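{- Let $\lambda\in\mathcal{P}^k$ and $1\le r\le k$, and put $\widetilde{h}_r=h_0+h_1+\dots+h_r$ (with $h_0=1$). Then \[ \widetilde{g}^{(k)}_{\lambda}\,\widetilde{h}_r=\sum_{\mu} g^{(k)}_{\mu}, \] where the sum runs (each $\mu$ once) over all $\mu\in\mathcal{P}^k$ such that $\mu\le\kappa$ (strong order) for some $\kappa\in\mathcal{P}^k$ such that $\kappa/\lambda$ is a weak strip of size $r$.
   Context: Fix a positive integer $k$. Let $I=\mathbb{Z}/(k+1)\mathbb{Z}=\{0,1,\dots,k\}$ and let $W=\tilde S_{k+1}$ be the affine symmetric group with Coxeter generators $s_i$ ($i\in I$), relations $s_i^2=1$, $s_is_{i+1}s_i=s_{i+1}s_is_{i+1}$, and $s_is_j=s_js_i$ when $i-j\not\equiv 0,\pm1 \pmod{k+1}$. Let $l$ be the length function, $\le$ the strong (Bruhat) order, and $\le_L$ the left weak order: $u\le_L v$ iff $l(vu^{ -1})+l(u)=l(v)$. Let $W^\circ\subset W$ be the set of affine Grassmannian elements, i.e. $w$ with $ws_i>w$ for all $i\in\{1,\dots,k\}$. For $A\subsetneq I$, $d_A=s_{i_1}\cdots s_{i_m}$ where $A=\{i_1,\dots,i_m\}$ and the word $i_1\cdots i_m$ is cyclically decreasing (distinct letters, and no $j$ occurs to the left of $j+1$, indices mod $k+1$); this is independent of the choice of word. $\mathcal{P}^k$ is the set of partitions $\lambda$ with $\lambda_1\le k$. The residue of the cell in row $i$, column $j$ is $j-i \bmod (k+1)$. For $\lambda\in\mathcal{P}^k$,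 $w_\lambda=s_{i_1}\cdots s_{i_l}$ where $(i_1,\dots,i_l)$ are the residues of the cells of $\lambda$ read from the shortest row to the longest, each row from right to left; $\lambda\mapsto w_\lambda$ is a bijection $\mathcal{P}^k\to W^\circ$, and $\mathcal P^k$ carries the strong order $\mu\le\lambda\iff w_\mu\le w_\lambda$. For $\lambda,\kappa\in\mathcal{P}^k$, $\kappa/\lambda$ is a weak strip of size $r$ if $w_\kappa=d_Aw_\lambda\ge_L w_\lambda$ for some $A\subsetneq I$ with $|A|=r$. Demazure action: for $s=s_i$, $\phi_s(x)=sx$ if $sx>x$ and $\phi_s(x)=x$ otherwise; for $x=t_1\cdots t_n$ reduced, $x*y=\phi_{t_1}\cdots\phi_{t_n}(y)$. Let $h_r$ be the complete homogeneous symmetric functions and $\Lambda^{(k)}=\mathbb{Z}[h_1,\dots,h_k]$. The $K$-$k$-Schur functions $\{g^{(k)}_w\}_{w\in W^\circ}$ are the family (a basis of $\Lambda^{(k)}$) determined by $g^{(k)}_e=1$ and, for $w\in W^\circ$ and $1\le r\le k$, $h_r\,g^{(k)}_w=\sum (-1)^{r+l(w)-l(d_A*w)} g^{(k)}_{d_A*w}$, summed over $A\subsetneq I$ with $|A|=r$ and $d_A*w\in W^\circ$. Write $g^{(k)}_\lambda=g^{(k)}_{w_\lambda}$ and $\widetilde{g}^{(k)}_{\lambda}=\sum_{\mu\in\mathcal{P}^k,\ \mu\le\lambda} g^{(k)}_{\mu}$. -}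

module Defs where

open import Data.Nat as ℕ using (ℕ; zero; suc; _≤_; _<ᵇ_; _≡ᵇ_)
open import Data.Nat.DivMod as NDM using ()
open import Data.Integer as ℤ using (ℤ; +_; _/ℕ_; _%ℕ_; ∣_∣; 0ℤ; 1ℤ; -1ℤ)
open import Data.Integer.Properties using () renaming (_≟_ to _≟ℤ_)
open import Data.Fin as Fin using (Fin; toℕ)
open import Data.Fin.Subset using (Subset; ⊤; inside; outside) renaming (∣_∣ to ∣_∣ˢ)
open import Data.Vec as Vec using (Vec; []; _∷_)
open import Data.List as List using (List; []; _∷_; map; concatMap; upTo; reverse; zip; length; allFin; filter)
open import Data.List.Properties using (≡-dec)
open import Data.List.Relation.Unary.All using (All)
open import Data.List.Relation.Unary.Linked using (Linked)
open import Data.List.Relation.Binary.Sublist.Propositional using (_⊆_)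
open import Data.Bool using (Bool; true; false; if_then_else_; _∧_)
open import Data.Product using (Σ; ∃; _×_; _,_)
open import Relation.Binary.PropositionalEquality using (_≡_; _≢_)
open import Relation.Nullary using (¬_; does)

-- Throughout, k is the fixed positive integer and n = k + 1 = |I|.
-- I = ℤ/(k+1) is represented by Fin (suc k).
--
-- The affine symmetric group W is realised (standard realisation,
-- Björner–Brenti §8.3) as the group of bijections f : ℤ → ℤ with
-- f(m + n) = f(m) + n and f(1)+…+f(n) = 1+…+n, under composition;
-- an element is stored by its window [f(1),…,f(n)] (a List ℤ of length n),
-- so that ≡ on windows is equality in W.  The Coxeter generator s_i
-- swaps the residue classes i and i+1 (mod n).

Window : Set
Window = List ℤ

allᵇ : {A : Set} → (A → Bool) → List A → Bool
allᵇ p = List.foldr (λ a b → p a ∧ b) true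

module _ (k : ℕ) where

  private
    n : ℕ
    n = suc k

  positions : List ℤ
  positions = map (λ i → + suc i) (upTo n)

  lookupD : List ℤ → ℕ → ℤ
  lookupD []       _       = 0ℤ
  lookupD (x ∷ xs) zero    = x
  lookupD (x ∷ xs) (suc i) = lookupD xs i

  eval : Window → ℤ → ℤ
  eval w m = lookupD w ((m ℤ.- 1ℤ) %ℕ n) ℤ.+ ((m ℤ.- 1ℤ) /ℕ n) ℤ.* (+ n)

  idW : Window
  idW = positions

  _∘W_ : Window → Window → Window
  u ∘W v = map (λ j → eval u (eval v j)) positions

  sfun : Fin n → ℤ → ℤ
  sfun i m =
    if (m %ℕ n) ≡ᵇ toℕ i then m ℤ.+ 1ℤ
    else if (m %ℕ n) ≡ᵇ (suc (toℕ i) ℕ.% n) then m ℤ.- 1ℤ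
    else m

  gen : Fin n → Window
  gen i = map (sfun i) positions

  prod : List (Fin n) → Window
  prod []       = idW
  prod (a ∷ as) = gen a ∘W prod as

  -- inverse: f⁻¹(j) = i - q n  where f(i) = j + q n, 1 ≤ i ≤ n
  invAt : Window → ℤ → ℤ
  invAt w j = go positions
    where
    go : List ℤ → ℤ
    go []       = 0ℤ
    go (i ∷ is) = if ((eval w i ℤ.- j) %ℕ n) ≡ᵇ 0
                  then i ℤ.- ((eval w i ℤ.- j) /ℕ n) ℤ.* (+ n)
                  else go is

  inverse : Window → Window
  inverse w = map (invAt w) positions

  -- Coxeter length, via the inversion formula (Shi; Björner–Brenti 8.3.1):
  -- l(w) = Σ_{1≤i<j≤n} | ⌊(w(j) − w(i)) / n⌋ |
  len : Window → ℕ
  len w = List.foldr ℕ._+_ 0 (concatMap (λ i → map (λ j → ∣ (eval w (+ suc j) ℤ.- eval w (+ suc i)) /ℕ n ∣)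
                                   (List.drop (suc i) (upTo n)))
                         (upTo n))

  -- strong (Bruhat) order, by the subword property:
  -- u ≤ v iff some reduced word of v has a subword that is a reduced word of u
  Bruhat : Window → Window → Set
  Bruhat u v = Σ (List (Fin n)) λ ws → prod ws ≡ v × length ws ≡ len v ×
               Σ (List (Fin n)) λ us → us ⊆ ws × prod us ≡ u × length us ≡ len u

  LeftWeak : Window → Window → Set
  LeftWeak u v = len (v ∘W inverse u) ℕ.+ len u ≡ len v

  -- "s x > x" for a simple reflection s (equivalently l(sx) > l(x))
  -- Demazure operator φ_s
  phi : Fin n → Window → Window
  phi i x = if len x <ᵇ len (gen i ∘W x) then gen i ∘W x else x

  -- x * y for x given by a reduced word t_1 ⋯ t_m : φ_{t_1} ⋯ φ_{t_m}(y)
  demazure : List (Fin n) → Window → Window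
  demazure ts y = List.foldr phi y ts

  isGrass : Window → Bool
  isGrass w = allᵇ (λ i → (toℕ i ≡ᵇ 0) Data.Bool.∨ (len w <ᵇ len (w ∘W gen i))) (allFin n)

  _∈ᵇ_ : Fin n → Subset n → Bool
  i ∈ᵇ A = Vec.lookup A i

  -- a cyclically decreasing word for A ⊊ I: with j the least element not in A,
  -- list the elements of A in the order j-1, j-2, …, j+1 (mod n).
  firstOut : Subset n → ℕ
  firstOut A = go (allFin n)
    where
    go : List (Fin n) → ℕ
    go []       = 0
    go (i ∷ is) = if i ∈ᵇ A then go is else toℕ i

  cdWord : Subset n → List (Fin n)
  cdWord A = filter (λ i → Relation.Nullary.Decidable.Core.T? (i ∈ᵇ A))
                    (map (λ t → NDM._mod_ (firstOut A ℕ.+ n ℕ.∸ suc t) n) (upTo k))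
    where import Relation.Nullary.Decidable.Core

  dA : Subset n → Window
  dA A = prod (cdWord A)

  allSubsets : (m : ℕ) → List (Subset m)
  allSubsets zero    = [] ∷ []
  allSubsets (suc m) = concatMap (λ s → (outside ∷ s) ∷ (inside ∷ s) ∷ []) (allSubsets m)

  isFull : Subset n → Bool
  isFull A = allᵇ (λ i → i ∈ᵇ A) (allFin n)

  -- Λ^(k) is represented in the K-k-Schur basis: a formal ℤ-combination
  -- Σ c_w g_w is a finite list of pairs (c_w , w) (w a window in W°);
  -- its coefficient at x is the sum of the c's paired with x.

  FSum : Set
  FSum = List (ℤ × Window)

  coeff : Window → FSum → ℤ
  coeff x F = List.foldr ℤ._+_ 0ℤ (map (λ { (c , w) → if does (≡-dec _≟ℤ_ w x) then c else 0ℤ }) F)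

  -- (-1)^{r + l(w) - l(y)} (same parity as r + l(w) + l(y))
  sign : ℕ → ℕ → ℕ → ℤ
  sign r a b = if ((r ℕ.+ a ℕ.+ b) ℕ.% 2) ≡ᵇ 0 then 1ℤ else -1ℤ

  -- Pieri rule (definition of the g's): for 1 ≤ r ≤ k,
  -- h_r g_w = Σ_{A ⊊ I, |A| = r, d_A * w ∈ W°} (-1)^{r+l(w)-l(d_A*w)} g_{d_A*w}
  pieri : ℕ → Window → FSum
  pieri r w = concatMap term (allSubsets n)
    where
    term : Subset n → FSum
    term A = let y = demazure (cdWord A) w in
             if (∣ A ∣ˢ ≡ᵇ r) ∧ Data.Bool.not (isFull A) ∧ isGrass y
             then (sign r (len w) (len y) , y) ∷ [] else []

  hmul : ℕ → FSum → FSum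
  hmul zero    F = F
  hmul (suc r) F = concatMap (λ { (c , w) → map (λ { (e , y) → (c ℤ.* e , y) }) (pieri (suc r) w) }) F

  htilde : ℕ → FSum → FSum
  htilde r F = concatMap (λ j → hmul j F) (upTo (suc r))

  Pk : List ℕ → Set
  Pk la = Linked ℕ._≥_ la × All (λ x → 1 ≤ x × x ≤ k) la

  res : ℕ → ℕ → Fin n
  res i j = NDM._mod_ ((+ j ℤ.- + i) %ℕ n) n

  readingWord : List ℕ → List (Fin n)
  readingWord la =
    concatMap (λ { (i , li) → map (λ j → res i j) (reverse (map suc (upTo li))) })
              (reverse (zip (map suc (upTo (length la))) la))

  wOf : List ℕ → Window
  wOf la = prod (readingWord la)

  WeakStrip : List ℕ → List ℕ → ℕ → Set
  WeakStrip ka la r = Σ (Subset n) λ A → A ≢ ⊤ × ∣ A ∣ˢ ≡ r ×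
                      wOf ka ≡ dA A ∘W wOf la × LeftWeak (wOf la) (wOf ka)

  -- support of g̃_λ : windows w_μ with μ ∈ P^k, μ ≤ λ
  GSupp : List ℕ → Window → Set
  GSupp la x = Σ (List ℕ) λ mu → Pk mu × Bruhat (wOf mu) (wOf la) × wOf mu ≡ x

  StripSupp : List ℕ → ℕ → Window → Set
  StripSupp la r x = Σ (List ℕ) λ mu → Pk mu × wOf mu ≡ x ×
                     Σ (List ℕ) λ ka → Pk ka × WeakStrip ka la r × Bruhat (wOf mu) (wOf ka)

  IsIndicator : FSum → (Window → Set) → Set
  IsIndicator F P = ∀ x → (P x → coeff x F ≡ 1ℤ) × (¬ P x → coeff x F ≡ 0ℤ)

{-# OPTIONS --safe #-}
module Submission where

-- Identify w ∈ W with its action on ℤ and call p a bead of w if w⁻¹(p) ≤ 0. A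
-- Grassmannian element is determined by its beads, hence by the function c_w
-- counting the beads to the right of each position, and for Grassmannian x the
-- strong order is comparison of these functions: x ≤ w iff c_x ≤ c_w pointwise.
-- On coefficient functions, s_i acts in the Pieri rule by
-- (D_i φ)(x) = φ(min(x, s_i x)) - φ(x). Applying D_A to the indicator of
-- {x : c_x ≤ d}, d = c_λ, gives the indicator of those x which satisfy
-- c_x(p) ≤ d(p + 1) + 1 for p in a class of A and c_x(p) ≤ d(p) otherwise, and
-- which exceed d somewhere on every class of A. These conditions force A to
-- be the set E of classes on which c_x exceeds d. So at most one A contributes
-- to the coefficient at x, and some A with |A| ≤ r does iff x lies below some
-- d_A w_λ with |A| = r, because a smaller E can be enlarged by letting the last
-- bead of w_λ travel further.

open import Data.Nat using (ℕ)
open import Defs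
open import Data.Nat as ℕ using (zero; suc; z≤n; s≤s; _∸_)
import Data.Nat.Properties as ℕₚ
import Data.Nat.DivMod as ℕd
open import Data.Integer using (ℤ; +_; -[1+_]; +[1+_]; _+_; _-_; _*_; -_; _≤_; _<_; _/ℕ_; _%ℕ_; 0ℤ; 1ℤ; -1ℤ; ∣_∣; +≤+; +<+; -≤+; -≤-)
import Data.Integer.Properties as ℤₚ
open import Data.Integer.DivMod using (n%ℕd<d; a≡a%ℕn+[a/ℕn]*n; 0≤n⇒0≤n/ℕd)
open import Data.Integer.Tactic.RingSolver using (solve-∀)
open import Data.Nat.Tactic.RingSolver using () renaming (solve-∀ to ℕsolve-∀)
open import Data.Fin as Fin using (Fin; toℕ; fromℕ<)
import Data.Fin.Properties as Finₚ
open import Data.List as List using (List; []; _∷_; _++_; map; concatMap; upTo; applyUpTo; length; reverse; allFin; filter; zip)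
import Data.List.Properties as Listₚ
open import Data.Nat.ListAction using (sum)
open import Data.Nat.ListAction.Properties using (sum-++)
open import Data.List.Relation.Unary.Any as Any using (Any; here; there)
open import Data.List.Relation.Unary.All as All using (All; []; _∷_)
open import Data.List.Relation.Binary.Sublist.Propositional using (_⊆_; []; _∷_; _∷ʳ_)
import Data.List.Relation.Unary.All.Properties as Allₚ
open import Data.List.Relation.Unary.Linked using (Linked; []; [-]; _∷_)
open import Data.List.Reverse using (Reverse; reverseView; []; _∶_∶ʳ_)
open import Data.List.Relation.Unary.AllPairs as AllPairs using (AllPairs; []; _∷_)
import Data.List.Relation.Unary.AllPairs.Properties as AllPairsₚ
open import Data.List.Relation.Unary.Unique.Propositional using (Unique)
open import Data.List.Relation.Unary.Unique.Propositional.Properties using (allFin⁺; upTo⁺)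
open import Data.List.Membership.Propositional using (_∈_)
open import Data.List.Membership.Propositional.Properties using (∈-filter⁺; ∈-filter⁻; ∈-tabulate⁺; ∈-map⁺; ∈-upTo⁺; ∈-upTo⁻)
open import Data.List.Membership.Propositional.Properties.WithK using (unique∧set⇒bag)
open import Data.List.Relation.Binary.BagAndSetEquality using (∼bag⇒↭)
open import Data.List.Relation.Binary.Permutation.Propositional.Properties using (↭-length)
import Data.Vec as Vec
import Data.Vec.Properties as Vecₚ
open import Data.Fin.Subset.Properties using (∣⊤∣≡n)
open import Data.Fin.Subset using (Subset) renaming (⊤ to full; ∣_∣ to ∣_∣ˢ)
open import Data.Bool.Properties using (∨-zeroʳ)
open import Data.Bool using (Bool; true; false; if_then_else_; T; _∧_; _∨_; not)
open import Data.Product using (∃; _×_; _,_; proj₁; proj₂)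
open import Data.Sum using (_⊎_; inj₁; inj₂)
open import Data.Empty using (⊥; ⊥-elim)
open import Data.Unit using (⊤; tt)
open import Relation.Nullary using (¬_; Dec; yes; no; does)
open import Relation.Nullary.Decidable using (decidable-stable; T?)
open import Relation.Binary.PropositionalEquality
open import Relation.Binary using (tri<; tri≈; tri>)
open import Function using (_∘_; id; mk⇔)

-- On the indicator of a single y, `D_i` gives the indicator of s_i y when that is longer, and minus
-- the indicator of y otherwise. This is one Demazure step together with its sign, so for each A the
-- signed rule becomes a composition of operators `D_i`, and on the sets that occur here each of
-- them is a difference of nested indicators. Cyclic decrease keeps the outcome local: when the
-- letter i acts, no letter i + 1 has acted before it, so at a site p of class i the comparison is
-- with the original d(p + 1).
--
-- The obstacle is logical. Whether c_x exceeds d on a class is a question about infinitely many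
-- sites, and no decision procedure is given for membership in either support. Every coefficient
-- claim, however, is an equality of integers, which is stable under double negation, so E may be
-- assumed to be given as a subset. Actual sites of excess are needed only to construct a weak
-- strip, and there it is the absence of a strip that is being refuted.

module Affine (j : ℕ) where

  -- Residue classes modulo n and the action of words on ℤ

  -- Writing k as `suc j` gives n ≥ 2 by computation, so that p and p + 1 always lie in different
  -- classes.
  K n : ℕ
  K = suc j
  n = suc K

  N : ℤ
  N = + n

  abstract
    -- Linear inequalities are transported along an equality of differences, because that equality
    -- can be left to the ring solver.
    ≤⇒ : ∀ {a b x y} → a ≤ b → y - x ≡ b - a → x ≤ y
    ≤⇒ {a} {b} {x} {y} p e =
      ℤₚ.≤-trans (ℤₚ.≤-reflexive (l₁ x a))
        (ℤₚ.≤-trans (ℤₚ.+-monoʳ-≤ (x - a) p)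
        (ℤₚ.≤-reflexive (trans (l₂ x a b) (trans (cong (_+_ x) (sym e)) (l₃ x y)))))
      where
      l₁ : ∀ x a → x ≡ (x - a) + a
      l₁ = solve-∀
      l₂ : ∀ x a b → (x - a) + b ≡ x + (b - a)
      l₂ = solve-∀
      l₃ : ∀ x y → x + (y - x) ≡ y
      l₃ = solve-∀

    <⇒≤1 : ∀ {a b} → a < b → a + 1ℤ ≤ b
    <⇒≤1 {a} p = ℤₚ.≤-trans (ℤₚ.≤-reflexive (ℤₚ.+-comm a 1ℤ)) (ℤₚ.i<j⇒suc[i]≤j p)

    ≤1⇒< : ∀ {a b} → a + 1ℤ ≤ b → a < b
    ≤1⇒< {a} p = ℤₚ.suc[i]≤j⇒i<j (ℤₚ.≤-trans (ℤₚ.≤-reflexive (ℤₚ.+-comm 1ℤ a)) p)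

    <⇒ : ∀ {a b x y} → a < b → y - x ≡ b - a → x < y
    <⇒ {a} {b} {x} {y} p e = ≤1⇒< (≤⇒ (<⇒≤1 p) (trans (l y x) (trans (cong (_- 1ℤ) e) (sym (l b a)))))
      where
      l : ∀ y x → y - (x + 1ℤ) ≡ (y - x) - 1ℤ
      l = solve-∀

    +1-1 : ∀ p → p + 1ℤ - 1ℤ ≡ p
    +1-1 = solve-∀

    -1+1 : ∀ p → p - 1ℤ + 1ℤ ≡ p
    -1+1 = solve-∀

    p<p+1 : ∀ p → p < p + 1ℤ
    p<p+1 p = ≤1⇒< ℤₚ.≤-refl

    p≢p+1 : ∀ p → p ≢ p + 1ℤ
    p≢p+1 p e = ℤₚ.<-irrefl e (p<p+1 p)

    0≤+ : ∀ m → 0ℤ ≤ + m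
    0≤+ m = +≤+ z≤n

    N*-mono : ∀ {a b} → a ≤ b → a * N ≤ b * N
    N*-mono = ℤₚ.*-monoʳ-≤-nonNeg N

    +-cancelˡ : ∀ a {b c} → a + b ≡ a + c → b ≡ c
    +-cancelˡ a {b} {c} e = trans (l a b) (trans (cong (_- a) e) (sym (l a c)))
      where
      l : ∀ a b → b ≡ a + b - a
      l = solve-∀

    quot≤ : ∀ {q q' r r'} → r ℕ.< n → + r + q * N ≡ + r' + q' * N → q' ≤ q
    quot≤ {q} {q'} {r} {r'} r<n e with q' ℤₚ.≤? q
    ... | yes p = p
    ... | no np = ⊥-elim (ℤₚ.<-irrefl refl
      (ℤₚ.≤-<-trans (ℤₚ.≤-trans big (≤⇒ (0≤+ r') (l₂ (+ r') (q' * N)))) top'))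
      where
      l₂ : ∀ a b → a + b - b ≡ a - 0ℤ
      l₂ = solve-∀
      l₁ : ∀ a b → (a + 1ℤ) * b ≡ b + a * b
      l₁ = solve-∀
      big : N + q * N ≤ q' * N
      big = ℤₚ.≤-trans (ℤₚ.≤-reflexive (sym (l₁ q N))) (N*-mono (<⇒≤1 (ℤₚ.≰⇒> np)))
      top' : + r' + q' * N < N + q * N
      top' = subst (_< N + q * N) e (ℤₚ.+-monoˡ-< (q * N) (+<+ r<n))

    divmod-unique : ∀ m q r → r ℕ.< n → m ≡ + r + q * N → m %ℕ n ≡ r × m /ℕ n ≡ q
    divmod-unique m q r r<n e = ℤₚ.+-injective
      (+-cancelˡ (q * N) (trans (ℤₚ.+-comm (q * N) _) (trans e' (ℤₚ.+-comm (+ r) (q * N))))) , q≡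
      where
      e₀ : + (m %ℕ n) + (m /ℕ n) * N ≡ + r + q * N
      e₀ = trans (sym (a≡a%ℕn+[a/ℕn]*n m n)) e
      q≡ : m /ℕ n ≡ q
      q≡ = ℤₚ.≤-antisym (quot≤ r<n (sym e₀)) (quot≤ (n%ℕd<d m n) e₀)
      e' : + (m %ℕ n) + q * N ≡ + r + q * N
      e' = trans (cong (λ z → + (m %ℕ n) + z * N) (sym q≡)) e₀

  infix 4 _∼_

  -- An explicit multiple of `N` instead of an equation between remainders, so that shifts by
  -- periods become ring identities. `∼⇒%` and `%⇒∼` connect it with the tests in `sfun`.
  _∼_ : ℤ → Fin n → Set
  p ∼ i = ∃ λ c → p ≡ + toℕ i + c * N

  abstract
    ∼⇒% : ∀ {p i} → p ∼ i → p %ℕ n ≡ toℕ i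
    ∼⇒% {p} {i} (c , e) = proj₁ (divmod-unique p c (toℕ i) (Finₚ.toℕ<n i) e)

    %⇒∼ : ∀ {p i} → p %ℕ n ≡ toℕ i → p ∼ i
    %⇒∼ {p} e = p /ℕ n , trans (a≡a%ℕn+[a/ℕn]*n p n) (cong (λ z → + z + (p /ℕ n) * N) e)

    _∼?_ : ∀ p i → Dec (p ∼ i)
    p ∼? i with (p %ℕ n) ℕ.≟ toℕ i
    ... | yes e = yes (%⇒∼ e)
    ... | no ne = no (ne ∘ ∼⇒%)

  cl : ℤ → Fin n
  cl p = fromℕ< (n%ℕd<d p n)

  abstract
    ∼cl : ∀ p → p ∼ cl p
    ∼cl p = %⇒∼ (sym (Finₚ.toℕ-fromℕ< (n%ℕd<d p n)))

    ∼-unique : ∀ {p i i'} → p ∼ i → p ∼ i' → i ≡ i'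
    ∼-unique a b = Finₚ.toℕ-injective (trans (sym (∼⇒% a)) (∼⇒% b))

    ∼-shift : ∀ {p i} c → p ∼ i → (p + c * N) ∼ i
    ∼-shift {p} {i} c (d , e) = d + c , trans (cong (_+ c * N) e) (l (+ toℕ i) d c N)
      where
      l : ∀ t d c m → t + d * m + c * m ≡ t + (d + c) * m
      l = solve-∀

    ∼-diff : ∀ {p q i} → p ∼ i → q ∼ i → ∃ λ c → q ≡ p + c * N
    ∼-diff {p} {q} {i} (c , e) (d , e') = d - c , trans e'
      (trans (l (+ toℕ i) c d N) (cong (_+ (d - c) * N) (sym e)))
      where
      l : ∀ t c d m → t + d * m ≡ t + c * m + (d - c) * m
      l = solve-∀

    ∼-transfer : ∀ {p q i i'} → p ∼ i → q ∼ i → p ∼ i' → q ∼ i'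
    ∼-transfer a b c = subst (_ ∼_) (∼-unique a c) b

    small-multiple : ∀ {t} c → t ℕ.< n → + t ≡ c * N → t ≡ 0
    small-multiple {t} c t<n e =
      trans (sym (proj₁ (divmod-unique (+ t) 0ℤ t t<n (l₁ (+ t) N))))
        (proj₁ (divmod-unique (+ t) c 0 (s≤s z≤n) (trans e (sym (ℤₚ.+-identityˡ _)))))
      where
      l₁ : ∀ t m → t ≡ t + 0ℤ * m
      l₁ = solve-∀

    ∼-separated : ∀ {p i t} → p ∼ i → (p + + t) ∼ i → t ℕ.< n → t ≡ 0
    ∼-separated {p} {i} {t} a b t<n with ∼-diff a b
    ... | c , e = small-multiple c t<n (+-cancelˡ p e)

    ¬∼+1 : ∀ {p i} → p ∼ i → ¬ (p + 1ℤ) ∼ i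
    ¬∼+1 a b with ∼-separated {t = 1} a b (s≤s (s≤s z≤n))
    ... | ()

    ¬∼-1 : ∀ {p i} → p ∼ i → ¬ (p - 1ℤ) ∼ i
    ¬∼-1 {p} {i} a b = ¬∼+1 b (subst (_∼ i) (sym (-1+1 p)) a)

    nat%ℕ : ∀ m c → (+ m + c * N) %ℕ n ≡ m ℕ.% n
    nat%ℕ m c = proj₁ (divmod-unique (+ m + c * N) (+ (m ℕ./ n) + c) (m ℕ.% n) (ℕd.m%n<n m n) eq)
      where
      l : ∀ a b c d → a + b * d + c * d ≡ a + (b + c) * d
      l = solve-∀
      eq : + m + c * N ≡ + (m ℕ.% n) + (+ (m ℕ./ n) + c) * N
      eq = trans (cong (λ z → + z + c * N) (ℕd.m≡m%n+[m/n]*n m n))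
             (trans (cong (λ z → + (m ℕ.% n) + z + c * N) (ℤₚ.pos-* (m ℕ./ n) n))
               (l (+ (m ℕ.% n)) (+ (m ℕ./ n)) c N))

    ≡ᵇ-true : ∀ {a b} → a ≡ b → (a ℕ.≡ᵇ b) ≡ true
    ≡ᵇ-true {a} refl with a ℕ.≡ᵇ a | ℕₚ.≡⇒≡ᵇ a a refl
    ... | true | _ = refl

    ≡ᵇ-false : ∀ {a b} → a ≢ b → (a ℕ.≡ᵇ b) ≡ false
    ≡ᵇ-false {a} {b} ne with a ℕ.≡ᵇ b | ℕₚ.≡ᵇ⇒≡ a b
    ... | true | h = ⊥-elim (ne (h tt))
    ... | false | _ = refl

    ∼⇒suc% : ∀ {i p} → p ∼ i → (p + 1ℤ) %ℕ n ≡ suc (toℕ i) ℕ.% n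
    ∼⇒suc% {i} {p} (c , e) = trans (cong (_%ℕ n) (trans (cong (_+ 1ℤ) e) (l (+ toℕ i) (c * N))))
      (nat%ℕ (suc (toℕ i)) c)
      where
      l : ∀ a b → a + b + 1ℤ ≡ 1ℤ + a + b
      l = solve-∀

    suc%⇒∼ : ∀ {i p} → p %ℕ n ≡ suc (toℕ i) ℕ.% n → (p - 1ℤ) ∼ i
    suc%⇒∼ {i} {p} e = (p /ℕ n) - + (suc (toℕ i) ℕ./ n) ,
        trans (cong (_- 1ℤ) (trans (a≡a%ℕn+[a/ℕn]*n p n) (cong (λ z → + z + (p /ℕ n) * N) e)))
          (l (+ (suc (toℕ i) ℕ.% n)) (p /ℕ n) (+ (suc (toℕ i) ℕ./ n)) (+ toℕ i) N
            (trans (cong +_ (ℕd.m≡m%n+[m/n]*n (suc (toℕ i)) n))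
                   (cong (λ z → + (suc (toℕ i) ℕ.% n) + z) (ℤₚ.pos-* (suc (toℕ i) ℕ./ n) n))))
      where
      l : ∀ r q q' a m → 1ℤ + a ≡ r + q' * m → r + q * m - 1ℤ ≡ a + (q - q') * m
      l r q q' a m e = trans (l₁ r q q' m) (trans (cong (_+ ((q - q') * m - 1ℤ)) (sym e)) (l₂ a ((q - q') * m)))
        where
        l₁ : ∀ r q q' m → r + q * m - 1ℤ ≡ r + q' * m + ((q - q') * m - 1ℤ)
        l₁ = solve-∀
        l₂ : ∀ a b → 1ℤ + a + (b - 1ℤ) ≡ a + b
        l₂ = solve-∀

    s-up′ : ∀ {i p} → p ∼ i → sfun K i p ≡ p + 1ℤ
    s-up′ {i} {p} a rewrite ≡ᵇ-true (∼⇒% a) = refl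

    s-dn′ : ∀ {i p} → p ∼ i → sfun K i (p + 1ℤ) ≡ p
    s-dn′ {i} {p} a rewrite ≡ᵇ-false {(p + 1ℤ) %ℕ n} {toℕ i} (λ e → ¬∼+1 a (%⇒∼ e))
                         | ≡ᵇ-true (∼⇒suc% a) = +1-1 p

    s-fix′ : ∀ {i p} → ¬ p ∼ i → ¬ (p - 1ℤ) ∼ i → sfun K i p ≡ p
    s-fix′ {i} {p} a b rewrite ≡ᵇ-false {p %ℕ n} {toℕ i} (a ∘ %⇒∼)
                         | ≡ᵇ-false {p %ℕ n} {suc (toℕ i) ℕ.% n} (λ e → b (suc%⇒∼ {i} {p} e)) = refl

  -- Opaque, so that unification never unfolds the tests on residues in sfun.
  abstract
    s : Fin n → ℤ → ℤ
    s = sfun K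

    s-up : ∀ {i p} → p ∼ i → s i p ≡ p + 1ℤ
    s-up = s-up′

    s-dn : ∀ {i p} → p ∼ i → s i (p + 1ℤ) ≡ p
    s-dn = s-dn′

    s-fix : ∀ {i p} → ¬ p ∼ i → ¬ (p - 1ℤ) ∼ i → s i p ≡ p
    s-fix = s-fix′

    sfun≡s : ∀ i p → sfun K i p ≡ s i p
    sfun≡s i p = refl

  -- `isDn` is indexed by p + 1, so that matching presents the upper site of an exchanged pair
  -- through the lower one, which is the site of class i.
  data View (i : Fin n) : ℤ → Set where
    isUp  : ∀ {p} → p ∼ i → View i p
    isDn  : ∀ {p} → p ∼ i → View i (p + 1ℤ)
    isFix : ∀ {p} → ¬ p ∼ i → ¬ (p - 1ℤ) ∼ i → View i p

  abstract
    view : ∀ i p → View i p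
    view i p with p ∼? i | (p - 1ℤ) ∼? i
    ... | yes a | _ = isUp a
    ... | no _ | yes b = subst (View i) (-1+1 p) (isDn b)
    ... | no a | no b = isFix a b

    s-invol : ∀ i p → s i (s i p) ≡ p
    s-invol i p with view i p
    ... | isUp a = trans (cong (s i) (s-up a)) (s-dn a)
    ... | isDn a = trans (cong (s i) (s-dn a)) (s-up a)
    ... | isFix a b = trans (cong (s i) (s-fix a b)) (s-fix a b)

  Periodic : (ℤ → ℤ) → Set
  Periodic F = ∀ m c → F (m + c * N) ≡ F m + c * N

  abstract
    +-swap : ∀ a b c → a + b + c ≡ a + c + b
    +-swap = solve-∀

    ¬∼-shift : ∀ {p i} c → ¬ p ∼ i → ¬ (p + c * N) ∼ i
    ¬∼-shift {p} {i} c h a = h (subst (_∼ i) (l p c N) (∼-shift (- c) a))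
      where
      l : ∀ p c m → p + c * m + - c * m ≡ p
      l = solve-∀

    s-periodic : ∀ i → Periodic (s i)
    s-periodic i m c with view i m
    ... | isUp a = trans (s-up (∼-shift c a)) (trans (+-swap m (c * N) 1ℤ) (cong (_+ c * N) (sym (s-up a))))
    ... | isDn {p} a = trans (cong (s i) (+-swap p 1ℤ (c * N)))
      (trans (s-dn (∼-shift c a)) (cong (_+ c * N) (sym (s-dn a))))
    ... | isFix a b = trans (s-fix (¬∼-shift c a) (¬∼-shift c b ∘ subst (_∼ i) (+-swap m (c * N) -1ℤ)))
      (cong (_+ c * N) (sym (s-fix a b)))

  Word : Set
  Word = List (Fin n)

  -- `f ws` is the group element and `g ws` its inverse. Prefixing a letter precomposes `g` with
  -- `s i`, so left multiplication merely permutes sites; this is why beads, ascents and lengths are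
  -- all read off `g`.
  f g : Word → ℤ → ℤ
  f [] p = p
  f (i ∷ ws) p = s i (f ws p)
  g [] p = p
  g (i ∷ ws) p = g ws (s i p)

  abstract
    f-g : ∀ ws p → f ws (g ws p) ≡ p
    f-g [] p = refl
    f-g (i ∷ ws) p = trans (cong (s i) (f-g ws _)) (s-invol i p)

    g-f : ∀ ws p → g ws (f ws p) ≡ p
    g-f [] p = refl
    g-f (i ∷ ws) p = trans (cong (g ws) (s-invol i _)) (g-f ws p)

    f-periodic : ∀ ws → Periodic (f ws)
    f-periodic [] m c = refl
    f-periodic (i ∷ ws) m c = trans (cong (s i) (f-periodic ws m c)) (s-periodic i (f ws m) c)

    g-periodic : ∀ ws → Periodic (g ws)
    g-periodic [] m c = refl
    g-periodic (i ∷ ws) m c = trans (cong (g ws) (s-periodic i m c)) (g-periodic ws _ c)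

    g-inj : ∀ ws {p q} → g ws p ≡ g ws q → p ≡ q
    g-inj ws {p} {q} e = trans (sym (f-g ws p)) (trans (cong (f ws) e) (f-g ws q))

    f-inj : ∀ ws {p q} → f ws p ≡ f ws q → p ≡ q
    f-inj ws {p} {q} e = trans (sym (g-f ws p)) (trans (cong (g ws) e) (g-f ws q))

    -- Windows of periodic maps

    lookupD-map : ∀ (F : ℤ → ℤ) (h : ℕ → ℤ) (e : ℕ → ℕ) m r → r ℕ.< m → lookupD K
      (map F (map h (applyUpTo e m))) r ≡ F (h (e r))
    lookupD-map F h e (suc m) zero p = refl
    lookupD-map F h e (suc m) (suc r) (s≤s p) = lookupD-map F h (e ∘ suc) m r p

    eval-map : ∀ {F} → Periodic F → ∀ p → eval K (map F (positions K)) p ≡ F p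
    eval-map {F} per p =
      trans (cong (_+ ((p - 1ℤ) /ℕ n) * N) (lookupD-map F (λ i → + suc i) id n r (n%ℕd<d (p - 1ℤ) n)))
        (trans (sym (per (+ suc r) ((p - 1ℤ) /ℕ n))) (cong F eq))
      where
      r : ℕ
      r = (p - 1ℤ) %ℕ n
      l : ∀ a b → 1ℤ + a + b ≡ a + b + 1ℤ
      l = solve-∀
      eq : + suc r + ((p - 1ℤ) /ℕ n) * N ≡ p
      eq = trans (l (+ r) (((p - 1ℤ) /ℕ n) * N))
        (trans (cong (_+ 1ℤ) (sym (a≡a%ℕn+[a/ℕn]*n (p - 1ℤ) n))) (-1+1 p))

    ∘W-map : ∀ {F G} → Periodic F → Periodic G → _∘W_ K (map F (positions K)) (map G (positions K)) ≡ map
      (F ∘ G) (positions K)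
    ∘W-map {F} {G} pF pG = Listₚ.map-cong
      (λ p → trans (cong (eval K (map F (positions K))) (eval-map pG p)) (eval-map pF (G p))) (positions K)

    prod-f : ∀ ws → prod K ws ≡ map (f ws) (positions K)
    prod-f [] = sym (Listₚ.map-id (positions K))
    prod-f (i ∷ ws) = trans (cong₂ (_∘W_ K) (Listₚ.map-cong (sfun≡s i) (positions K)) (prod-f ws))
      (∘W-map (s-periodic i) (f-periodic ws))

    eval-prod : ∀ ws p → eval K (prod K ws) p ≡ f ws p
    eval-prod ws p = trans (cong (λ w → eval K w p) (prod-f ws)) (eval-map (f-periodic ws) p)

    f⇒prod : ∀ us ws → (∀ p → f us p ≡ f ws p) → prod K us ≡ prod K ws
    f⇒prod us ws e = trans (prod-f us) (trans (Listₚ.map-cong e (positions K)) (sym (prod-f ws)))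

    prod⇒f : ∀ us ws → prod K us ≡ prod K ws → ∀ p → f us p ≡ f ws p
    prod⇒f us ws e p = trans (sym (eval-prod us p)) (trans (cong (λ w → eval K w p) e) (eval-prod ws p))

    f⇒g : ∀ us ws → (∀ p → f us p ≡ f ws p) → ∀ p → g us p ≡ g ws p
    f⇒g us ws e p = f-inj us (trans (f-g us p) (sym (trans (e _) (f-g ws p))))

    f-++ : ∀ us ws p → f (us ++ ws) p ≡ f us (f ws p)
    f-++ [] ws p = refl
    f-++ (i ∷ us) ws p = cong (s i) (f-++ us ws p)

    g-++ : ∀ us ws p → g (us ++ ws) p ≡ g ws (g us p)
    g-++ [] ws p = refl
    g-++ (i ∷ us) ws p = g-++ us ws (s i p)

    f-reverse : ∀ ws p → f (reverse ws) p ≡ g ws p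
    f-reverse [] p = refl
    f-reverse (i ∷ ws) p = trans (cong (λ w → f w p) (Listₚ.unfold-reverse i ws))
      (trans (f-++ (reverse ws) (i ∷ []) p) (f-reverse ws _))

    g-reverse : ∀ ws p → g (reverse ws) p ≡ f ws p
    g-reverse ws p = f-inj (reverse ws) (trans (f-g (reverse ws) p) (sym (trans (f-reverse ws _) (g-f ws p))))

    prod-++ : ∀ us ws → prod K (us ++ ws) ≡ _∘W_ K (prod K us) (prod K ws)
    prod-++ us ws = trans (prod-f (us ++ ws)) (trans (Listₚ.map-cong (f-++ us ws) (positions K))
      (sym (trans (cong₂ (_∘W_ K) (prod-f us) (prod-f ws)) (∘W-map (f-periodic us) (f-periodic ws)))))

  -- Length

  crossings : ℤ → ℤ → ℕ
  crossings a b = ∣ (b - a) /ℕ n ∣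

  rowSum : ℤ → List ℤ → ℕ
  rowSum a [] = 0
  rowSum a (b ∷ L) = crossings a b ℕ.+ rowSum a L

  colSum : ℤ → List ℤ → ℕ
  colSum c [] = 0
  colSum c (b ∷ L) = crossings b c ℕ.+ colSum c L

  inv : List ℤ → ℕ
  inv [] = 0
  inv (a ∷ L) = rowSum a L ℕ.+ inv L

  Win : (ℤ → ℤ) → ℤ → ℕ → List ℤ
  Win F b zero = []
  Win F b (suc m) = F b ∷ Win F (b + 1ℤ) m

  range : ℕ → ℕ → List ℕ
  range d zero = []
  range d (suc m) = d ∷ range (suc d) m

  abstract
    applyUpTo≡range : ∀ e d m → (∀ t → e t ≡ d ℕ.+ t) → applyUpTo e m ≡ range d m
    applyUpTo≡range e d zero eq = refl
    applyUpTo≡range e d (suc m) eq = cong₂ _∷_ (trans (eq 0) (ℕₚ.+-identityʳ d))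
      (applyUpTo≡range (e ∘ suc) (suc d) m (λ t → trans (eq (suc t)) (ℕₚ.+-suc d t)))

    drop-range : ∀ d a m → List.drop d (range a (d ℕ.+ m)) ≡ range (d ℕ.+ a) m
    drop-range zero a m = refl
    drop-range (suc d) a m = trans (drop-range d (suc a) m) (cong (λ z → range z m) (ℕₚ.+-suc d a))

    sum-map-crossings : ∀ (v : ℕ → ℤ) d L → sum (map (λ t → crossings (v d) (v t)) L) ≡ rowSum (v d) (map v L)
    sum-map-crossings v d [] = refl
    sum-map-crossings v d (x ∷ L) = cong (crossings (v d) (v x) ℕ.+_) (sum-map-crossings v d L)

    -- Stated for an arbitrary start `d`, so that the induction can peel off one row of the double
    -- sum while the list under `List.drop` remains the full one.
    sum-pairs : ∀ (v : ℕ → ℤ) N' d m → N' ≡ d ℕ.+ m →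
      sum (concatMap (λ i → map (λ t → crossings (v i) (v t)) (List.drop (suc i) (range 0 N')))
        (range d m)) ≡ inv (map v (range d m))
    sum-pairs v N' d zero e = refl
    sum-pairs v N' d (suc m) e =
      trans (sum-++ (map (λ t → crossings (v d) (v t)) (List.drop (suc d) (range 0 N'))) _)
        (cong₂ ℕ._+_ (trans (cong (λ L → sum (map (λ t → crossings (v d) (v t)) L)) tail≡)
          (sum-map-crossings v d (range (suc d) m)))
                     (sum-pairs v N' (suc d) m (trans e (ℕₚ.+-suc d m))))
      where
      tail≡ : List.drop (suc d) (range 0 N') ≡ range (suc d) m
      tail≡ = trans (cong (λ z → List.drop (suc d) (range 0 z)) (trans e (ℕₚ.+-suc d m)))
                (trans (drop-range (suc d) 0 m) (cong (λ z → range z m) (ℕₚ.+-identityʳ (suc d))))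

    map-range : ∀ F d m → map (λ t → F (+ suc t)) (range d m) ≡ Win F (+ suc d) m
    map-range F d zero = refl
    map-range F d (suc m) = cong (F (+ suc d) ∷_)
      (trans (map-range F (suc d) m) (cong (λ z → Win F z m) (cong +_ (sym (ℕₚ.+-comm (suc d) 1)))))

    len-map : ∀ {F} → Periodic F → len K (map F (positions K)) ≡ inv (Win F 1ℤ n)
    len-map {F} per =
      trans (cong (λ L → sum (concatMap (λ i → map (λ t → crossings (v i) (v t)) (List.drop (suc i) L)) L))
        (applyUpTo≡range id 0 n (λ _ → refl)))
        (trans (sum-pairs v n 0 n refl)
          (cong inv (trans (Listₚ.map-cong (λ t → eval-map {F} per (+ suc t)) (range 0 n)) (map-range F 0 n))))
      where
      v : ℕ → ℤ
      v t = eval K (map F (positions K)) (+ suc t)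

    Win-cong : ∀ {F G} → (∀ p → F p ≡ G p) → ∀ b m → Win F b m ≡ Win G b m
    Win-cong e b zero = refl
    Win-cong e b (suc m) = cong₂ _∷_ (e b) (Win-cong e (b + 1ℤ) m)

    +-suc-1 : ∀ b m → b + 1ℤ + + m ≡ b + + suc m
    +-suc-1 b m = ℤₚ.+-assoc b 1ℤ (+ m)

    Win-snoc : ∀ F b m → Win F b (suc m) ≡ Win F b m List.∷ʳ F (b + + m)
    Win-snoc F b zero = cong (λ z → F z ∷ []) (sym (ℤₚ.+-identityʳ b))
    Win-snoc F b (suc m) = cong (F b ∷_)
      (trans (Win-snoc F (b + 1ℤ) m) (cong (λ z → Win F (b + 1ℤ) m List.∷ʳ F z) (+-suc-1 b m)))

    inv-snoc : ∀ L c → inv (L List.∷ʳ c) ≡ colSum c L ℕ.+ inv L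
    inv-snoc [] c = refl
    inv-snoc (a ∷ L) c = trans (cong₂ ℕ._+_ (row L) (inv-snoc L c))
      (shuffle (crossings a c) (rowSum a L) (colSum c L) (inv L))
      where
      row : ∀ L → rowSum a (L List.∷ʳ c) ≡ crossings a c ℕ.+ rowSum a L
      row [] = refl
      row (b ∷ L) = trans (cong (crossings a b ℕ.+_) (row L))
        (exch (crossings a b) (crossings a c) (rowSum a L))
        where
        exch : ∀ x y z → x ℕ.+ (y ℕ.+ z) ≡ y ℕ.+ (x ℕ.+ z)
        exch = ℕsolve-∀
      shuffle : ∀ x y z w → x ℕ.+ y ℕ.+ (z ℕ.+ w) ≡ x ℕ.+ z ℕ.+ (y ℕ.+ w)
      shuffle = ℕsolve-∀

  InjMod : (ℤ → ℤ) → Set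
  InjMod F = ∀ p q c → F q ≡ F p + c * N → q ≡ p + c * N

  abstract
    ∤⇒% : ∀ d → ¬ (∃ λ c → d ≡ c * N) → ∃ λ r → (d %ℕ n ≡ suc r) × r ℕ.< K
    ∤⇒% d nd with d %ℕ n in eq | n%ℕd<d d n
    ... | zero | _ = ⊥-elim (nd (d /ℕ n , trans (a≡a%ℕn+[a/ℕn]*n d n)
      (trans (cong (λ z → + z + (d /ℕ n) * N) eq) (ℤₚ.+-identityˡ _))))
    ... | suc r | s≤s r<K = r , refl , r<K

    -- If N does not divide d = r + q N, then 0 < r < N, and N - d = (N - r) - q N exhibits the
    -- quotient -q with the remainder N - r.
    /-complement : ∀ {d d'} → ¬ (∃ λ c → d ≡ c * N) → d' ≡ N - d → d' /ℕ n ≡ - (d /ℕ n)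
    /-complement {d} {d'} nd e with ∤⇒% d nd
    ... | r , eq , r<K = proj₂ (divmod-unique d' (- (d /ℕ n)) (K ∸ r) (s≤s (ℕₚ.m∸n≤m K r)) e')
      where
      l : ∀ k r q m → 1ℤ + k - (1ℤ + r + q * m) ≡ k - r + - q * m
      l = solve-∀
      e' : d' ≡ + (K ∸ r) + - (d /ℕ n) * N
      e' = trans e (trans (cong (λ z → N - z)
        (trans (a≡a%ℕn+[a/ℕn]*n d n) (cong (λ z → + z + (d /ℕ n) * N) eq)))
             (trans (l (+ K) (+ r) (d /ℕ n) N)
               (cong (_+ - (d /ℕ n) * N) (trans (ℤₚ.m-n≡m⊖n K r) (ℤₚ.⊖-≥ (ℕₚ.<⇒≤ r<K))))))

    crossings-rotate : ∀ {a b} → ¬ (∃ λ c → b ≡ a + c * N) → crossings b (a + N) ≡ crossings a b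
    crossings-rotate {a} {b} nd = trans (cong ∣_∣
      (/-complement {b - a} {a + N - b} (λ (c , e) → nd (c , l₁ c e)) (l₂ a b N))) (ℤₚ.∣-i∣≡∣i∣ ((b - a) /ℕ n))
      where
      l₂ : ∀ a b m → a + m - b ≡ m - (b - a)
      l₂ = solve-∀
      l₃ : ∀ a b → b ≡ a + (b - a)
      l₃ = solve-∀
      l₁ : ∀ c → b - a ≡ c * N → b ≡ a + c * N
      l₁ c e = trans (l₃ a b) (cong (_+_ a) e)

    crossings-swap : ∀ {a b} → a < b → ¬ (∃ λ c → b ≡ a + c * N) → crossings b a ≡ suc (crossings a b)
    crossings-swap {a} {b} a<b nd = trans (cong ∣_∣ q'≡)
      (abs (0≤n⇒0≤n/ℕd (b - a) n (ℤₚ.i≤j⇒0≤j-i (ℤₚ.<⇒≤ a<b))))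
      where
      l₂ : ∀ a b m → a - b + m ≡ m - (b - a)
      l₂ = solve-∀
      l₃ : ∀ a b → b ≡ a + (b - a)
      l₃ = solve-∀
      l₄ : ∀ a r q m → a + m ≡ r + q * m → a ≡ r + (q - 1ℤ) * m
      l₄ a r q m e = trans (l₅ a m) (trans (cong (_- m) e) (l₆ r q m))
        where
        l₅ : ∀ a m → a ≡ a + m - m
        l₅ = solve-∀
        l₆ : ∀ r q m → r + q * m - m ≡ r + (q - 1ℤ) * m
        l₆ = solve-∀
      d' q : ℤ
      d' = a - b + N
      q = (b - a) /ℕ n
      q'≡ : (a - b) /ℕ n ≡ - q - 1ℤ
      q'≡ = trans (proj₂ (divmod-unique (a - b) (d' /ℕ n - 1ℤ) (d' %ℕ n) (n%ℕd<d d' n)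
        (l₄ (a - b) (+ (d' %ℕ n)) (d' /ℕ n) N (a≡a%ℕn+[a/ℕn]*n d' n))))
              (cong (_- 1ℤ) (/-complement {b - a} {d'} (λ (c , e) → nd (c , trans (l₃ a b) (cong (_+_ a) e)))
                (l₂ a b N)))
      abs : ∀ {q} → 0ℤ ≤ q → ∣ - q - 1ℤ ∣ ≡ suc ∣ q ∣
      abs {+ zero} _ = refl
      abs {+ suc m} _ = cong (suc ∘ suc) (ℕₚ.+-identityʳ m)

  module _ {F : ℤ → ℤ} (per : Periodic F) (inj : InjMod F) where

    private
      F∤ : ∀ b t → suc t ℕ.< n → ¬ (∃ λ c → F (b + + suc t) ≡ F b + c * N)
      F∤ b t t<n (c , e) = ℕₚ.1+n≢0 (small-multiple {suc t} c t<n (+-cancelˡ b (inj b (b + + suc t) c e)))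

      col≡row : ∀ b t m → suc t ℕ.+ m ℕ.≤ n → colSum (F b + N) (Win F (b + + suc t) m) ≡ rowSum (F b)
        (Win F (b + + suc t) m)
      col≡row b t zero _ = refl
      col≡row b t (suc m) p = cong₂ ℕ._+_
        (crossings-rotate (F∤ b t (ℕₚ.<-≤-trans (ℕₚ.m<m+n (suc t) (s≤s z≤n)) p)))
        (trans (cong (λ z → colSum (F b + N) (Win F z m)) e)
          (trans (col≡row b (suc t) m (ℕₚ.≤-trans (ℕₚ.≤-reflexive (sym (ℕₚ.+-suc (suc t) m))) p))
          (cong (λ z → rowSum (F b) (Win F z m)) (sym e))))
        where
        e : b + + suc t + 1ℤ ≡ b + + suc (suc t)
        e = trans (ℤₚ.+-assoc b (+ suc t) 1ℤ) (cong (λ z → b + + z) (ℕₚ.+-comm (suc t) 1))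

    -- Sliding the window by one site turns its first entry a into a last entry a + N, and by
    -- `crossings-rotate` every pair involving it keeps its contribution.
    inv-rotate : ∀ b → inv (Win F b n) ≡ inv (Win F (b + 1ℤ) n)
    inv-rotate b = sym (trans (cong inv (Win-snoc F (b + 1ℤ) K)) (trans (inv-snoc (Win F (b + 1ℤ) K) _)
      (cong (ℕ._+ inv (Win F (b + 1ℤ) K))
        (trans (cong (λ z → colSum z (Win F (b + 1ℤ) K)) e) (col≡row b 0 K ℕₚ.≤-refl)))))
      where
      l : ∀ b c → b + 1ℤ + c ≡ b + 1ℤ * (1ℤ + c)
      l = solve-∀
      e : F (b + 1ℤ + + K) ≡ F b + N
      e = trans (cong F (l b (+ K))) (trans (per b 1ℤ) (cong (_+_ (F b)) (ℤₚ.*-identityˡ N)))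

    inv-base : ∀ m → inv (Win F 0ℤ n) ≡ inv (Win F (+ m) n)
    inv-base zero = refl
    inv-base (suc m) = trans (inv-base m)
      (trans (inv-rotate (+ m)) (cong (λ z → inv (Win F z n)) (cong +_ (ℕₚ.+-comm m 1))))

    inv-any : ∀ m → inv (Win F 1ℤ n) ≡ inv (Win F (+ m) n)
    inv-any m = trans (sym (inv-base 1)) (inv-base m)

  abstract
    inv-swap : ∀ {a b} L → crossings b a ≡ suc (crossings a b) → inv (b ∷ a ∷ L) ≡ suc (inv (a ∷ b ∷ L))
    inv-swap {a} {b} L e = trans (cong (λ z → z ℕ.+ rowSum b L ℕ.+ (rowSum a L ℕ.+ inv L)) e)
      (cong suc (l (crossings a b) (rowSum b L) (rowSum a L) (inv L)))
      where
      l : ∀ x y z w → x ℕ.+ y ℕ.+ (z ℕ.+ w) ≡ x ℕ.+ z ℕ.+ (y ℕ.+ w)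
      l = ℕsolve-∀

  module _ {F : ℤ → ℤ} (per : Periodic F) (inj : InjMod F) where

    ∘s-periodic : ∀ i → Periodic (F ∘ s i)
    ∘s-periodic i m c = trans (cong F (s-periodic i m c)) (per (s i m) c)

    ∘s-injMod : ∀ i → InjMod (F ∘ s i)
    ∘s-injMod i p q c e = trans (sym (s-invol i q)) (trans (cong (s i) (inj (s i p) (s i q) c e))
      (trans (s-periodic i (s i p) c) (cong (_+ c * N) (s-invol i p))))

    -- In the window that begins at i, the letter exchanges the first two entries and fixes the
    -- others, so only their mutual term changes. The standard window would not do: for i = 0 the
    -- sites exchanged are 0 and 1.
    inv-∘s : ∀ i → F (+ toℕ i) < F (+ toℕ i + 1ℤ) → inv (Win (F ∘ s i) 1ℤ n) ≡ suc (inv (Win F 1ℤ n))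
    inv-∘s i lt = trans (inv-any {F ∘ s i} (∘s-periodic i) (∘s-injMod i) (toℕ i))
      (trans (cong inv eqL) (trans (inv-swap {F b} {F (b + 1ℤ)} (Win F (b + 1ℤ + 1ℤ) j)
        (crossings-swap {F b} {F (b + 1ℤ)} lt nd))
        (cong suc (sym (inv-any {F} per inj (toℕ i))))))
      where
      b = + toℕ i
      l : ∀ a m → a ≡ a + 0ℤ * m
      l = solve-∀
      b∼ : b ∼ i
      b∼ = 0ℤ , l b N
      nd : ¬ (∃ λ c → F (b + 1ℤ) ≡ F b + c * N)
      nd (c , e) = ℕₚ.1+n≢0 (small-multiple {1} c (s≤s (s≤s z≤n)) (+-cancelˡ b (inj b (b + 1ℤ) c e)))

      e₂ : b + 1ℤ + 1ℤ ≡ b + + 2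
      e₂ = ℤₚ.+-assoc b 1ℤ 1ℤ
      Win-fix : ∀ t m {q} → suc (suc t) ℕ.+ m ℕ.≤ n → q ≡ b + + suc (suc t) → Win (F ∘ s i) q m ≡ Win F q m
      Win-fix t zero _ _ = refl
      Win-fix t (suc m) {q} le e = cong₂ _∷_ (cong F (s-fix x y))
        (Win-fix (suc t) m (ℕₚ.≤-trans (ℕₚ.≤-reflexive (sym (ℕₚ.+-suc (suc (suc t)) m))) le)
          (trans (cong (_+ 1ℤ) e) (trans (ℤₚ.+-assoc b (+ suc (suc t)) 1ℤ)
            (cong (λ z → b + + z) (ℕₚ.+-comm (suc (suc t)) 1)))))
        where
        lt' : suc (suc t) ℕ.< n
        lt' = ℕₚ.<-≤-trans (ℕₚ.m<m+n (suc (suc t)) (s≤s z≤n)) le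
        x : ¬ q ∼ i
        x r = ℕₚ.1+n≢0 (∼-separated {b} {i} {suc (suc t)} b∼ (subst (_∼ i) e r) lt')
        l₂ : ∀ b t → b + (1ℤ + (1ℤ + t)) - 1ℤ ≡ b + (1ℤ + t)
        l₂ = solve-∀
        y : ¬ (q - 1ℤ) ∼ i
        y r = ℕₚ.1+n≢0 (∼-separated {b} {i} {suc t} b∼ (subst (_∼ i) (trans (cong (_- 1ℤ) e) (l₂ b (+ t))) r)
          (ℕₚ.<-trans (ℕₚ.n<1+n _) lt'))
      eqL : Win (F ∘ s i) b n ≡ F (b + 1ℤ) ∷ F b ∷ Win F (b + 1ℤ + 1ℤ) j
      eqL = cong₂ _∷_ (cong F (s-up b∼)) (cong₂ _∷_ (cong F (s-dn b∼)) (Win-fix 0 j ℕₚ.≤-refl e₂))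

  abstract
    injMod : ∀ {F} → Periodic F → (∀ {p q} → F p ≡ F q → p ≡ q) → InjMod F
    injMod {F} per inj p q c e = inj (trans e (sym (per p c)))

  abstract
    -- The inversion count of the inverse: prefixing a letter is then a change of sites, to which
    -- `inv-∘s` applies. `len-prod` identifies it with the length of the element itself, by way of
    -- `ℓ-reverse`.
    ℓ : Word → ℕ
    ℓ ws = inv (Win (g ws) 1ℤ n)

  Asc Desc : Fin n → Word → Set
  Asc i ws = ∀ p → p ∼ i → g ws p < g ws (p + 1ℤ)
  Desc i ws = ∀ p → p ∼ i → g ws (p + 1ℤ) < g ws p

  abstract
    g-shift1 : ∀ ws p c → g ws (p + c * N + 1ℤ) ≡ g ws (p + 1ℤ) + c * N
    g-shift1 ws p c = trans (cong (g ws) (+-swap p (c * N) 1ℤ)) (g-periodic ws (p + 1ℤ) c)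

    toℕ∼ : ∀ i → (+ toℕ i) ∼ i
    toℕ∼ i = 0ℤ , sym (ℤₚ.+-identityʳ (+ toℕ i))

    mkAsc : ∀ {i p} ws → p ∼ i → g ws p < g ws (p + 1ℤ) → Asc i ws
    mkAsc {i} {p} ws a lt q b with ∼-diff a b
    ... | c , refl = subst₂ _<_ (sym (g-periodic ws p c)) (sym (g-shift1 ws p c)) (ℤₚ.+-monoˡ-< (c * N) lt)

    mkDesc : ∀ {i p} ws → p ∼ i → g ws (p + 1ℤ) < g ws p → Desc i ws
    mkDesc {i} {p} ws a lt q b with ∼-diff a b
    ... | c , refl = subst₂ _<_ (sym (g-shift1 ws p c)) (sym (g-periodic ws p c)) (ℤₚ.+-monoˡ-< (c * N) lt)

    asc? : ∀ i ws → Asc i ws ⊎ Desc i ws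
    asc? i ws with ℤₚ.<-cmp (g ws (+ toℕ i)) (g ws (+ toℕ i + 1ℤ))
    ... | tri< a _ _ = inj₁ (mkAsc ws (toℕ∼ i) a)
    ... | tri≈ _ e _ = ⊥-elim (p≢p+1 _ (g-inj ws e))
    ... | tri> _ _ c = inj₂ (mkDesc ws (toℕ∼ i) c)

    ¬asc∧desc : ∀ {i ws} → Asc i ws → Desc i ws → ⊥
    ¬asc∧desc {i} a d = ℤₚ.<-asym (a _ (toℕ∼ i)) (d _ (toℕ∼ i))

    ℓ-cong : ∀ {us ws} → (∀ p → g us p ≡ g ws p) → ℓ us ≡ ℓ ws
    ℓ-cong e = cong inv (Win-cong e 1ℤ n)

    ℓ-asc : ∀ i ws → Asc i ws → ℓ (i ∷ ws) ≡ suc (ℓ ws)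
    ℓ-asc i ws a = inv-∘s (g-periodic ws) (injMod (g-periodic ws) (g-inj ws)) i (a _ (toℕ∼ i))

    desc⇒asc : ∀ {i} ws → Desc i ws → Asc i (i ∷ ws)
    desc⇒asc ws d p a = subst₂ _<_ (cong (g ws) (sym (s-up a))) (cong (g ws) (sym (s-dn a))) (d p a)

    asc⇒desc : ∀ {i} ws → Asc i ws → Desc i (i ∷ ws)
    asc⇒desc ws d p a = subst₂ _<_ (cong (g ws) (sym (s-dn a))) (cong (g ws) (sym (s-up a))) (d p a)

    ℓ-desc : ∀ i ws → Desc i ws → ℓ ws ≡ suc (ℓ (i ∷ ws))
    ℓ-desc i ws d = trans (ℓ-cong {ws} {i ∷ i ∷ ws} (λ p → cong (g ws) (sym (s-invol i p))))
      (ℓ-asc i (i ∷ ws) (desc⇒asc ws d))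

    ℓ-[] : ℓ [] ≡ 0
    ℓ-[] = inv-id n 1ℤ ℕₚ.≤-refl
      where
      row-id : ∀ a t m {q} → q ≡ a + + t → t ℕ.+ m ℕ.≤ n → rowSum a (Win (g []) q m) ≡ 0
      row-id a t zero e le = refl
      row-id a t (suc m) {q} e le = cong₂ ℕ._+_
        (cong ∣_∣ (proj₂ (divmod-unique (q - a) 0ℤ t (ℕₚ.<-≤-trans (ℕₚ.m<m+n t (s≤s z≤n)) le)
          (trans (cong (_- a) e) (l a (+ t))))))
        (row-id a (suc t) m (trans (cong (_+ 1ℤ) e) (l₂ a (+ t)))
          (ℕₚ.≤-trans (ℕₚ.≤-reflexive (sym (ℕₚ.+-suc t m))) le))
        where
        l : ∀ a t → a + t - a ≡ t + 0ℤ
        l = solve-∀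
        l₂ : ∀ a t → a + t + 1ℤ ≡ a + (1ℤ + t)
        l₂ = solve-∀
      inv-id : ∀ m q → m ℕ.≤ n → inv (Win (g []) q m) ≡ 0
      inv-id zero q _ = refl
      inv-id (suc m) q le = cong₂ ℕ._+_ (row-id q 1 m refl le) (inv-id m (q + 1ℤ) (ℕₚ.≤-trans (ℕₚ.n≤1+n m) le))

    ℓ-∷≤ : ∀ i ws → ℓ (i ∷ ws) ℕ.≤ suc (ℓ ws)
    ℓ-∷≤ i ws with asc? i ws
    ... | inj₁ a = ℕₚ.≤-reflexive (ℓ-asc i ws a)
    ... | inj₂ d = ℕₚ.≤-trans (ℕₚ.n≤1+n _) (ℕₚ.≤-trans (ℕₚ.≤-reflexive (sym (ℓ-desc i ws d))) (ℕₚ.n≤1+n _))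

    ℓ≤length : ∀ ws → ℓ ws ℕ.≤ length ws
    ℓ≤length [] = ℕₚ.≤-reflexive ℓ-[]
    ℓ≤length (i ∷ ws) = ℕₚ.≤-trans (ℓ-∷≤ i ws) (s≤s (ℓ≤length ws))

  -- Reflections, the exchange property and reduced words

  record Reflection (τ : ℤ → ℤ) (p q : ℤ) : Set where
    field
      on-p  : ∀ c → τ (p + c * N) ≡ q + c * N
      on-q  : ∀ c → τ (q + c * N) ≡ p + c * N
      fixes : ∀ m → (∀ c → m ≢ p + c * N) → (∀ c → m ≢ q + c * N) → τ m ≡ m

  open Reflection

  abstract
    s-reflection : ∀ {i p} → p ∼ i → Reflection (s i) p (p + 1ℤ)
    s-reflection {i} {p} a .on-p c = trans (s-up (∼-shift c a)) (+-swap p (c * N) 1ℤ)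
    s-reflection {i} {p} a .on-q c = trans (cong (s i) (+-swap p 1ℤ (c * N))) (s-dn (∼-shift c a))
    s-reflection {i} {p} a .fixes m x y = s-fix nx ny
      where
      nx : ¬ m ∼ i
      nx b with ∼-diff a b
      ... | c , e = x c e
      ny : ¬ (m - 1ℤ) ∼ i
      ny b with ∼-diff a b
      ... | c , e = y c (trans (sym (-1+1 m)) (trans (cong (_+ 1ℤ) e) (+-swap p (c * N) 1ℤ)))

    %≡0⇒ : ∀ m p → (m - p) %ℕ n ≡ 0 → m ≡ p + ((m - p) /ℕ n) * N
    %≡0⇒ m p e = trans (l m p) (cong (_+_ p)
      (trans (a≡a%ℕn+[a/ℕn]*n (m - p) n) (trans (cong (λ z → + z + ((m - p) /ℕ n) * N) e) (ℤₚ.+-identityˡ _))))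
      where
      l : ∀ m p → m ≡ p + (m - p)
      l = solve-∀

    reflection-unique : ∀ {τ τ' p q} → Reflection τ p q → Reflection τ' p q → ∀ m → τ m ≡ τ' m
    reflection-unique {τ} {τ'} {p} {q} r r' m with (m - p) %ℕ n ℕ.≟ 0 | (m - q) %ℕ n ℕ.≟ 0
    ... | yes e | _ = subst (λ z → τ z ≡ τ' z) (sym (%≡0⇒ m p e))
      (trans (on-p r ((m - p) /ℕ n)) (sym (on-p r' ((m - p) /ℕ n))))
    ... | no _ | yes e = subst (λ z → τ z ≡ τ' z) (sym (%≡0⇒ m q e))
      (trans (on-q r ((m - q) /ℕ n)) (sym (on-q r' ((m - q) /ℕ n))))
    ... | no a | no b = trans (fixes r m (λ c e → a (zero% m p c e)) (λ c e → b (zero% m q c e)))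
                         (sym (fixes r' m (λ c e → a (zero% m p c e)) (λ c e → b (zero% m q c e))))
      where
      l : ∀ p c m → p + c * m - p ≡ 0ℤ + c * m
      l = solve-∀
      zero% : ∀ m p c → m ≡ p + c * N → (m - p) %ℕ n ≡ 0
      zero% m p c e = proj₁ (divmod-unique (m - p) c 0 (s≤s z≤n) (trans (cong (_- p) e) (l p c N)))

    conj-reflection : ∀ {τ p q} i → Reflection τ p q → Reflection (s i ∘ τ ∘ s i) (s i p) (s i q)
    conj-reflection {τ} {p} {q} i r .on-p c =
      trans (cong (s i ∘ τ) (trans (s-periodic i (s i p) c) (cong (_+ c * N) (s-invol i p))))
      (trans (cong (s i) (on-p r c)) (s-periodic i q c))
    conj-reflection {τ} {p} {q} i r .on-q c =
      trans (cong (s i ∘ τ) (trans (s-periodic i (s i q) c) (cong (_+ c * N) (s-invol i q))))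
      (trans (cong (s i) (on-q r c)) (s-periodic i p c))
    conj-reflection {τ} {p} {q} i r .fixes m x y =
      trans (cong (s i) (fixes r (s i m) (λ c e → x c (back p c e)) (λ c e → y c (back q c e)))) (s-invol i m)
      where
      back : ∀ p c → s i m ≡ p + c * N → m ≡ s i p + c * N
      back p c e = trans (sym (s-invol i m)) (trans (cong (s i) e) (s-periodic i p c))

    s-reverses : ∀ {i p q} → p < q → s i q < s i p → p ∼ i × q ≡ p + 1ℤ
    s-reverses {i} {p} {q} lt gt with view i p
    ... | isUp a with view i q
    ...   | isUp b = ⊥-elim (ℤₚ.<-asym lt (<⇒ (subst₂ _<_ (s-up b) (s-up a) gt) (l p q)))
      where
      l : ∀ p q → p - q ≡ (p + 1ℤ) - (q + 1ℤ)
      l = solve-∀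
    ...   | isDn {q'} b = a , ℤₚ.≤-antisym (subst₂ (λ x y → x + 1ℤ ≤ y) (s-dn b) (s-up a) (<⇒≤1 gt)) (<⇒≤1 lt)
    ...   | isFix b b' = ⊥-elim (ℤₚ.<-irrefl refl
      (ℤₚ.<-≤-trans (subst₂ _<_ (s-fix b b') (s-up a) gt) (<⇒≤1 lt)))
    s-reverses {i} {.(p + 1ℤ)} {q} lt gt | isDn {p} a with view i q
    ...   | isUp b = ⊥-elim (ℤₚ.<-asym (subst₂ _<_ (s-up b) (s-dn a) gt)
      (ℤₚ.<-trans (p<p+1 p) (ℤₚ.<-trans lt (p<p+1 q))))
    ...   | isDn {q'} b = ⊥-elim (ℤₚ.<-asym lt (<⇒ (subst₂ _<_ (s-dn b) (s-dn a) gt) (l p q')))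
      where
      l : ∀ p q → p + 1ℤ - (q + 1ℤ) ≡ p - q
      l = solve-∀
    ...   | isFix b b' = ⊥-elim (ℤₚ.<-asym (subst₂ _<_ (s-fix b b') (s-dn a) gt) (ℤₚ.<-trans (p<p+1 p) lt))
    s-reverses {i} {p} {q} lt gt | isFix a a' with view i q
    ...   | isUp b = ⊥-elim (ℤₚ.<-asym (subst₂ _<_ (s-up b) (s-fix a a') gt) (ℤₚ.<-trans lt (p<p+1 q)))
    ...   | isDn {q'} b = ⊥-elim (ℤₚ.<-irrefl refl
      (ℤₚ.≤-<-trans (<⇒≤1 (subst₂ _<_ (s-dn b) (s-fix a a') gt)) lt))
    ...   | isFix b b' = ⊥-elim (ℤₚ.<-asym lt (subst₂ _<_ (s-fix b b') (s-fix a a') gt))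

    -- The strong exchange property. Follow the pair p < q through the letters from the left: as it
    -- ends up reversed, some letter is the first to reverse it. There the conjugated reflection is
    -- that letter itself, so the two cancel and the letter is deleted.
    exchange : ∀ ws {τ p q} → Reflection τ p q → p < q → g ws q < g ws p →
      ∃ λ us → length ws ≡ suc (length us) × (∀ m → g us m ≡ g ws (τ m))
    exchange [] r lt gt = ⊥-elim (ℤₚ.<-asym lt gt)
    exchange (i ∷ ws) {τ} {p} {q} r lt gt with ℤₚ.<-cmp (s i p) (s i q)
    ... | tri< lt' _ _ with exchange ws (conj-reflection i r) lt' gt
    ...   | us , len≡ , e = i ∷ us , cong suc len≡ , λ m → trans (e (s i m))
      (cong (g ws ∘ s i ∘ τ) (s-invol i m))
    exchange (i ∷ ws) {τ} {p} {q} r lt gt | tri≈ _ e _ = ⊥-elim (ℤₚ.<-irrefl (cong (g ws) (sym e)) gt)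
    exchange (i ∷ ws) {τ} {p} {q} r lt gt | tri> _ _ gt' with s-reverses lt gt'
    ... | a , refl = ws , refl , λ m → cong (g ws)
      (sym (trans (cong (s i) (reflection-unique r (s-reflection a) m)) (s-invol i m)))

    reduced-word : ∀ ws → ∃ λ us → (∀ p → g us p ≡ g ws p) × length us ≡ ℓ ws
    reduced-word [] = [] , (λ p → refl) , sym ℓ-[]
    reduced-word (i ∷ ws) with reduced-word ws | asc? i ws
    ... | us , e , len≡ | inj₁ a = i ∷ us , (λ p → e (s i p)) , trans (cong suc len≡) (sym (ℓ-asc i ws a))
    -- At a descent the reduced word of the tail already inverts the pair, so the new letter is
    -- absorbed by deleting another one.
    ... | us , e , len≡ | inj₂ d with exchange us (s-reflection (toℕ∼ i)) (p<p+1 _)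
      (subst₂ _<_ (sym (e _)) (sym (e _)) (d _ (toℕ∼ i)))
    ...   | vs , len≡' , e' = vs , (λ p → trans (e' p) (e (s i p))) , ℕₚ.suc-injective
      (trans (sym len≡') (trans len≡ (ℓ-desc i ws d)))

    -- The reverse of a reduced word is a word for the inverse with equally many letters, and no
    -- word has fewer letters than its length.
    ℓ-reverse≤ : ∀ ws → ℓ (reverse ws) ℕ.≤ ℓ ws
    ℓ-reverse≤ ws with reduced-word ws
    ... | us , e , len≡ = ℕₚ.≤-trans (ℕₚ.≤-reflexive (ℓ-cong {reverse ws} {reverse us} e'))
                           (ℕₚ.≤-trans (ℓ≤length (reverse us))
                             (ℕₚ.≤-reflexive (trans (Listₚ.length-reverse us) len≡)))
      where
      e' : ∀ p → g (reverse ws) p ≡ g (reverse us) p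
      e' p = trans (g-reverse ws p) (trans (g-inj ws (trans (g-f ws p) (trans (sym (g-f us p)) (e (f us p)))))
        (sym (g-reverse us p)))

    ℓ-reverse : ∀ ws → ℓ (reverse ws) ≡ ℓ ws
    ℓ-reverse ws = ℕₚ.≤-antisym (ℓ-reverse≤ ws)
      (subst (λ z → ℓ z ℕ.≤ ℓ (reverse ws)) (Listₚ.reverse-involutive ws) (ℓ-reverse≤ (reverse ws)))

    len-prod′ : ∀ ws → len K (prod K ws) ≡ inv (Win (f ws) 1ℤ n)
    len-prod′ ws = trans (cong (len K) (prod-f ws)) (len-map (f-periodic ws))

    len-prod : ∀ ws → len K (prod K ws) ≡ ℓ ws
    len-prod ws = trans (len-prod′ ws) (trans (ℓ-cong′ (λ p → sym (g-reverse ws p))) (ℓ-reverse ws))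
      where
      ℓ-cong′ : (∀ p → f ws p ≡ g (reverse ws) p) → inv (Win (f ws) 1ℤ n) ≡ ℓ (reverse ws)
      ℓ-cong′ e = cong inv (Win-cong e 1ℤ n)

  -- Counting beads

  β : ℤ → ℕ
  β (+ zero) = 1
  β +[1+ _ ] = 0
  β -[1+ _ ] = 1

  -- A position p is a bead of ws if g ws p ≤ 0 and a hole otherwise;
  -- c ws p is the number of beads to the right of p.
  c : Word → ℤ → ℕ
  c [] (+ _) = 0
  c [] -[1+ m ] = suc m
  c (i ∷ ws) p = if does (p ∼? i) then c ws (p + 1ℤ) ℕ.+ β (g ws p) else c ws p

  Step : (ℤ → ℕ) → Set
  Step d = ∀ p → d (p + 1ℤ) ℕ.≤ d p × d p ℕ.≤ suc (d (p + 1ℤ))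

  infix 4 _≼_ _∼∈_

  _≼_ : (ℤ → ℕ) → (ℤ → ℕ) → Set
  d ≼ e = ∀ p → d p ℕ.≤ e p

  _∼∈_ : ℤ → Word → Set
  p ∼∈ as = Any (p ∼_) as

  -- The element min(x, s_i x) on which the operator of the letter i evaluates.
  psi : Fin n → Word → Word
  psi i x with asc? i x
  ... | inj₁ _ = x
  ... | inj₂ _ = i ∷ x

  -- The Grassmannian condition for all pairs in the window instead of the adjacent ones;
  -- `sorted⇒grass` and `grass⇒sorted` compare it with `isGrass`.
  Sorted : Word → Set
  Sorted ws = ∀ u v → 1ℤ ≤ u → u < v → v ≤ N → f ws u < f ws v

  Bit : ℤ → Set
  Bit x = (x ≤ 0ℤ × β x ≡ 1) ⊎ (0ℤ < x × β x ≡ 0)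

  β-cases : ∀ x → Bit x
  β-cases (+ zero) = inj₁ (ℤₚ.≤-refl , refl)
  β-cases +[1+ m ] = inj₂ (+<+ (s≤s z≤n) , refl)
  β-cases -[1+ m ] = inj₁ (-≤+ , refl)

  abstract
    β-≤0 : ∀ {x} → x ≤ 0ℤ → β x ≡ 1
    β-≤0 {x} le with β-cases x
    ... | inj₁ (_ , e) = e
    ... | inj₂ (lt , _) = ⊥-elim (ℤₚ.<-irrefl refl (ℤₚ.<-≤-trans lt le))

    β-0< : ∀ {x} → 0ℤ < x → β x ≡ 0
    β-0< {x} lt with β-cases x
    ... | inj₂ (_ , e) = e
    ... | inj₁ (le , _) = ⊥-elim (ℤₚ.<-irrefl refl (ℤₚ.<-≤-trans lt le))

    β-one : ∀ {x} → β x ≡ 1 → x ≤ 0ℤ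
    β-one {x} e with β-cases x
    ... | inj₁ (le , _) = le
    ... | inj₂ (_ , e') = ⊥-elim (ℕₚ.1+n≢0 (trans (sym e) e'))

    β-zero : ∀ {x} → β x ≡ 0 → 0ℤ < x
    β-zero {x} e with β-cases x
    ... | inj₂ (lt , _) = lt
    ... | inj₁ (_ , e') = ⊥-elim (ℕₚ.1+n≢0 (trans (sym e') e))

    β≤1 : ∀ x → β x ℕ.≤ 1
    β≤1 x with β-cases x
    ... | inj₁ (_ , e) = ℕₚ.≤-reflexive e
    ... | inj₂ (_ , e) = ℕₚ.≤-trans (ℕₚ.≤-reflexive e) z≤n

    c-at : ∀ i ws {p} → p ∼ i → c (i ∷ ws) p ≡ c ws (p + 1ℤ) ℕ.+ β (g ws p)
    c-at i ws {p} a with p ∼? i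
    ... | yes _ = refl
    ... | no na = ⊥-elim (na a)

    c-off : ∀ i ws {p} → ¬ p ∼ i → c (i ∷ ws) p ≡ c ws p
    c-off i ws {p} na with p ∼? i
    ... | yes a = ⊥-elim (na a)
    ... | no _ = refl

    -- The ray to the right of p is infinite, so `c` recurses on the word: a letter changes the
    -- count only in class i, where the site p + 1 receives what was at p. This identity shows that
    -- the recursion does count beads.
    c-step : ∀ ws p → c ws p ≡ β (g ws (p + 1ℤ)) ℕ.+ c ws (p + 1ℤ)
    c-step [] (+ zero) = refl
    c-step [] +[1+ m ] = refl
    c-step [] -[1+ zero ] = refl
    c-step [] -[1+ suc m ] = refl
    c-step (i ∷ ws) p with p ∼? i | (p + 1ℤ) ∼? i
    ... | yes a | yes b = ⊥-elim (¬∼+1 a b)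
    ... | yes a | no _ = trans (ℕₚ.+-comm (c ws (p + 1ℤ)) _)
      (cong (λ z → β (g ws z) ℕ.+ c ws (p + 1ℤ)) (sym (s-dn a)))
    ... | no _ | yes b = trans (c-step ws p) (trans (cong (β (g ws (p + 1ℤ)) ℕ.+_) (c-step ws (p + 1ℤ)))
            (trans (l (β (g ws (p + 1ℤ))) (β (g ws (p + 1ℤ + 1ℤ))) (c ws (p + 1ℤ + 1ℤ)))
              (cong (λ z → β (g ws z) ℕ.+ (c ws (p + 1ℤ + 1ℤ) ℕ.+ β (g ws (p + 1ℤ)))) (sym (s-up b)))))
      where
      l : ∀ x y z → x ℕ.+ (y ℕ.+ z) ≡ y ℕ.+ (z ℕ.+ x)
      l = ℕsolve-∀
    ... | no a | no b = trans (c-step ws p)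
      (cong (λ z → β (g ws z) ℕ.+ c ws (p + 1ℤ)) (sym (s-fix b (a ∘ subst (_∼ i) (+1-1 p)))))

    c-step⁻ : ∀ ws p → c ws (p - 1ℤ) ≡ β (g ws p) ℕ.+ c ws p
    c-step⁻ ws p = trans (c-step ws (p - 1ℤ)) (cong (λ z → β (g ws z) ℕ.+ c ws z) (-1+1 p))

    c-Step : ∀ ws → Step (c ws)
    c-Step ws p = ℕₚ.≤-trans (ℕₚ.m≤n+m _ _) (ℕₚ.≤-reflexive (sym (c-step ws p))) ,
      ℕₚ.≤-trans (ℕₚ.≤-reflexive (c-step ws p)) (ℕₚ.+-monoˡ-≤ _ (β≤1 _))

    step-pred : ∀ {d} → Step d → ∀ p → d p ℕ.≤ d (p - 1ℤ) × d (p - 1ℤ) ℕ.≤ suc (d p)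
    step-pred {d} st p = subst (λ z → d z ℕ.≤ d (p - 1ℤ) × d (p - 1ℤ) ℕ.≤ suc (d z)) (-1+1 p) (st (p - 1ℤ))

    step-mono : ∀ {d} → Step d → ∀ p t → d (p + + t) ℕ.≤ d p
    step-mono {d} st p zero = ℕₚ.≤-reflexive (cong d (ℤₚ.+-identityʳ p))
    step-mono {d} st p (suc t) = ℕₚ.≤-trans
      (subst (λ z → d z ℕ.≤ d (p + 1ℤ)) (+-suc-1 p t) (step-mono st (p + 1ℤ) t)) (proj₁ (st p))

    ≤⇒+ : ∀ {p q} → p ≤ q → ∃ λ t → q ≡ p + + t
    ≤⇒+ {p} {q} le = ∣ q - p ∣ , trans (l p q) (cong (_+_ p) (sym (ℤₚ.0≤i⇒+∣i∣≡i (ℤₚ.i≤j⇒0≤j-i le))))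
      where
      l : ∀ p q → q ≡ p + (q - p)
      l = solve-∀

    step-anti : ∀ {d} → Step d → ∀ {p q} → p ≤ q → d q ℕ.≤ d p
    step-anti {d} st {p} le with ≤⇒+ le
    ... | t , refl = step-mono st p t

    c-≤pred : ∀ i ws p → c (i ∷ ws) p ℕ.≤ c ws (p - 1ℤ)
    c-≤pred i ws p with p ∼? i
    ... | yes a = ℕₚ.≤-trans (ℕₚ.≤-reflexive (ℕₚ.+-comm _ (β (g ws p))))
      (ℕₚ.≤-trans (ℕₚ.+-monoʳ-≤ (β (g ws p)) (proj₁ (c-Step ws p))) (ℕₚ.≤-reflexive (sym (c-step⁻ ws p))))
    ... | no _ = proj₁ (step-pred (c-Step ws) p)

    c-vanishes : ∀ ws q → + length ws ≤ q → c ws q ≡ 0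
    c-vanishes [] (+ m) _ = refl
    c-vanishes (i ∷ ws) q le = ℕₚ.n≤0⇒n≡0
      (ℕₚ.≤-trans (c-≤pred i ws q) (ℕₚ.≤-reflexive (c-vanishes ws (q - 1ℤ) (≤⇒ le (l q (+ length ws))))))
      where
      l : ∀ q m → q - 1ℤ - m ≡ q - (1ℤ + m)
      l = solve-∀

    -- `c` is computed from a word, yet `c-step` recovers it from the beads by descending from a
    -- site far to the right, where both words give zero.
    c-cong : ∀ us ws → (∀ p → g us p ≡ g ws p) → ∀ p → c us p ≡ c ws p
    c-cong us ws e p = down t p (trans
      (c-vanishes us (p + + t) (bound (length us) (ℕₚ.+-monoʳ-≤ ∣ p ∣ (ℕₚ.m≤m+n (length us) (length ws)))))
        (sym (c-vanishes ws (p + + t) (bound (length ws)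
          (ℕₚ.+-monoʳ-≤ ∣ p ∣ (ℕₚ.m≤n+m (length ws) (length us)))))))
      where
      t : ℕ
      t = ∣ p ∣ ℕ.+ (length us ℕ.+ length ws)
      neg : ∀ p → - p ≤ + ∣ p ∣
      neg (+ zero) = ℤₚ.≤-refl
      neg +[1+ m ] = -≤+
      neg -[1+ m ] = ℤₚ.≤-refl
      bound : ∀ m → ∣ p ∣ ℕ.+ m ℕ.≤ t → + m ≤ p + + t
      bound m le = ℤₚ.≤-trans (≤⇒ (neg p) (l p (+ ∣ p ∣) (+ m))) (ℤₚ.+-monoʳ-≤ p (+≤+ le))
        where
        l : ∀ p a m → p + (a + m) - m ≡ a - (- p)
        l = solve-∀
      down : ∀ t p → c us (p + + t) ≡ c ws (p + + t) → c us p ≡ c ws p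
      down zero p h = subst (λ z → c us z ≡ c ws z) (ℤₚ.+-identityʳ p) h
      down (suc t) p h = trans (c-step us p)
        (trans (cong₂ ℕ._+_ (cong β (e (p + 1ℤ)))
        (down t (p + 1ℤ) (subst (λ z → c us z ≡ c ws z) (sym (+-suc-1 p t)) h))) (sym (c-step ws p)))

    c⇒β : ∀ us ws → (∀ p → c us p ≡ c ws p) → ∀ p → β (g us p) ≡ β (g ws p)
    c⇒β us ws e p = ℕₚ.+-cancelʳ-≡ (c us p) _ _
      (trans (sym (c-step⁻ us p)) (trans (e (p - 1ℤ))
      (trans (c-step⁻ ws p) (cong (β (g ws p) ℕ.+_) (sym (e p))))))

    psi-off : ∀ i x {p} → ¬ p ∼ i → c (psi i x) p ≡ c x p
    psi-off i x na with asc? i x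
    ... | inj₁ _ = refl
    ... | inj₂ _ = c-off i x na

    -- After `psi`, the site p + 1 is a bead only if p is one too. Hence the count at p is the least
    -- one that its two neighbours allow.
    psi-at≤ : ∀ i x {p m} → p ∼ i → c x (p + 1ℤ) ℕ.≤ m → c x (p - 1ℤ) ℕ.≤ suc m → c (psi i x) p ℕ.≤ m
    psi-at≤ i x {p} {m} a hi lo with asc? i x
    ... | inj₁ asc = go (β-cases (g x (p + 1ℤ)))
      where
      go : Bit (g x (p + 1ℤ)) → c x p ℕ.≤ m
      go (inj₂ (_ , e)) = subst (ℕ._≤ m) (sym (trans (c-step x p) (cong (ℕ._+ c x (p + 1ℤ)) e))) hi
      go (inj₁ (le , _)) = ℕₚ.≤-pred
        (subst (ℕ._≤ suc m) (trans (c-step⁻ x p)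
        (cong (ℕ._+ c x p) (β-≤0 (ℤₚ.≤-trans (ℤₚ.<⇒≤ (asc p a)) le)))) lo)
    ... | inj₂ desc = subst (ℕ._≤ m) (sym (c-at i x a)) (go (β-cases (g x p)))
      where
      go : Bit (g x p) → c x (p + 1ℤ) ℕ.+ β (g x p) ℕ.≤ m
      go (inj₂ (_ , e)) = subst (ℕ._≤ m) (sym (trans (cong (c x (p + 1ℤ) ℕ.+_) e) (ℕₚ.+-identityʳ _))) hi
      go (inj₁ (le , e)) = ℕₚ.≤-pred (subst (ℕ._≤ suc m) eq lo)
        where
        eq : c x (p - 1ℤ) ≡ suc (c x (p + 1ℤ) ℕ.+ β (g x p))
        eq = trans (c-step⁻ x p) (trans
          (cong₂ ℕ._+_ e (trans (c-step x p)
          (cong (ℕ._+ c x (p + 1ℤ)) (β-≤0 (ℤₚ.≤-trans (ℤₚ.<⇒≤ (desc p a)) le)))))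
               (cong suc (trans (ℕₚ.+-comm 1 (c x (p + 1ℤ))) (cong (c x (p + 1ℤ) ℕ.+_) (sym e)))))

    -- The opposite extreme to `psi-at≤`: in `i ∷ y` the site p + 1 is a bead as soon as one of p, p
    -- + 1 is. Its count in class i is therefore the greatest that the neighbours allow, and a bound
    -- outside that class suffices.
    asc-lift : ∀ i y {C} → Asc i y → Step C → (∀ q → ¬ q ∼ i → C q ℕ.≤ c y q) → C ≼ c (i ∷ y)
    asc-lift i y {C} asc st le q with q ∼? i
    ... | no na = le q na
    ... | yes a = go (β-cases (g y q))
      where
      go : Bit (g y q) → C q ℕ.≤ c y (q + 1ℤ) ℕ.+ β (g y q)
      go (inj₁ (_ , e)) = ℕₚ.≤-trans (proj₂ (st q)) (ℕₚ.≤-trans (s≤s (le (q + 1ℤ) (¬∼+1 a)))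
         (ℕₚ.≤-reflexive (trans (ℕₚ.+-comm 1 _) (cong (c y (q + 1ℤ) ℕ.+_) (sym e)))))
      go (inj₂ (lt , e)) = ℕₚ.≤-trans (proj₁ (step-pred st q))
        (ℕₚ.≤-trans (le (q - 1ℤ) (¬∼-1 a)) (ℕₚ.≤-reflexive
         (trans (c-step⁻ y q) (trans (cong₂ ℕ._+_ e
           (trans (c-step y q) (cong (ℕ._+ c y (q + 1ℤ)) (β-0< (ℤₚ.<-trans lt (asc q a))))))
           (trans (sym (ℕₚ.+-identityʳ _)) (cong (c y (q + 1ℤ) ℕ.+_) (sym e)))))))

    asc-≼ : ∀ i y → Asc i y → c y ≼ c (i ∷ y)
    asc-≼ i y asc = asc-lift i y asc (c-Step y) (λ q _ → ℕₚ.≤-refl)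

    sorted-∷ : ∀ i x → Sorted x → (∀ q → q ∼ i → 1ℤ ≤ g x q → g x q < g x (q + 1ℤ) → g x (q + 1ℤ) ≤ N → ⊥) →
      Sorted (i ∷ x)
    sorted-∷ i x so noCross u v 1≤u u<v v≤N with ℤₚ.<-cmp (f (i ∷ x) u) (f (i ∷ x) v)
    ... | tri< lt _ _ = lt
    ... | tri≈ _ e _ = ⊥-elim (ℤₚ.<-irrefl (f-inj (i ∷ x) e) u<v)
    ... | tri> _ _ gt = ⊥-elim (bad (s-reverses (so u v 1≤u u<v v≤N) gt))
      where
      bad : f x u ∼ i × f x v ≡ f x u + 1ℤ → ⊥
      bad (a , e) = noCross (f x u) a (subst (1ℤ ≤_) (sym gu) 1≤u) (subst₂ _<_ (sym gu) (sym gv) u<v)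
        (subst (_≤ N) (sym gv) v≤N)
        where
        gu : g x (f x u) ≡ u
        gu = g-f x u
        gv : g x (f x u + 1ℤ) ≡ v
        gv = trans (cong (g x) (sym e)) (g-f x v)

    sorted-psi : ∀ i x → Sorted x → Sorted (psi i x)
    sorted-psi i x so with asc? i x
    ... | inj₁ _ = so
    ... | inj₂ desc = sorted-∷ i x so (λ q a _ lt _ → ℤₚ.<-asym lt (desc q a))

    sorted-desc : ∀ i x → Sorted x → Desc i x → Sorted (i ∷ x)
    sorted-desc i x so desc = sorted-∷ i x so (λ q a _ lt _ → ℤₚ.<-asym lt (desc q a))

    -- A shift by periods that brings g x p ≤ 0 into the window 1, ..., N is by a positive multiple
    -- of N, and it carries g x (p + 1) > 0 beyond N. So the exchanged sites never meet inside one
    -- window.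
    sorted-jump : ∀ i x {p} → Sorted x → p ∼ i → g x p ≤ 0ℤ → 0ℤ < g x (p + 1ℤ) → Sorted (i ∷ x)
    sorted-jump i x {p} so a le lt = sorted-∷ i x so bad
      where
      bad : ∀ q → q ∼ i → 1ℤ ≤ g x q → g x q < g x (q + 1ℤ) → g x (q + 1ℤ) ≤ N → ⊥
      bad q b 1≤ _ ≤N with ∼-diff a b
      ... | e , refl = ℤₚ.<-irrefl refl (ℤₚ.<-≤-trans (ℤₚ.≤-<-trans N≤eN hi) ≤N′)
        where
        1≤′ : 1ℤ ≤ g x p + e * N
        1≤′ = subst (1ℤ ≤_) (g-periodic x p e) 1≤
        ≤N′ : g x (p + 1ℤ) + e * N ≤ N
        ≤N′ = subst (_≤ N) (g-shift1 x p e) ≤N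
        0<eN : 0ℤ * N < e * N
        0<eN = ℤₚ.<-≤-trans (≤1⇒< (ℤₚ.≤-trans (ℤₚ.≤-reflexive (ℤₚ.+-identityˡ 1ℤ)) 1≤′))
          (ℤₚ.≤-trans (ℤₚ.+-monoˡ-≤ (e * N) le) (ℤₚ.≤-reflexive (ℤₚ.+-identityˡ (e * N))))
        0<e : 0ℤ < e
        0<e = ℤₚ.*-cancelʳ-<-nonNeg N 0<eN
        hi : e * N < g x (p + 1ℤ) + e * N
        hi = ℤₚ.≤-<-trans (ℤₚ.≤-reflexive (sym (ℤₚ.+-identityˡ (e * N)))) (ℤₚ.+-monoˡ-< (e * N) lt)
        N≤eN : N ≤ e * N
        N≤eN = ℤₚ.≤-trans (ℤₚ.≤-reflexive (sym (ℤₚ.*-identityˡ N)))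
          (N*-mono (ℤₚ.≤-trans (ℤₚ.≤-reflexive (sym (ℤₚ.+-identityˡ 1ℤ))) (<⇒≤1 0<e)))

  -- Cyclically decreasing words and the operators of the Pieri rule

  -- Comparisons such as `c x ≼ d` quantify over all of ℤ and cannot be tested. Equality of integers
  -- is decidable, hence stable, which makes a case distinction on any proposition legitimate for
  -- such goals.
  classical : ∀ {a b : ℤ} (P : Set) → (P → a ≡ b) → (¬ P → a ≡ b) → a ≡ b
  classical {a} {b} P yes′ no′ = decidable-stable (a ℤₚ.≟ b) (λ ne → ne (no′ (λ p → ne (yes′ p))))

  Indicates : ℤ → Set → Set
  Indicates v P = (P → v ≡ 1ℤ) × (¬ P → v ≡ 0ℤ)

  indicates-⇔ : ∀ {v P Q} → (P → Q) → (Q → P) → Indicates v P → Indicates v Q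
  indicates-⇔ to from (one , zero′) = one ∘ from , λ nq → zero′ (nq ∘ to)

  indicates-∖ : ∀ {a b P Q} → Indicates a P → Indicates b Q → (Q → P) → Indicates (a - b) (P × ¬ Q)
  indicates-∖ {a} {b} {P} {Q} (a1 , a0) (b1 , b0) Q⇒P =
    (λ (p , nq) → cong₂ _-_ (a1 p) (b0 nq)) ,
    (λ npq → classical Q (λ q → cong₂ _-_ (a1 (Q⇒P q)) (b1 q))
      (λ nq → cong₂ _-_ (a0 (λ p → npq (p , nq))) (b0 nq)))

  CyclicallyDecreasing : Word → Set
  CyclicallyDecreasing [] = ⊤
  CyclicallyDecreasing (i ∷ as) = (∀ p → p ∼ i → ¬ p ∼∈ as × ¬ (p + 1ℤ) ∼∈ as) × CyclicallyDecreasing as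

  -- This says that C lies below the function obtained from d by applying as,
  -- each letter acting as s_i or trivially, whichever gives the larger result.
  Dom : Word → (ℤ → ℕ) → (ℤ → ℕ) → Set
  Dom as C d = ∀ p → (p ∼∈ as → C p ℕ.≤ suc (d (p + 1ℤ))) × (¬ p ∼∈ as → C p ℕ.≤ d p)

  -- Kept negative, because it arises from the failure of a bound in a set difference, and such a
  -- failure does not exhibit a site.
  Excess : Word → (ℤ → ℕ) → (ℤ → ℕ) → Set
  Excess as C d = All (λ i → ¬ (∀ p → p ∼ i → C p ℕ.≤ d p)) as

  U : Word → (Word → ℤ) → Word → ℤ
  U [] F x = F x
  U (i ∷ as) F x = U as F (psi i x) - U as F x

  -- The counterpart of `psi` for functions that need not come from a word: in class i, the least
  -- value that the neighbours allow.
  lower : Fin n → (ℤ → ℕ) → ℤ → ℕ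
  lower i C p = if does (p ∼? i) then C (p + 1ℤ) ℕ.⊔ ℕ.pred (C (p - 1ℤ)) else C p

  _∼∈?_ : ∀ p as → Dec (p ∼∈ as)
  p ∼∈? as = Any.any? (p ∼?_) as

  abstract
    -- For p of class i, cyclic decrease says that the class of p + 1 is no letter, so C (p + 1) ≤ d
    -- (p + 1) ≤ d p; and C (p - 1) ≤ d p + 1 whether or not its class is a letter. The least value
    -- between such neighbours is at most d p. The form of `C′` covers both `psi` and `lower`.
    dom-tail : ∀ {i as C C′ d} → CyclicallyDecreasing (i ∷ as) → Step d → Step C →
      (∀ {p} → ¬ p ∼ i → C′ p ≡ C p) →
        (∀ {p m} → p ∼ i → C (p + 1ℤ) ℕ.≤ m → C (p - 1ℤ) ℕ.≤ suc m → C′ p ℕ.≤ m) →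
      Dom (i ∷ as) C d → Dom as C′ d
    dom-tail {i} {as} {C} {C′} {d} (cd , _) st stC off at dom p with p ∼? i
    ... | no na = (λ m → subst (ℕ._≤ suc (d (p + 1ℤ))) (sym (off na)) (proj₁ (dom p) (there m))) ,
                  (λ nm → subst (ℕ._≤ d p) (sym (off na))
                    (proj₂ (dom p) λ { (here a) → na a ; (there m) → nm m }))
    ... | yes a = (λ m → ⊥-elim (proj₁ (cd p a) m)) , (λ _ → at a hi lo)
      where
      hi : C (p + 1ℤ) ℕ.≤ d p
      hi = ℕₚ.≤-trans (proj₂ (dom (p + 1ℤ)) λ { (here b) → ¬∼+1 a b ; (there m) → proj₂ (cd p a) m })
        (proj₁ (st p))
      lo : C (p - 1ℤ) ℕ.≤ suc (d p)
      lo with (p - 1ℤ) ∼∈? (i ∷ as)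
      ... | yes m = subst (λ z → C (p - 1ℤ) ℕ.≤ suc (d z)) (-1+1 p) (proj₁ (dom (p - 1ℤ)) m)
      ... | no nm = ℕₚ.≤-trans (proj₂ (dom (p - 1ℤ)) nm) (proj₂ (step-pred st p))

    -- In class i one step gives C p ≤ C (p + 1) + 1, and at p + 1 the functions agree and no letter
    -- acts.
    dom-untail : ∀ {i as C C′ d} → CyclicallyDecreasing (i ∷ as) → Step C →
      (∀ {p} → ¬ p ∼ i → C′ p ≡ C p) → Dom as C′ d → Dom (i ∷ as) C d
    dom-untail {i} {as} {C} {C′} {d} (cd , _) stC off dom p = in′ , out
      where
      in′ : p ∼∈ (i ∷ as) → C p ℕ.≤ suc (d (p + 1ℤ))
      in′ m with p ∼? i
      in′ (here a) | no na = ⊥-elim (na a)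
      in′ (there m) | no na = subst (ℕ._≤ suc (d (p + 1ℤ))) (off na) (proj₁ (dom p) m)
      ... | yes a = ℕₚ.≤-trans (proj₂ (stC p))
        (s≤s (subst (ℕ._≤ d (p + 1ℤ)) (off (¬∼+1 a)) (proj₂ (dom (p + 1ℤ)) (proj₂ (cd p a)))))
      out : ¬ p ∼∈ (i ∷ as) → C p ℕ.≤ d p
      out nm = subst (ℕ._≤ d p) (off (nm ∘ here)) (proj₂ (dom p) (nm ∘ there))

    dom-weaken : ∀ {i as C d} → Step d → Dom as C d → Dom (i ∷ as) C d
    dom-weaken {i} {as} {C} {d} st dom p = in′ , (λ nm → proj₂ (dom p) (nm ∘ there))
      where
      in′ : p ∼∈ (i ∷ as) → C p ℕ.≤ suc (d (p + 1ℤ))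
      in′ _ with p ∼∈? as
      ... | yes m = proj₁ (dom p) m
      ... | no nm = ℕₚ.≤-trans (proj₂ (dom p) nm) (proj₂ (st p))

    dom-drop : ∀ {i as C d} → (∀ p → p ∼ i → C p ℕ.≤ d p) → Dom (i ∷ as) C d → Dom as C d
    dom-drop {i} {as} {C} {d} le dom p = (λ m → proj₁ (dom p) (there m)) , out
      where
      out : ¬ p ∼∈ as → C p ℕ.≤ d p
      out nm with p ∼? i
      ... | yes a = le p a
      ... | no na = proj₂ (dom p) λ { (here a) → na a ; (there m) → nm m }

    excess-off : ∀ {i as C C′ d} → (∀ {p} → ¬ p ∼ i → C′ p ≡ C p) → (∀ p → p ∼ i → ¬ p ∼∈ as) → Excess as C d →
      Excess as C′ d
    excess-off off sep [] = []
    excess-off {d = d} off sep (e ∷ es) =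
      (λ le → e (λ p a → subst (ℕ._≤ d p) (off (λ b → sep p b (here a))) (le p a))) ∷
      excess-off off (λ p a m → sep p a (there m)) es

    -- Each letter takes the difference of two nested indicators. The tail's `Excess` is the same
    -- for x and `psi i x`, so a point of the difference is one where the bound without the letter i
    -- fails, and that is precisely an excess in class i.
    U-indicates : ∀ {d F} → Step d → (∀ x → Sorted x → Indicates (F x) (c x ≼ d)) →
      ∀ as → CyclicallyDecreasing as → ∀ x → Sorted x → Indicates (U as F x)
        (Dom as (c x) d × Excess as (c x) d)
    U-indicates st ind [] cd x so = indicates-⇔ (λ le → (λ p → (λ ()) , (λ _ → le p)) , [])
      (λ (dom , _) p → proj₂ (dom p) (λ ())) (ind x so)
    U-indicates {d} {F} st ind (i ∷ as) cd x so =
      indicates-⇔ to from (indicates-∖ (U-indicates st ind as (proj₂ cd) (psi i x) (sorted-psi i x so))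
        (U-indicates st ind as (proj₂ cd) x so) incl)
      where
      sep : ∀ p → p ∼ i → ¬ p ∼∈ as
      sep p a = proj₁ (proj₁ cd p a)
      off : ∀ {p} → ¬ p ∼ i → c (psi i x) p ≡ c x p
      off = psi-off i x
      off⁻ : ∀ {p} → ¬ p ∼ i → c x p ≡ c (psi i x) p
      off⁻ na = sym (psi-off i x na)
      shrink : Dom (i ∷ as) (c x) d → Dom as (c (psi i x)) d
      shrink = dom-tail {C′ = c (psi i x)} cd st (c-Step x) off (psi-at≤ i x)
      incl : Dom as (c x) d × Excess as (c x) d → Dom as (c (psi i x)) d × Excess as (c (psi i x)) d
      incl (dom , ex) = shrink (dom-weaken st dom) , excess-off off sep ex
      to : (Dom as (c (psi i x)) d × Excess as (c (psi i x)) d) × ¬ (Dom as (c x) d × Excess as (c x) d) → Dom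
        (i ∷ as) (c x) d × Excess (i ∷ as) (c x) d
      to ((dom , ex) , nb) = dom′ , (λ le → nb (dom-drop le dom′ , ex′)) ∷ ex′
        where
        dom′ : Dom (i ∷ as) (c x) d
        dom′ = dom-untail {C′ = c (psi i x)} cd (c-Step x) off dom
        ex′ : Excess as (c x) d
        ex′ = excess-off off⁻ sep ex
      from : Dom (i ∷ as) (c x) d × Excess (i ∷ as) (c x) d →
        (Dom as (c (psi i x)) d × Excess as (c (psi i x)) d) × ¬ (Dom as (c x) d × Excess as (c x) d)
      from (dom , e ∷ ex) = (shrink dom , excess-off off sep ex) , λ (dom′ , _) → e
        (λ p a → proj₂ (dom′ p) (sep p a))

    lower-off : ∀ i C {p} → ¬ p ∼ i → lower i C p ≡ C p
    lower-off i C {p} na with p ∼? i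
    ... | yes a = ⊥-elim (na a)
    ... | no _ = refl

    lower-at : ∀ i C {p} → p ∼ i → lower i C p ≡ C (p + 1ℤ) ℕ.⊔ ℕ.pred (C (p - 1ℤ))
    lower-at i C {p} a with p ∼? i
    ... | yes _ = refl
    ... | no na = ⊥-elim (na a)

    lower-at≤ : ∀ i C {p m} → p ∼ i → C (p + 1ℤ) ℕ.≤ m → C (p - 1ℤ) ℕ.≤ suc m → lower i C p ℕ.≤ m
    lower-at≤ i C {p} {m} a hi lo = subst (ℕ._≤ m) (sym (lower-at i C a)) (ℕₚ.⊔-lub hi (ℕₚ.pred-mono-≤ lo))

    lower-Step : ∀ i {C} → Step C → Step (lower i C)
    lower-Step i {C} st p with p ∼? i | (p + 1ℤ) ∼? i
    ... | yes a | yes b = ⊥-elim (¬∼+1 a b)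
    ... | yes a | no _ = ℕₚ.m≤m⊔n _ _ , ℕₚ.⊔-lub (ℕₚ.n≤1+n _)
      (ℕₚ.pred-mono-≤ (ℕₚ.≤-trans (proj₂ (step-pred st p)) (s≤s (proj₂ (st p)))))
    ... | no _ | yes b = subst (λ z → C (p + 1ℤ + 1ℤ) ℕ.⊔ ℕ.pred (C z) ℕ.≤ C p × C p ℕ.≤ suc
      (C (p + 1ℤ + 1ℤ) ℕ.⊔ ℕ.pred (C z))) (sym (+1-1 p))
        (ℕₚ.⊔-lub (ℕₚ.≤-trans (proj₁ (st (p + 1ℤ))) (proj₁ (st p))) ℕₚ.pred[n]≤n ,
         ℕₚ.≤-trans (≤suc-pred (C p)) (s≤s (ℕₚ.m≤n⊔m (C (p + 1ℤ + 1ℤ)) _)))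
      where
      ≤suc-pred : ∀ m → m ℕ.≤ suc (ℕ.pred m)
      ≤suc-pred zero = z≤n
      ≤suc-pred (suc m) = ℕₚ.≤-refl
    ... | no _ | no _ = st p

    c-++-off : ∀ as ws {p} → ¬ p ∼∈ as → c (as ++ ws) p ≡ c ws p
    c-++-off [] ws nm = refl
    c-++-off (i ∷ as) ws nm = trans (c-off i (as ++ ws) (nm ∘ here)) (c-++-off as ws (nm ∘ there))

  record Jumps (i : Fin n) (y : Word) : Set where
    constructor jump
    field
      {at} : ℤ
      at∼ : at ∼ i
      bead : g y at ≤ 0ℤ
      hole : 0ℤ < g y (at + 1ℤ)

  abstract
    jump⇒asc : ∀ i y → Jumps i y → Asc i y
    jump⇒asc i y (jump a b h) = mkAsc y a (ℤₚ.≤-<-trans b h)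

    jump⇒sorted : ∀ i y → Sorted y → Jumps i y → Sorted (i ∷ y)
    jump⇒sorted i y so (jump a b h) = sorted-jump i y so a b h

    -- The tail is built first, for the target `lower i C`. At the site p where C exceeds `c ws`,
    -- the tail has not changed the count, while at p - 1 and p + 1 it has already reached C. This
    -- forces a bead at p and a hole at p + 1, so every letter jumps and adds one to the length.
    realize : ∀ ws as → CyclicallyDecreasing as → ∀ {C} → Step C → Dom as C (c ws) →
      All (λ i → ∃ λ p → p ∼ i × c ws p ℕ.< C p) as → Sorted ws →
      C ≼ c (as ++ ws) × Sorted (as ++ ws) × ℓ (as ++ ws) ≡ length as ℕ.+ ℓ ws
    realize ws [] cd st dom ex so = (λ p → proj₂ (dom p) λ ()) , so , refl
    realize ws (i ∷ as) cd {C} st dom ((p , a , lt) ∷ ex) so with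
      realize ws as (proj₂ cd) (lower-Step i st)
        (dom-tail {C′ = lower i C} cd (c-Step ws) st (lower-off i C) (lower-at≤ i C) dom)
        (ex′ as ex (λ q b → proj₁ (proj₁ cd q b))) so
      where
      ex′ : ∀ as → All (λ i → ∃ λ p → p ∼ i × c ws p ℕ.< C p) as → (∀ q → q ∼ i → ¬ q ∼∈ as) → All
        (λ i′ → ∃ λ p → p ∼ i′ × c ws p ℕ.< lower i C p) as
      ex′ _ [] sep = []
      ex′ _ ((q , b , lt) ∷ ex) sep =
        (q , b , subst (c ws q ℕ.<_) (sym (lower-off i C (λ a → sep q a (here b)))) lt) ∷ ex′ _ ex
        (λ q a m → sep q a (there m))
    ... | le , so′ , len≡ = asc-lift i y (jump⇒asc i y jp) st off≤ , jump⇒sorted i y so′ jp ,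
      trans (ℓ-asc i y (jump⇒asc i y jp)) (cong suc len≡)
      where
      y : Word
      y = as ++ ws
      off≤ : ∀ q → ¬ q ∼ i → C q ℕ.≤ c y q
      off≤ q na = subst (ℕ._≤ c y q) (lower-off i C na) (le q)
      lt′ : c y p ℕ.< C p
      lt′ = subst (ℕ._< C p) (sym (c-++-off as ws (proj₁ (proj₁ cd p a)))) lt
      bit-one : ∀ {b m} → suc m ℕ.≤ b ℕ.+ m → b ℕ.≤ 1 → b ≡ 1
      bit-one {zero} h _ = ⊥-elim (ℕₚ.<-irrefl refl h)
      bit-one {suc zero} _ _ = refl
      bit-one {suc (suc _)} _ (s≤s ())
      bit-zero : ∀ {b m} → b ℕ.+ m ℕ.≤ m → b ≡ 0
      bit-zero {zero} _ = refl
      bit-zero {suc b} {m} h = ⊥-elim (ℕₚ.<-irrefl refl (ℕₚ.≤-trans (s≤s (ℕₚ.m≤n+m m b)) h))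
      jp : Jumps i y
      jp = jump a
        (β-one (bit-one (subst (suc (c y p) ℕ.≤_) (c-step⁻ y p)
          (ℕₚ.≤-trans lt′ (ℕₚ.≤-trans (proj₁ (step-pred st p)) (off≤ (p - 1ℤ) (¬∼-1 a))))) (β≤1 (g y p))))
        (β-zero (bit-zero (subst (ℕ._≤ c y (p + 1ℤ)) (c-step y p)
          (ℕₚ.≤-pred (ℕₚ.≤-trans lt′ (ℕₚ.≤-trans (proj₂ (st p)) (s≤s (off≤ (p + 1ℤ) (¬∼+1 a)))))))))

  -- Strong order

  Red : Word → Set
  Red ws = length ws ≡ ℓ ws

  abstract
    red-tail : ∀ i ws → Red (i ∷ ws) → Red ws × Asc i ws
    red-tail i ws e with asc? i ws
    ... | inj₁ a = ℕₚ.suc-injective (trans e (ℓ-asc i ws a)) , a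
    ... | inj₂ d = ⊥-elim (ℕₚ.<-irrefl refl
      (ℕₚ.<-≤-trans (ℕₚ.m<n+m (length ws) {2} (s≤s z≤n))
      (ℕₚ.≤-trans (ℕₚ.≤-reflexive (trans (cong suc e) (sym (ℓ-desc i ws d)))) (ℓ≤length ws))))

    red-cons : ∀ i ws → Red ws → Asc i ws → Red (i ∷ ws)
    red-cons i ws e a = trans (cong suc e) (sym (ℓ-asc i ws a))

    -- Every letter of a reduced word is an ascent of what follows it. Put on the larger word alone
    -- it raises counts; put on both, it makes the larger one maximal in class i.
    subword⇒≼ : ∀ {us ws} → Red ws → us ⊆ ws → c us ≼ c ws
    subword⇒≼ red [] p = ℕₚ.≤-refl
    subword⇒≼ {us} red (_∷ʳ_ {xs = .us} {ys = ws} i sub) p =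
      ℕₚ.≤-trans (subword⇒≼ (proj₁ (red-tail i ws red)) sub p) (asc-≼ i ws (proj₂ (red-tail i ws red)) p)
    subword⇒≼ red (_∷_ {x = i} {xs = us} {ys = ws} refl sub) =
      asc-lift i ws (proj₂ (red-tail i ws red)) (c-Step (i ∷ us))
        (λ q na → subst (ℕ._≤ c ws q) (sym (c-off i us na)) (subword⇒≼ (proj₁ (red-tail i ws red)) sub q))

    -- Conservation of charge: at a site further left than the word can reach, the count is that of
    -- the identity.
    c-far : ∀ ws m → length ws ℕ.≤ m → c ws -[1+ m ] ≡ suc m
    c-far [] m _ = refl
    c-far (i ∷ ws) (suc m) (s≤s le) with -[1+ suc m ] ∼? i
    ... | no _ = c-far ws (suc m) (ℕₚ.m≤n⇒m≤1+n le)
    ... | yes _ = trans (cong₂ ℕ._+_ (c-far ws m le) b) (ℕₚ.+-comm (suc m) 1)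
      where
      b : β (g ws -[1+ suc m ]) ≡ 1
      b = ℕₚ.+-cancelʳ-≡ (suc (suc m)) _ _
        (trans (cong (β (g ws -[1+ suc m ]) ℕ.+_) (sym (c-far ws (suc m) (ℕₚ.m≤n⇒m≤1+n le))))
            (trans (sym (c-step⁻ ws -[1+ suc m ]))
              (trans (cong (λ z → c ws -[1+ suc z ]) (ℕₚ.+-identityʳ (suc m)))
              (c-far ws (suc (suc m)) (ℕₚ.m≤n⇒m≤1+n (ℕₚ.m≤n⇒m≤1+n le))))))

    -- All counts agree far to the left, and none with steps of at most one can fall faster than
    -- that of the identity.
    c[]-least : ∀ ws → c [] ≼ c ws
    c[]-least ws (+ m) = z≤n
    c[]-least ws -[1+ m ] = down (length ws) m
      (ℕₚ.≤-reflexive (sym (c-far ws (length ws ℕ.+ m) (ℕₚ.m≤m+n _ _))))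
      where
      down : ∀ t m → suc (t ℕ.+ m) ℕ.≤ c ws -[1+ t ℕ.+ m ] → suc m ℕ.≤ c ws -[1+ m ]
      down zero m h = h
      down (suc t) m h = down t m (ℕₚ.≤-pred (ℕₚ.≤-trans h (proj₂ (c-Step ws -[1+ suc (t ℕ.+ m) ]))))

    sorted-[] : Sorted []
    sorted-[] u v _ lt _ = lt

    -- The beads compare x and y at level 0 only; translation by periods extends this to every level
    -- e * N.
    β⇒≤ : ∀ x y → (∀ p → β (g x p) ≡ β (g y p)) → ∀ p e → g x p ≤ e * N → g y p ≤ e * N
    β⇒≤ x y eq p e le = ≤⇒ {g y q} {0ℤ}
      (β-one (trans (sym (eq q)) (β-≤0
      (≤⇒ {g x p} {e * N} le (trans (cong (_-_ 0ℤ) (g-periodic x p (- e))) (l₁ (g x p) e N))))))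
        (trans (l₂ (g y p) e N) (cong (_-_ 0ℤ) (sym (g-periodic y p (- e)))))
      where
      q : ℤ
      q = p + - e * N
      l₁ : ∀ a e m → 0ℤ - (a + - e * m) ≡ e * m - a
      l₁ = solve-∀
      l₂ : ∀ a e m → e * m - a ≡ 0ℤ - (a + - e * m)
      l₂ = solve-∀

    ≤-lift : ∀ {φ : ℤ → ℤ} → (∀ u → 1ℤ ≤ u → u ≤ N → 1ℤ ≤ φ u) → (∀ u v → 1ℤ ≤ u → u < v → v ≤ N → φ u < φ v) →
      ∀ u → 1ℤ ≤ u → u ≤ N → u ≤ φ u
    ≤-lift {φ} into mono u 1≤u u≤N with ≤⇒+ 1≤u
    ... | t , refl = go t u≤N
      where
      go : ∀ t → 1ℤ + + t ≤ N → 1ℤ + + t ≤ φ (1ℤ + + t)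
      go zero le = into 1ℤ ℤₚ.≤-refl le
      go (suc t) le = ℤₚ.≤-trans (ℤₚ.≤-reflexive (l (+ t)))
        (ℤₚ.≤-trans (ℤₚ.+-monoˡ-≤ 1ℤ (go t (ℤₚ.≤-trans (ℤₚ.<⇒≤ lt) le)))
        (<⇒≤1 (mono _ _ (+≤+ (s≤s z≤n)) lt le)))
        where
        l : ∀ t → 1ℤ + (1ℤ + t) ≡ 1ℤ + t + 1ℤ
        l = solve-∀
        lt : 1ℤ + + t < 1ℤ + + suc t
        lt = +<+ ℕₚ.≤-refl

    module Compare (x y : Word) (sx : Sorted x) (sy : Sorted y) (eq : ∀ p → β (g x p) ≡ β (g y p)) where

      φ : ℤ → ℤ
      φ u = g y (f x u)

      φ≤N : ∀ u → u ≤ N → φ u ≤ N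
      φ≤N u le = subst (φ u ≤_) (ℤₚ.*-identityˡ N)
        (β⇒≤ x y eq (f x u) 1ℤ (ℤₚ.≤-trans (ℤₚ.≤-reflexive (g-f x u))
        (ℤₚ.≤-trans le (ℤₚ.≤-reflexive (sym (ℤₚ.*-identityˡ N))))))

      1≤φ : ∀ u → 1ℤ ≤ u → 1ℤ ≤ φ u
      1≤φ u le with φ u ℤₚ.≤? 0ℤ
      ... | no np = ℤₚ.≤-trans (ℤₚ.≤-reflexive (sym (ℤₚ.+-identityˡ 1ℤ))) (<⇒≤1 (ℤₚ.≰⇒> np))
      ... | yes p = ⊥-elim (absurd (ℤₚ.≤-trans le
        (subst (_≤ 0ℤ) (g-f x u) (β⇒≤ y x (λ p → sym (eq p)) (f x u) 0ℤ p))))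
        where
        absurd : ¬ 1ℤ ≤ 0ℤ
        absurd (+≤+ ())

      φ-mono : ∀ u v → 1ℤ ≤ u → u < v → v ≤ N → φ u < φ v
      φ-mono u v 1≤u u<v v≤N with ℤₚ.<-cmp (φ u) (φ v)
      ... | tri< lt _ _ = lt
      ... | tri≈ _ e _ = ⊥-elim (ℤₚ.<-irrefl (f-inj x (g-inj y e)) u<v)
      ... | tri> _ _ gt = ⊥-elim (ℤₚ.<-asym (sx u v 1≤u u<v v≤N)
          (subst₂ _<_ (f-g y (f x v)) (f-g y (f x u))
            (sy (φ v) (φ u) (1≤φ v (ℤₚ.≤-trans 1≤u (ℤₚ.<⇒≤ u<v))) gt (φ≤N u (ℤₚ.≤-trans (ℤₚ.<⇒≤ u<v) v≤N)))))

      φ-≥ : ∀ u → 1ℤ ≤ u → u ≤ N → u ≤ φ u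
      φ-≥ = ≤-lift (λ u a _ → 1≤φ u a) φ-mono

    window-reduce : ∀ p → ∃ λ u → ∃ λ e → 1ℤ ≤ u × u ≤ N × p ≡ u + e * N
    window-reduce p = + suc ((p - 1ℤ) %ℕ n) , (p - 1ℤ) /ℕ n , +≤+ (s≤s z≤n) , +≤+ (n%ℕd<d (p - 1ℤ) n) ,
      trans (sym (-1+1 p)) (trans (cong (_+ 1ℤ) (a≡a%ℕn+[a/ℕn]*n (p - 1ℤ) n))
        (l (+ ((p - 1ℤ) %ℕ n)) (((p - 1ℤ) /ℕ n) * N)))
      where
      l : ∀ a b → a + b + 1ℤ ≡ 1ℤ + a + b
      l = solve-∀

    -- The transition map `g y ∘ f x` preserves the window 1, ..., N, since x and y have the same
    -- sites at the levels 0 and N, and it is increasing since both are sorted. Hence u ≤ φ u, and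
    -- the same for the opposite transition gives equality.
    sorted-unique : ∀ x y → Sorted x → Sorted y → (∀ p → c x p ≡ c y p) → ∀ p → f x p ≡ f y p
    sorted-unique x y sx sy eq p = lemma (window-reduce p)
      where
      eqβ : ∀ p → β (g x p) ≡ β (g y p)
      eqβ = c⇒β x y eq
      module A = Compare x y sx sy eqβ
      module B = Compare y x sy sx (λ p → sym (eqβ p))
      lemma : (∃ λ u → ∃ λ e → 1ℤ ≤ u × u ≤ N × p ≡ u + e * N) → f x p ≡ f y p
      lemma (u , e , 1≤u , u≤N , refl) = trans (f-periodic x u e)
        (trans (cong (_+ e * N) f≡) (sym (f-periodic y u e)))
        where
        φ≤ : A.φ u ≤ u
        φ≤ = subst (A.φ u ≤_) (trans (cong (g x) (f-g y (f x u))) (g-f x u))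
          (B.φ-≥ (A.φ u) (A.1≤φ u 1≤u) (A.φ≤N u u≤N))
        f≡ : f x u ≡ f y u
        f≡ = trans (sym (f-g y (f x u))) (cong (f y) (ℤₚ.≤-antisym φ≤ (A.φ-≥ u 1≤u u≤N)))

    asc-f : ∀ i us ws → (∀ p → f us p ≡ f ws p) → Asc i ws → Asc i us
    asc-f i us ws e a p b = subst₂ _<_ (sym (f⇒g us ws e p)) (sym (f⇒g us ws e (p + 1ℤ))) (a p b)

    -- The lifting property: if x lies below `i ∷ ws`, then min(x, s_i x) lies below `ws`. The
    -- subword found there is preceded by i exactly when i is a descent of x.
    ≼⇒subword : ∀ ws x → Red ws → Sorted x → c x ≼ c ws → ∃ λ us → us ⊆ ws × (∀ p → f us p ≡ f x p) × Red us
    ≼⇒subword [] x red so le = [] , [] , sorted-unique [] x sorted-[] so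
      (λ p → ℕₚ.≤-antisym (c[]-least x p) (le p)) , sym ℓ-[]
    ≼⇒subword (i ∷ ws) x red so le = extend
      (≼⇒subword ws (psi i x) (proj₁ (red-tail i ws red)) (sorted-psi i x so) le′)
      where
      le′ : c (psi i x) ≼ c ws
      le′ p with p ∼? i
      ... | no na = subst₂ ℕ._≤_ (sym (psi-off i x na)) (c-off i ws na) (le p)
      ... | yes a = psi-at≤ i x a
              (ℕₚ.≤-trans (subst (c x (p + 1ℤ) ℕ.≤_) (c-off i ws (¬∼+1 a)) (le (p + 1ℤ))) (proj₁ (c-Step ws p)))
              (ℕₚ.≤-trans (subst (c x (p - 1ℤ) ℕ.≤_) (c-off i ws (¬∼-1 a)) (le (p - 1ℤ)))
                (proj₂ (step-pred (c-Step ws) p)))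
      extend : (∃ λ us → us ⊆ ws × (∀ p → f us p ≡ f (psi i x) p) × Red us) → ∃ λ us → us ⊆ i ∷ ws ×
        (∀ p → f us p ≡ f x p) × Red us
      extend (us , sub , e , r) with asc? i x
      ... | inj₁ _ = us , i ∷ʳ sub , e , r
      ... | inj₂ d = i ∷ us , refl ∷ sub , (λ p → trans (cong (s i) (e p)) (s-invol i (f x p))) ,
        red-cons i us r (asc-f i us (i ∷ x) e (desc⇒asc x d))

  -- Partitions and Grassmannian elements

  row : ℕ → ℕ → Word
  row i zero = []
  row i (suc m) = res K i (suc m) ∷ row i m

  pair : ℕ → ℕ → ℕ × ℕ
  pair = _,_

  AtLeast : ℕ → List ℕ → Set
  AtLeast m la = All (m ℕ.≤_) la

  abstract
    mod∼ : ∀ p → p ∼ ((p %ℕ n) ℕd.mod n)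
    mod∼ p = %⇒∼ (sym (trans (Finₚ.toℕ-fromℕ< (ℕd.m%n<n (p %ℕ n) n)) (ℕd.m<n⇒m%n≡m (n%ℕd<d p n))))

    -- `res` numbers cells from 1, so the cell in row l + 1 and column u + 1 has content u - l,
    -- which is the site of the bead that its letter moves.
    res∼ : ∀ l u → (- (+ l) + + u) ∼ res K (suc l) (suc u)
    res∼ l u = subst (_∼ res K (suc l) (suc u)) (eq (+ u) (+ l)) (mod∼ (+ suc u - + suc l))
      where
      eq : ∀ u l → 1ℤ + u - (1ℤ + l) ≡ - l + u
      eq = solve-∀

    range-snoc : ∀ d m → range d (suc m) ≡ range d m List.∷ʳ (d ℕ.+ m)
    range-snoc d zero = cong (_∷ []) (sym (ℕₚ.+-identityʳ d))
    range-snoc d (suc m) = cong (d ∷_)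
      (trans (range-snoc (suc d) m) (cong (λ z → range (suc d) m List.∷ʳ z) (sym (ℕₚ.+-suc d m))))

    map-suc-upTo : ∀ m → map suc (upTo m) ≡ range 1 m
    map-suc-upTo m = trans (Listₚ.map-upTo suc m) (applyUpTo≡range suc 1 m (λ _ → refl))

    row-res : ∀ i m → map (res K i) (reverse (map suc (upTo m))) ≡ row i m
    row-res i m = trans (cong (map (res K i) ∘ reverse) (map-suc-upTo m)) (go m)
      where
      go : ∀ m → map (res K i) (reverse (range 1 m)) ≡ row i m
      go zero = refl
      go (suc m) = trans (cong (map (res K i))
        (trans (cong reverse (range-snoc 1 m)) (Listₚ.reverse-++ (range 1 m) (suc m ∷ []))))
        (cong (res K i (suc m) ∷_) (go m))

    zip-snoc : ∀ d (la : List ℕ) m → zip (range d (length (la List.∷ʳ m))) (la List.∷ʳ m) ≡ zip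
      (range d (length la)) la List.∷ʳ (d ℕ.+ length la , m)
    zip-snoc d [] m = cong (λ z → List.[ pair z m ]) (sym (ℕₚ.+-identityʳ d))
    zip-snoc d (x ∷ la) m = cong (pair d x ∷_) (trans (zip-snoc (suc d) la m)
      (cong (λ z → zip (range (suc d) (length la)) la List.∷ʳ pair z m) (sym (ℕₚ.+-suc d (length la)))))

    readingWord-snoc : ∀ la m → readingWord K (la List.∷ʳ m) ≡ row (suc (length la)) m ++ readingWord K la
    readingWord-snoc la m = trans (cong (concatMap _) eq) (cong₂ _++_ (row-res (suc (length la)) m) refl)
      where
      eq : reverse (zip (map suc (upTo (length (la List.∷ʳ m)))) (la List.∷ʳ m)) ≡
        (suc (length la) , m) ∷ reverse (zip (map suc (upTo (length la))) la)
      eq = trans (cong {B = List (ℕ × ℕ)} (λ z → reverse (zip z (la List.∷ʳ m)))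
        (map-suc-upTo (length (la List.∷ʳ m))))
            (trans (cong reverse (zip-snoc 1 la m))
              (trans (Listₚ.reverse-++ (zip (range 1 (length la)) la) ((suc (length la) , m) ∷ []))
              (cong {B = List (ℕ × ℕ)} (λ z → (suc (length la) , m) ∷ reverse (zip z la))
                (sym (map-suc-upTo (length la))))))

    linked-snoc : ∀ {la m} → Linked ℕ._≥_ la → AtLeast m la → Linked ℕ._≥_ (la List.∷ʳ m)
    linked-snoc [] [] = [-]
    linked-snoc [-] (le ∷ []) = le ∷ [-]
    linked-snoc (x ∷ lk) (_ ∷ al) = x ∷ linked-snoc lk al

    linked-unsnoc : ∀ la {m} → Linked ℕ._≥_ (la List.∷ʳ m) → Linked ℕ._≥_ la × AtLeast m la
    linked-unsnoc [] lk = [] , []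
    linked-unsnoc (x ∷ []) (le ∷ lk) = [-] , le ∷ []
    linked-unsnoc (x ∷ y ∷ la) (le ∷ lk) with linked-unsnoc (y ∷ la) lk
    ... | lk′ , m≤y ∷ al = le ∷ lk′ , ℕₚ.≤-trans m≤y le ∷ m≤y ∷ al

  -- The state while row l + 1 is being read, with h = -l: the last bead of the solid block on the
  -- left has travelled from h to h + u, along a path of which t sites beyond h are under control.
  record OneBead (h : ℤ) (t u : ℕ) (G : ℤ → ℤ) : Set where
    field
      below : ∀ q → q < h → G q ≤ 0ℤ
      here′ : G (h + + u) ≤ 0ℤ
      empty : ∀ r → r ℕ.≤ t → r ≢ u → 0ℤ < G (h + + r)

  open OneBead

  abstract
    same-class : ∀ {i} b {x y} → (b + + x) ∼ i → (b + + y) ∼ i → x ℕ.< n → y ℕ.< n → x ≡ y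
    same-class {i} b {x} {y} p q x<n y<n with ℕₚ.≤-total x y
    ... | inj₁ le = sym (ℕₚ.≤-antisym
      (ℕₚ.m∸n≡0⇒m≤n (∼-separated {b + + x} {i} {y ∸ x} p (subst (_∼ i) (eq le) q)
      (ℕₚ.≤-<-trans (ℕₚ.m∸n≤m y x) y<n))) le)
      where
      eq : ∀ {x y} → x ℕ.≤ y → b + + y ≡ b + + x + + (y ∸ x)
      eq {x} {y} le = trans (cong (λ z → b + + z) (sym (ℕₚ.m+[n∸m]≡n le)))
        (sym (ℤₚ.+-assoc b (+ x) (+ (y ∸ x))))
    ... | inj₂ le = ℕₚ.≤-antisym (ℕₚ.m∸n≡0⇒m≤n
      (∼-separated {b + + y} {i} {x ∸ y} q (subst (_∼ i) (eq le) p) (ℕₚ.≤-<-trans (ℕₚ.m∸n≤m x y) x<n))) le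
      where
      eq : ∀ {x y} → x ℕ.≤ y → b + + y ≡ b + + x + + (y ∸ x)
      eq {x} {y} le = trans (cong (λ z → b + + z) (sym (ℕₚ.m+[n∸m]≡n le)))
        (sym (ℤₚ.+-assoc b (+ x) (+ (y ∸ x))))

    -- As t ≤ K, the sites h, ..., h + t are distinct modulo n, so the letter affects none of them
    -- except h + u and h + u + 1. The site h - 1 is likewise out of its reach, which keeps the
    -- block on the left solid.
    module Move {i h t u} (a : (h + + u) ∼ i) (u<t : suc u ℕ.≤ t) (t≤K : t ℕ.≤ K) where

      next : h + + u + 1ℤ ≡ h + + suc u
      next = trans (ℤₚ.+-assoc h (+ u) 1ℤ) (cong (λ z → h + + z) (ℕₚ.+-comm u 1))

      a⁻ : (h - 1ℤ + + suc u) ∼ i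
      a⁻ = subst (_∼ i) (l h (+ u)) a
        where
        l : ∀ h u → h + u ≡ h - 1ℤ + (1ℤ + u)
        l = solve-∀

      up≡ : s i (h + + u) ≡ h + + suc u
      up≡ = trans (s-up a) next

      dn≡ : s i (h + + suc u) ≡ h + + u
      dn≡ = trans (cong (s i) (sym next)) (s-dn a)

      other : ∀ r → r ℕ.≤ t → r ≢ u → r ≢ suc u → s i (h + + r) ≡ h + + r
      other r r≤t r≢u r≢su = s-fix
        (λ b → r≢u (same-class h b a (s≤s (ℕₚ.≤-trans r≤t t≤K)) (s≤s (ℕₚ.≤-trans (ℕₚ.<⇒≤ u<t) t≤K))))
        (λ b → r≢su (same-class (h - 1ℤ) (subst (_∼ i) (+-swap h (+ r) -1ℤ) b) a⁻ (s≤s (ℕₚ.≤-trans r≤t t≤K))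
          (s≤s (ℕₚ.≤-trans u<t t≤K))))

      stays-below : ∀ q → q < h → s i q < h
      stays-below q lt with view i q
      ... | isFix x y = subst (_< h) (sym (s-fix x y)) lt
      ... | isDn {q′} b = subst (_< h) (sym (s-dn b)) (ℤₚ.<-trans (p<p+1 q′) lt)
      ... | isUp b with ℤₚ.<-cmp (q + 1ℤ) h
      ...   | tri< lt′ _ _ = subst (_< h) (sym (s-up b)) lt′
      ...   | tri> _ _ gt = ⊥-elim (ℤₚ.<-irrefl refl (ℤₚ.<-≤-trans gt (<⇒≤1 lt)))
      ...   | tri≈ _ e _ = ⊥-elim (ℕₚ.1+n≢0
        (sym (same-class (h - 1ℤ) {0} {suc u} (subst (_∼ i) (l q h e) b) a⁻ (s≤s z≤n)
        (s≤s (ℕₚ.≤-trans u<t t≤K)))))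
        where
        l₁ : ∀ q → q ≡ q + 1ℤ - 1ℤ + 0ℤ
        l₁ = solve-∀
        l : ∀ q h → q + 1ℤ ≡ h → q ≡ h - 1ℤ + 0ℤ
        l q h refl = l₁ q

      move-up : ∀ {G} → OneBead h t u G → OneBead h t (suc u) (G ∘ s i)
      move-up {G} ob .below q lt = below ob (s i q) (stays-below q lt)
      move-up {G} ob .here′ = subst (λ z → G z ≤ 0ℤ) (sym dn≡) (here′ ob)
      move-up {G} ob .empty r r≤t r≢su with r ℕₚ.≟ u
      ... | yes refl = subst (λ z → 0ℤ < G z) (sym up≡) (empty ob (suc u) u<t (ℕₚ.1+n≢n))
      ... | no r≢u = subst (λ z → 0ℤ < G z) (sym (other r r≤t r≢u r≢su)) (empty ob r r≤t r≢u)

      move-down : ∀ {G} → OneBead h t (suc u) G → OneBead h t u (G ∘ s i)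
      move-down {G} ob .below q lt = below ob (s i q) (stays-below q lt)
      move-down {G} ob .here′ = subst (λ z → G z ≤ 0ℤ) (sym up≡) (here′ ob)
      move-down {G} ob .empty r r≤t r≢u with r ℕₚ.≟ suc u
      ... | yes refl = subst (λ z → 0ℤ < G z) (sym dn≡) (empty ob u (ℕₚ.<⇒≤ u<t) (ℕₚ.1+n≢n ∘ sym))
      ... | no r≢su = subst (λ z → 0ℤ < G z) (sym (other r r≤t r≢u r≢su)) (empty ob r r≤t r≢su)

    row-moves : ∀ l t y → t ℕ.≤ K → Sorted y → Red y → OneBead (- (+ l)) t 0 (g y) → ∀ u → u ℕ.≤ t →
      Sorted (row (suc l) u ++ y) × Red (row (suc l) u ++ y) × OneBead (- (+ l)) t u (g (row (suc l) u ++ y))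
    row-moves l t y t≤K so red ob zero _ = so , red , ob
    row-moves l t y t≤K so red ob (suc u) u<t = jump⇒sorted i z (proj₁ ih) jp , red-cons i z (proj₁ (proj₂ ih))
      (jump⇒asc i z jp) , M.move-up ob′
      where
      i : Fin n
      i = res K (suc l) (suc u)
      z : Word
      z = row (suc l) u ++ y
      ih : Sorted z × Red z × OneBead (- (+ l)) t u (g z)
      ih = row-moves l t y t≤K so red ob u (ℕₚ.<⇒≤ u<t)
      ob′ : OneBead (- (+ l)) t u (g z)
      ob′ = proj₂ (proj₂ ih)
      module M = Move {i} { - (+ l)} {t} {u} (res∼ l u) u<t t≤K
      jp : Jumps i z
      jp = jump (res∼ l u) (here′ ob′) (subst (λ q → 0ℤ < g z q) (sym M.next) (empty ob′ (suc u) u<t ℕₚ.1+n≢n))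

  -- `holes` is what the next row requires: a row no longer than the earlier ones finds its path
  -- free.
  record Diagram (la : List ℕ) : Set where
    field
      sorted : Sorted (readingWord K la)
      red    : Red (readingWord K la)
      beads  : ∀ q → q ≤ - (+ length la) → g (readingWord K la) q ≤ 0ℤ
      holes  : ∀ t → t ℕ.≤ K → AtLeast t la → ∀ r → r ℕ.< t → 0ℤ < g (readingWord K la)
        (- (+ length la) + + suc r)

  abstract
    diagram-snoc : ∀ la m → m ℕ.≤ K → AtLeast m la → Diagram la → Diagram (la List.∷ʳ m)
    diagram-snoc la m m≤K al D = record
      { sorted = subst Sorted (sym rw) (proj₁ mv)
      ; red    = subst Red (sym rw) (proj₁ (proj₂ mv))
      ; beads  = λ q le → subst (λ w → g w q ≤ 0ℤ) (sym rw)
        (below ob q (≤1⇒< (≤⇒ (subst (λ z → q ≤ - (+ z)) len≡ le) (l₁ q (+ l)))))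
      ; holes  = λ t t≤K al′ r r<t → subst₂ (λ w z → 0ℤ < g w (- (+ z) + + suc r)) (sym rw) (sym len≡)
                   (subst (λ z → 0ℤ < g (row (suc l) m ++ y) z) (l₂ (+ l) (+ r))
                     (empty ob r (r≤m t al′ r<t) (ℕₚ.<⇒≢ (r<m t al′ r<t))))
      }
      where
      l : ℕ
      l = length la
      y : Word
      y = readingWord K la
      open Diagram D
      rw : readingWord K (la List.∷ʳ m) ≡ row (suc l) m ++ y
      rw = readingWord-snoc la m
      len≡ : length (la List.∷ʳ m) ≡ suc l
      len≡ = trans (Listₚ.length-++ la) (ℕₚ.+-comm l 1)
      l₀ : ∀ l → - l + 0ℤ ≡ - l
      l₀ = solve-∀
      l₁ : ∀ q l → - l - (q + 1ℤ) ≡ - (1ℤ + l) - q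
      l₁ = solve-∀
      l₂ : ∀ l r → - l + r ≡ - (1ℤ + l) + (1ℤ + r)
      l₂ = solve-∀
      start : OneBead (- (+ l)) m 0 (g y)
      start .below q lt = beads q (ℤₚ.<⇒≤ lt)
      start .here′ = beads _ (ℤₚ.≤-reflexive (l₀ (+ l)))
      start .empty zero _ ne = ⊥-elim (ne refl)
      start .empty (suc r) le _ = holes m m≤K al r le
      mv : Sorted (row (suc l) m ++ y) × Red (row (suc l) m ++ y) × OneBead (- (+ l)) m m
        (g (row (suc l) m ++ y))
      mv = row-moves l m y m≤K sorted red start m ℕₚ.≤-refl
      ob : OneBead (- (+ l)) m m (g (row (suc l) m ++ y))
      ob = proj₂ (proj₂ mv)
      last≥ : ∀ la {t} → AtLeast t (la List.∷ʳ m) → t ℕ.≤ m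
      last≥ [] (le ∷ []) = le
      last≥ (x ∷ la) (_ ∷ al) = last≥ la al
      r<m : ∀ t {r} → AtLeast t (la List.∷ʳ m) → r ℕ.< t → r ℕ.< m
      r<m t al′ r<t = ℕₚ.<-≤-trans r<t (last≥ la al′)
      r≤m : ∀ t {r} → AtLeast t (la List.∷ʳ m) → r ℕ.< t → r ℕ.≤ m
      r≤m t al′ r<t = ℕₚ.<⇒≤ (r<m t al′ r<t)

    diagram : ∀ la → Pk K la → Diagram la
    diagram la pk = go (reverseView la) pk
      where
      go : ∀ {la} → Reverse la → Pk K la → Diagram la
      go [] _ = record { sorted = sorted-[] ; red = sym ℓ-[] ; beads = λ q le → le ; holes = λ t _ _ r _ → +<+
        (s≤s z≤n) }
      go (la ∶ rv ∶ʳ m) (lk , al) = diagram-snoc la m (proj₂ (proj₂ (Allₚ.∷ʳ⁻ al)))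
        (proj₂ (linked-unsnoc la lk)) (go rv (proj₁ (linked-unsnoc la lk) , proj₁ (Allₚ.∷ʳ⁻ al)))

    row-undo : ∀ l t → t ℕ.≤ K → ∀ u → u ℕ.≤ t → ∀ z → Sorted z → OneBead (- (+ l)) t u (g z) →
      ∃ λ y → Sorted y × OneBead (- (+ l)) t 0 (g y) × (∀ p → f (row (suc l) u) (f y p) ≡ f z p)
    row-undo l t t≤K zero _ z so ob = z , so , ob , λ p → refl
    row-undo l t t≤K (suc u) u<t z so ob = finish
      (row-undo l t t≤K u (ℕₚ.<⇒≤ u<t) (i ∷ z) (sorted-desc i z so desc) (M.move-down ob))
      where
      i : Fin n
      i = res K (suc l) (suc u)
      module M = Move {i} { - (+ l)} {t} {u} (res∼ l u) u<t t≤K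
      desc : Desc i z
      desc = mkDesc z (res∼ l u) (ℤₚ.≤-<-trans (subst (λ q → g z q ≤ 0ℤ) (sym M.next) (here′ ob))
        (empty ob u (ℕₚ.<⇒≤ u<t) (ℕₚ.1+n≢n ∘ sym)))
      finish : (∃ λ y → Sorted y × OneBead (- (+ l)) t 0 (g y) ×
        (∀ p → f (row (suc l) u) (f y p) ≡ f (i ∷ z) p)) →
        ∃ λ y → Sorted y × OneBead (- (+ l)) t 0 (g y) × (∀ p → f (row (suc l) (suc u)) (f y p) ≡ f z p)
      finish (y , so′ , ob′ , e) = y , so′ , ob′ , λ p → trans (cong (s i) (e p)) (s-invol i (f z p))

    -- The count agrees with the identity far to the left, and a solid block up to 0 uses all of it
    -- up, so no bead remains to the right of 0.
    beads⇒c : ∀ y → (∀ q → q ≤ 0ℤ → g y q ≤ 0ℤ) → ∀ p → c y p ≡ c [] p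
    beads⇒c y bd -[1+ m ] = down (length y) m (c-far y (length y ℕ.+ m) (ℕₚ.m≤m+n _ _))
      where
      down : ∀ t m → c y -[1+ t ℕ.+ m ] ≡ suc (t ℕ.+ m) → c y -[1+ m ] ≡ suc m
      down zero m h = h
      down (suc t) m h = down t m (ℕₚ.suc-injective
        (trans (sym (trans (c-step y -[1+ suc (t ℕ.+ m) ])
        (cong (ℕ._+ c y -[1+ t ℕ.+ m ]) (β-≤0 (bd _ -≤+))))) h))
    beads⇒c y bd (+ m) = ℕₚ.n≤0⇒n≡0 (ℕₚ.≤-trans (step-anti (c-Step y) {0ℤ} (+≤+ z≤n)) (ℕₚ.≤-reflexive
        (ℕₚ.suc-injective (trans (sym (trans (c-step y -[1+ 0 ]) (cong (ℕ._+ c y 0ℤ) (β-≤0 (bd 0ℤ ℤₚ.≤-refl)))))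
          (beads⇒c y bd -[1+ 0 ])))))

    -- A block of n holes meets every class, and shifting right by periods keeps `g` positive, so no
    -- bead lies beyond it and the count just left of it is 0. The identity, whose count is least,
    -- already has l + 1 there.
    no-hole-block : ∀ y l → (∀ r → r ℕ.< n → 0ℤ < g y (- (+ l) + + r)) → ⊥
    no-hole-block y l hl = ℕₚ.1+n≢0
      (ℕₚ.n≤0⇒n≡0 (ℕₚ.≤-trans (ℕₚ.≤-trans (ℕₚ.≤-reflexive (c[] l)) (c[]-least y (- (+ l) - 1ℤ)))
      (ℕₚ.≤-reflexive vanish)))
      where
      c[] : ∀ l → suc l ≡ c [] (- (+ l) - 1ℤ)
      c[] zero = refl
      c[] (suc l) = cong (λ z → suc (suc z)) (sym (ℕₚ.+-identityʳ l))
      all : ∀ T → 0ℤ < g y (- (+ l) + + T)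
      all T = subst (0ℤ <_) (trans (sym (g-periodic y (- (+ l) + + (T ℕ.% n)) (+ (T ℕ./ n)))) (cong (g y) eq))
                (ℤₚ.<-≤-trans (hl (T ℕ.% n) (ℕd.m%n<n T n))
                  (≤⇒ {0ℤ} {+ (T ℕ./ n) * N} (subst (0ℤ ≤_) (ℤₚ.pos-* (T ℕ./ n) n) (+≤+ z≤n))
                  (l₁ (g y (- (+ l) + + (T ℕ.% n))) (+ (T ℕ./ n) * N))))
        where
        l₁ : ∀ a b → a + b - a ≡ b - 0ℤ
        l₁ = solve-∀
        eq : - (+ l) + + (T ℕ.% n) + + (T ℕ./ n) * N ≡ - (+ l) + + T
        eq = trans (ℤₚ.+-assoc (- (+ l)) _ _)
          (cong (_+_ (- (+ l))) (sym (trans (cong +_ (ℕd.m≡m%n+[m/n]*n T n))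
          (cong (_+_ (+ (T ℕ.% n))) (ℤₚ.pos-* (T ℕ./ n) n)))))
      const : ∀ T → c y (- (+ l) - 1ℤ) ≡ c y (- (+ l) - 1ℤ + + T)
      const zero = cong (c y) (sym (ℤₚ.+-identityʳ _))
      const (suc T) = trans (const T)
        (trans (c-step y _) (trans (cong (ℕ._+ c y (- (+ l) - 1ℤ + + T + 1ℤ))
        (β-0< (subst (λ z → 0ℤ < g y z) (l₁ (- (+ l)) (+ T)) (all T))))
                        (cong (c y) (l₂ (- (+ l)) (+ T)))))
        where
        l₁ : ∀ h t → h + t ≡ h - 1ℤ + t + 1ℤ
        l₁ = solve-∀
        l₂ : ∀ h t → h - 1ℤ + t + 1ℤ ≡ h - 1ℤ + (1ℤ + t)
        l₂ = solve-∀
      vanish : c y (- (+ l) - 1ℤ) ≡ 0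
      vanish = trans (const (suc (l ℕ.+ length y))) (c-vanishes y _ (ℤₚ.≤-reflexive (l₁ (+ l) (+ length y))))
        where
        l₁ : ∀ l m → m ≡ - l - 1ℤ + (1ℤ + (l + m))
        l₁ = solve-∀

    first-bead : ∀ (G : ℕ → ℤ) m → (∀ r → r ℕ.< m → 0ℤ < G r) ⊎
      (∃ λ t → t ℕ.< m × G t ≤ 0ℤ × (∀ r → r ℕ.< t → 0ℤ < G r))
    first-bead G zero = inj₁ λ _ ()
    first-bead G (suc m) with first-bead G m
    ... | inj₂ (t , t<m , b , hl) = inj₂ (t , ℕₚ.m≤n⇒m≤1+n t<m , b , hl)
    ... | inj₁ hl with G m ℤₚ.≤? 0ℤ
    ...   | yes b = inj₂ (m , ℕₚ.n<1+n m , b , hl)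
    ...   | no nb = inj₁ hl′
      where
      hl′ : ∀ r → r ℕ.< suc m → 0ℤ < G r
      hl′ r (s≤s r≤m) with ℕₚ.m≤n⇒m<n∨m≡n r≤m
      ... | inj₁ lt = hl r lt
      ... | inj₂ refl = ℤₚ.≰⇒> nb

    -- `l` is the number of rows still to be read. The first bead after the solid block belongs to
    -- the shortest row; its moves are undone and the recursion finds the others. The last
    -- component, bounding all parts from below by the number of free sites, is what makes the parts
    -- weakly decreasing.
    find-rows : ∀ l y → Sorted y → (∀ q → q ≤ - (+ l) → g y q ≤ 0ℤ) → l ≡ 0 ⊎ 0ℤ < g y (- (+ l) + 1ℤ) →
      ∃ λ la → Pk K la × length la ≡ l × (∀ p → f (readingWord K la) p ≡ f y p) ×
        (∀ t → (∀ r → r ℕ.< t → 0ℤ < g y (- (+ l) + + suc r)) → AtLeast t la)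
    find-rows zero y so bd _ = [] , ([] , []) , refl , sorted-unique [] y sorted-[] so
      (λ p → sym (beads⇒c y bd p)) , λ _ _ → []
    find-rows (suc l) y so bd (inj₂ hole) = build (first-bead (λ r → g y (- (+ l) + + r)) n)
      where
      Goal : Set
      Goal = ∃ λ la → Pk K la × length la ≡ suc l × (∀ p → f (readingWord K la) p ≡ f y p) ×
        (∀ t → (∀ r → r ℕ.< t → 0ℤ < g y (- (+ suc l) + + suc r)) → AtLeast t la)
      l₀ : ∀ l → - l + 0ℤ ≡ - l
      l₀ = solve-∀
      l₁ : ∀ l → - (1ℤ + l) + 1ℤ ≡ - l + 0ℤ
      l₁ = solve-∀
      l₂ : ∀ l r → - (1ℤ + l) + (1ℤ + r) ≡ - l + r
      l₂ = solve-∀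
      l₃ : ∀ q l → - (1ℤ + l) - q ≡ - l - (q + 1ℤ)
      l₃ = solve-∀
      build : (∀ r → r ℕ.< n → 0ℤ < g y (- (+ l) + + r)) ⊎
        (∃ λ t → t ℕ.< n × g y (- (+ l) + + t) ≤ 0ℤ × (∀ r → r ℕ.< t → 0ℤ < g y (- (+ l) + + r))) → Goal
      -- Excluding a block of n holes is what bounds the length of the row by k.
      build (inj₁ hl) = ⊥-elim (no-hole-block y l hl)
      build (inj₂ (zero , _ , b , _)) = ⊥-elim
        (ℤₚ.<-irrefl refl (ℤₚ.<-≤-trans (subst (λ z → 0ℤ < g y z) (l₁ (+ l)) hole) b))
      build (inj₂ (t@(suc t′) , s≤s t≤K , b , hl)) = finish (row-undo l t t≤K t ℕₚ.≤-refl y so ob)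
        where
        ob : OneBead (- (+ l)) t t (g y)
        ob .below q lt = bd q (≤⇒ (<⇒≤1 lt) (l₃ q (+ l)))
        ob .here′ = b
        ob .empty r r≤t r≢t = hl r (ℕₚ.≤∧≢⇒< r≤t r≢t)
        finish : (∃ λ z → Sorted z × OneBead (- (+ l)) t 0 (g z) × (∀ p → f (row (suc l) t) (f z p) ≡ f y p)) →
          Goal
        finish (z , so′ , ob′ , e) = extend (find-rows l z so′ bd′ (inj₂ (empty ob′ 1 (s≤s z≤n) λ ())))
          where
          bd′ : ∀ q → q ≤ - (+ l) → g z q ≤ 0ℤ
          bd′ q le with ℤₚ.<-cmp q (- (+ l))
          ... | tri< lt _ _ = below ob′ q lt
          ... | tri≈ _ refl _ = subst (λ v → g z v ≤ 0ℤ) (l₀ (+ l)) (here′ ob′)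
          ... | tri> _ _ gt = ⊥-elim (ℤₚ.<-irrefl refl (ℤₚ.<-≤-trans gt le))
          extend : (∃ λ la → Pk K la × length la ≡ l × (∀ p → f (readingWord K la) p ≡ f z p) ×
            (∀ t → (∀ r → r ℕ.< t → 0ℤ < g z (- (+ l) + + suc r)) → AtLeast t la)) → Goal
          extend (la , (lk , al) , refl , e′ , atl) =
            la List.∷ʳ t , (linked-snoc lk (atl t (λ r r<t → empty ob′ (suc r) r<t λ ())) , Allₚ.∷ʳ⁺ al
              (s≤s z≤n , t≤K)) ,
            trans (Listₚ.length-++ la) (ℕₚ.+-comm (length la) 1) ,
            (λ p → trans (cong (λ w → f w p) (readingWord-snoc la t))
              (trans (f-++ (row (suc l) t) (readingWord K la) p)
              (trans (cong (f (row (suc l) t)) (e′ p)) (e p)))) ,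
            λ t₂ hl₂ → Allₚ.∷ʳ⁺ (atl t₂ (λ r r<t₂ → empty ob′ (suc r) (ℕₚ.≤-trans r<t₂ (t₂≤t t₂ hl₂)) λ ()))
              (t₂≤t t₂ hl₂)
            where
            t₂≤t : ∀ t₂ → (∀ r → r ℕ.< t₂ → 0ℤ < g y (- (+ suc l) + + suc r)) → t₂ ℕ.≤ t
            t₂≤t t₂ hl₂ with t₂ ℕₚ.≤? t
            ... | yes le = le
            ... | no nle = ⊥-elim (ℤₚ.<-irrefl refl
              (ℤₚ.<-≤-trans (subst (λ v → 0ℤ < g y v) (l₂ (+ l) (+ t)) (hl₂ t (ℕₚ.≰⇒> nle))) b))

  abstract
    -- The number of rows is found by extending the solid block of beads to the right until a hole
    -- follows or the site 0 is reached.
    sorted⇒partition : ∀ y → Sorted y → ∃ λ la → Pk K la × (∀ p → f (readingWord K la) p ≡ f y p)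
    sorted⇒partition y so = search (suc (length y)) far
      where
      far : ∀ q → q ≤ - (+ suc (length y)) → g y q ≤ 0ℤ
      far -[1+ m ] (-≤- le) = β-one (ℕₚ.+-cancelʳ-≡ (suc m) _ _
        (trans (cong (β (g y -[1+ m ]) ℕ.+_) (sym (c-far y m le)))
         (trans (sym (c-step y -[1+ suc m ])) (c-far y (suc m) (ℕₚ.m≤n⇒m≤1+n le)))))
      search : ∀ L → (∀ q → q ≤ - (+ L) → g y q ≤ 0ℤ) → ∃ λ la → Pk K la ×
        (∀ p → f (readingWord K la) p ≡ f y p)
      drop-rest : ∀ L → (∀ q → q ≤ - (+ L) → g y q ≤ 0ℤ) → L ≡ 0 ⊎ 0ℤ < g y (- (+ L) + 1ℤ) → ∃ λ la → Pk K la ×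
        (∀ p → f (readingWord K la) p ≡ f y p)
      drop-rest L bd h = let la , pk , _ , e , _ = find-rows L y so bd h in la , pk , e
      search zero bd = drop-rest 0 bd (inj₁ refl)
      search (suc L) bd with β-cases (g y (- (+ suc L) + 1ℤ))
      ... | inj₂ (hole , _) = drop-rest (suc L) bd (inj₂ hole)
      ... | inj₁ (b , _) = search L bd′
        where
        l₁ : ∀ l → - (1ℤ + l) + 1ℤ ≡ - l
        l₁ = solve-∀
        l₂ : ∀ q l → - (1ℤ + l) - q ≡ - l - (q + 1ℤ)
        l₂ = solve-∀
        bd′ : ∀ q → q ≤ - (+ L) → g y q ≤ 0ℤ
        bd′ q le with ℤₚ.<-cmp q (- (+ L))
        ... | tri< lt _ _ = bd q (≤⇒ (<⇒≤1 lt) (l₂ q (+ L)))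
        ... | tri≈ _ refl _ = subst (λ v → g y v ≤ 0ℤ) (l₁ (+ L)) b
        ... | tri> _ _ gt = ⊥-elim (ℤₚ.<-irrefl refl (ℤₚ.<-≤-trans gt le))

  -- The words of the elements d_A

  -- The local search functions of firstOut and invAt have no name outside Defs;
  -- the equations that follow solve the underscores to them.
  mutual
    scanOut : ∀ k → Subset (suc k) → List (Fin (suc k)) → ℕ
    scanOut = _

    firstOut-scan : ∀ k A → firstOut k A ≡
      (if Vec.lookup A Fin.zero then scanOut k A (List.tabulate Fin.suc) else 0)
    firstOut-scan k A with List.tabulate {n = k} (λ i → Fin.suc i)
    ... | L = refl

  mutual
    scanInv : ∀ k → Window → ℤ → List ℤ → ℤ
    scanInv = _

    invAt-scan : ∀ k w p → invAt k w p ≡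
      (if ((eval k w 1ℤ - p) %ℕ suc k) ℕ.≡ᵇ 0 then 1ℤ - ((eval k w 1ℤ - p) /ℕ suc k) * (+ suc k)
      else scanInv k w p (map (λ i → + suc i) (applyUpTo suc k)))
    invAt-scan k w p with map (λ i → + suc i) (applyUpTo suc k)
    ... | L = refl

  abstract
    scanOut-out : ∀ k A L → Any (λ i → Vec.lookup A i ≡ false) L → ∃ λ i →
      scanOut k A L ≡ toℕ i × Vec.lookup A i ≡ false
    scanOut-out k A (i ∷ L) out with Vec.lookup A i in e
    ... | false = i , refl , e
    scanOut-out k A (i ∷ L) (here b) | true with () ← trans (sym e) b
    scanOut-out k A (i ∷ L) (there out) | true = scanOut-out k A L out

    firstOut-out : ∀ k (A : Subset (suc k)) → (∃ λ i → Vec.lookup A i ≡ false) → ∃ λ i →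
      firstOut k A ≡ toℕ i × Vec.lookup A i ≡ false
    firstOut-out k A (i₀ , out) = scanOut-out k A (allFin (suc k))
      (Any.map (λ eq → subst (λ z → Vec.lookup A z ≡ false) eq out) (∈-tabulate⁺ {f = id} i₀))

    allᵇ-true : ∀ {X : Set} (p : X → Bool) L → allᵇ p L ≡ true → All (λ x → p x ≡ true) L
    allᵇ-true p [] _ = []
    allᵇ-true p (x ∷ L) e with p x in eq
    ... | true = eq ∷ allᵇ-true p L e

    allᵇ-intro : ∀ {X : Set} (p : X → Bool) L → All (λ x → p x ≡ true) L → allᵇ p L ≡ true
    allᵇ-intro p [] [] = refl
    allᵇ-intro p (x ∷ L) (e ∷ al) rewrite e = allᵇ-intro p L al

    allᵇ-false : ∀ {X : Set} (p : X → Bool) L → allᵇ p L ≡ false → Any (λ x → p x ≡ false) L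
    allᵇ-false p (x ∷ L) e with p x in eq
    ... | true = there (allᵇ-false p L e)
    ... | false = here eq

    not-full : ∀ (A : Subset n) → isFull K A ≡ false → ∃ λ i → Vec.lookup A i ≡ false
    not-full A e = Any.satisfied (allᵇ-false (Vec.lookup A) (allFin n) e)

    full-false : ∀ (A : Subset n) i → Vec.lookup A i ≡ false → isFull K A ≡ false
    full-false A i e with isFull K A in eq
    ... | false = refl
    ... | true with () ← trans (sym
      (All.lookup (allᵇ-true (Vec.lookup A) (allFin n) eq) (∈-tabulate⁺ {f = id} i))) e

    length-filter-subset : ∀ {m} (A : Subset m) {X : Set} (h : Fin m → X) (q : X → Bool) →
      (∀ i → q (h i) ≡ Vec.lookup A i) →
      length (filter (λ x → T? (q x)) (List.tabulate h)) ≡ ∣ A ∣ˢ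
    length-filter-subset Vec.[] h q e = refl
    length-filter-subset (true Vec.∷ A) h q e rewrite e Fin.zero = cong suc
      (length-filter-subset A (h ∘ Fin.suc) q (e ∘ Fin.suc))
    length-filter-subset (false Vec.∷ A) h q e rewrite e Fin.zero = length-filter-subset A (h ∘ Fin.suc) q
      (e ∘ Fin.suc)

    nat∼ : ∀ m → (+ m) ∼ (m ℕd.mod n)
    nat∼ m = %⇒∼ (sym (Finₚ.toℕ-fromℕ< (ℕd.m%n<n m n)))

  Apart : Fin n → Fin n → Set
  Apart i i′ = ∀ p → p ∼ i → ¬ p ∼ i′ × ¬ (p + 1ℤ) ∼ i′

  abstract
    apart⇒decreasing : ∀ {as} → AllPairs Apart as → CyclicallyDecreasing as
    apart⇒decreasing [] = tt
    apart⇒decreasing {i ∷ as} (al ∷ ap) =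
      (λ p a → none (λ ap → proj₁ (ap p a)) al , none (λ ap → proj₂ (ap p a)) al) , apart⇒decreasing ap
      where
      none : ∀ {as q} → (∀ {i′} → Apart i i′ → ¬ q ∼ i′) → All (Apart i) as → ¬ q ∼∈ as
      none no′ (a ∷ _) (here b) = no′ a b
      none no′ (_ ∷ al) (there m) = none no′ al m

  module Letters (A : Subset n) (nf : ∃ λ i → Vec.lookup A i ≡ false) where

    b₀ : ℕ
    b₀ = firstOut K A

    letter : ℕ → Fin n
    letter t = (b₀ ℕ.+ n ∸ suc t) ℕd.mod n

    letters : Word
    letters = map letter (upTo K)

    abstract
      out : ∃ λ i → b₀ ≡ toℕ i × Vec.lookup A i ≡ false
      out = firstOut-out K A nf

      b₀<n : b₀ ℕ.< n
      b₀<n = subst (ℕ._< n) (sym (proj₁ (proj₂ out))) (Finₚ.toℕ<n (proj₁ out))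

      at : ∀ t → t ℕ.< n → (+ (b₀ ℕ.+ n) - + suc t) ∼ letter t
      at t t<n = subst (_∼ letter t)
        (sym (trans (ℤₚ.m-n≡m⊖n (b₀ ℕ.+ n) (suc t)) (ℤₚ.⊖-≥ (ℕₚ.≤-trans t<n (ℕₚ.m≤n+m n b₀)))))
        (nat∼ (b₀ ℕ.+ n ∸ suc t))

      -- The letters at t < t′ stand for sites at distance d = t′ - t. Since t′ < K, both d and d +
      -- 1 lie strictly between 0 and n; the omission of `b₀` is what breaks the cycle.
      apart : ∀ {t t′} → t ℕ.< t′ → t′ ℕ.< K → Apart (letter t) (letter t′)
      apart {t} {t′} t<t′ t′<K p a = one , two
        where
        t′<n : t′ ℕ.< n
        t′<n = ℕₚ.m≤n⇒m≤1+n t′<K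
        q q′ : ℤ
        q = + (b₀ ℕ.+ n) - + suc t
        q′ = + (b₀ ℕ.+ n) - + suc t′
        d : ℕ
        d = t′ ∸ t
        l : ∀ b t d → b - (1ℤ + t) ≡ b - (1ℤ + (t + d)) + d
        l = solve-∀
        q≡ : q ≡ q′ + + d
        q≡ = trans (l (+ (b₀ ℕ.+ n)) (+ t) (+ d))
          (cong (λ z → + (b₀ ℕ.+ n) - + suc z + + d) (ℕₚ.m+[n∸m]≡n (ℕₚ.<⇒≤ t<t′)))
        q∼ : q ∼ letter t
        q∼ = at t (ℕₚ.<-trans t<t′ t′<n)
        d≤ : d ℕ.≤ t′
        d≤ = ℕₚ.m∸n≤m t′ t
        one : ¬ p ∼ letter t′
        one b = ℕₚ.m>n⇒m∸n≢0 t<t′ (∼-separated (at t′ t′<n) (subst (_∼ letter t′) q≡ (∼-transfer a q∼ b))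
          (ℕₚ.≤-<-trans d≤ t′<n))
        two : ¬ (p + 1ℤ) ∼ letter t′
        two b = ℕₚ.1+n≢0 (∼-separated {t = suc d} (at t′ t′<n)
          (subst (_∼ letter t′) (trans (cong (_+ 1ℤ) q≡) (l₂ q′ (+ d))) b′) (s≤s (ℕₚ.≤-trans (s≤s d≤) t′<K)))
          where
          l₂ : ∀ q d → q + d + 1ℤ ≡ q + (1ℤ + d)
          l₂ = solve-∀
          b′ : (q + 1ℤ) ∼ letter t′
          b′ = let e , eq = ∼-diff a q∼ in subst (_∼ letter t′) (trans (+-swap p 1ℤ (e * N)) (cong (_+ 1ℤ) (sym eq))) (∼-shift e b)

      letters-apart : AllPairs Apart letters
      letters-apart = AllPairsₚ.map⁺ (AllPairsₚ.applyUpTo⁺₁ id K apart)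

      apart⇒≢ : ∀ {i i′} → Apart i i′ → i ≢ i′
      apart⇒≢ {i} ap refl = proj₁ (ap (+ toℕ i) (toℕ∼ i)) (toℕ∼ i)

      mod-toℕ : ∀ i → (toℕ i) ℕd.mod n ≡ i
      mod-toℕ i = Finₚ.toℕ-injective
        (trans (Finₚ.toℕ-fromℕ< (ℕd.m%n<n (toℕ i) n)) (ℕd.m<n⇒m%n≡m (Finₚ.toℕ<n i)))

      mod-toℕ+ : ∀ i → (toℕ i ℕ.+ n) ℕd.mod n ≡ i
      mod-toℕ+ i = Finₚ.toℕ-injective
        (trans (Finₚ.toℕ-fromℕ< (ℕd.m%n<n (toℕ i ℕ.+ n) n))
        (trans (ℕd.[m+n]%n≡m%n (toℕ i) n) (ℕd.m<n⇒m%n≡m (Finₚ.toℕ<n i))))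

      -- The list descends from b₀ - 1 to 0 and resumes at n - 1, which accounts for the two cases.
      letter-onto : ∀ i → toℕ i ≢ b₀ → ∃ λ t → t ℕ.< K × i ≡ letter t
      letter-onto i ne with ℕₚ.<-cmp (toℕ i) b₀
      ... | tri≈ _ e _ = ⊥-elim (ne e)
      ... | tri< lt _ _ = e , ℕₚ.<-≤-trans e<b₀ (ℕₚ.≤-pred b₀<n) ,
        sym (trans (cong (ℕd._mod n) eq) (mod-toℕ+ i))
        where
        e : ℕ
        e = b₀ ∸ suc (toℕ i)
        b₀≡ : suc (toℕ i) ℕ.+ e ≡ b₀
        b₀≡ = ℕₚ.m+[n∸m]≡n lt
        e<b₀ : e ℕ.< b₀
        e<b₀ = subst (e ℕ.<_) b₀≡ (s≤s (ℕₚ.m≤n+m e (toℕ i)))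
        l : ∀ i e n → suc i ℕ.+ e ℕ.+ n ≡ i ℕ.+ n ℕ.+ suc e
        l = ℕsolve-∀
        eq : b₀ ℕ.+ n ∸ suc e ≡ toℕ i ℕ.+ n
        eq = trans (cong (_∸ suc e) (trans (cong (ℕ._+ n) (sym b₀≡)) (l (toℕ i) e n)))
          (ℕₚ.m+n∸n≡m (toℕ i ℕ.+ n) (suc e))
      ... | tri> _ _ gt = t , t<K , sym (trans (cong (ℕd._mod n) eq) (mod-toℕ i))
        where
        e t : ℕ
        e = toℕ i ∸ suc b₀
        t = K ∸ suc e
        i≡ : suc b₀ ℕ.+ e ≡ toℕ i
        i≡ = ℕₚ.m+[n∸m]≡n gt
        e<K : suc e ℕ.≤ K
        e<K = ℕₚ.≤-trans (s≤s (ℕₚ.m≤n+m e b₀)) (ℕₚ.≤-trans (ℕₚ.≤-reflexive i≡) (ℕₚ.≤-pred (Finₚ.toℕ<n i)))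
        t<K : t ℕ.< K
        t<K = s≤s (ℕₚ.m∸n≤m j e)
        l : ∀ b e t → b ℕ.+ suc (suc e ℕ.+ t) ≡ suc b ℕ.+ e ℕ.+ suc t
        l = ℕsolve-∀
        eq : b₀ ℕ.+ n ∸ suc t ≡ toℕ i
        eq = trans (cong (_∸ suc t) (trans (cong (λ z → b₀ ℕ.+ suc z) (sym (ℕₚ.m+[n∸m]≡n e<K)))
          (trans (l b₀ e t) (cong (ℕ._+ suc t) i≡)))) (ℕₚ.m+n∸n≡m (toℕ i) (suc t))

      cd-decreasing : CyclicallyDecreasing (cdWord K A)
      cd-decreasing = apart⇒decreasing (AllPairsₚ.filter⁺ (λ i → T? (Vec.lookup A i)) letters-apart)

      ∈-cd⁻ : ∀ {i} → i ∈ cdWord K A → Vec.lookup A i ≡ true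
      ∈-cd⁻ {i} m = T⇒true (proj₂ (∈-filter⁻ (λ i → T? (Vec.lookup A i)) {xs = letters} m))
        where
        T⇒true : ∀ {b} → T b → b ≡ true
        T⇒true {true} _ = refl

      ∈-cd⁺ : ∀ {i} → Vec.lookup A i ≡ true → i ∈ cdWord K A
      ∈-cd⁺ {i} e = ∈-filter⁺ (λ i → T? (Vec.lookup A i)) {xs = letters} in′ (subst T (sym e) tt)
        where
        ne : toℕ i ≢ b₀
        ne eq with () ← trans (sym e) (trans
          (cong (Vec.lookup A) (Finₚ.toℕ-injective (trans eq (proj₁ (proj₂ out))))) (proj₂ (proj₂ out)))
        in′ : i ∈ letters
        in′ = let t , t<K , eq = letter-onto i ne in subst (_∈ letters) (sym eq) (∈-map⁺ letter (∈-upTo⁺ t<K))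

      -- `cdWord` and the filtered list of all classes have the same members and no repetitions,
      -- hence are permutations of each other; the order of the second follows the vector, so its
      -- length is found by recursion.
      length-cd : length (cdWord K A) ≡ ∣ A ∣ˢ
      length-cd = trans (↭-length (∼bag⇒↭ (unique∧set⇒bag u₁ u₂ (mk⇔ to from))))
        (length-filter-subset A id (Vec.lookup A) (λ _ → refl))
        where
        u₁ : Unique (cdWord K A)
        u₁ = AllPairs.map apart⇒≢ (AllPairsₚ.filter⁺ (λ i → T? (Vec.lookup A i)) letters-apart)
        u₂ : Unique (filter (λ i → T? (Vec.lookup A i)) (allFin n))
        u₂ = AllPairsₚ.filter⁺ (λ i → T? (Vec.lookup A i)) (allFin⁺ n)
        to : ∀ {i} → i ∈ cdWord K A → i ∈ filter (λ i → T? (Vec.lookup A i)) (allFin n)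
        to {i} m = ∈-filter⁺ (λ i → T? (Vec.lookup A i)) {xs = allFin n} (∈-tabulate⁺ {f = id} i)
          (subst T (sym (∈-cd⁻ m)) tt)
        from : ∀ {i} → i ∈ filter (λ i → T? (Vec.lookup A i)) (allFin n) → i ∈ cdWord K A
        from {i} m = ∈-cd⁺ (T⇒true (proj₂ (∈-filter⁻ (λ i → T? (Vec.lookup A i)) {xs = allFin n} m)))
          where
          T⇒true : ∀ {b} → T b → b ≡ true
          T⇒true {true} _ = refl

  -- Inverses and the Grassmannian condition

  grassAt : Word → Fin n → Bool
  grassAt ws i = (toℕ i ℕ.≡ᵇ 0) ∨ (len K (prod K ws) ℕ.<ᵇ len K (_∘W_ K (prod K ws) (gen K i)))

  abstract
    scanInv-finds : ∀ ws p L → Any (λ i → (f ws i - p) %ℕ n ≡ 0) L → scanInv K (prod K ws) p L ≡ g ws p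
    scanInv-finds ws p (i ∷ L) hit rewrite eval-prod ws i with ((f ws i - p) %ℕ n) ℕ.≟ 0
    scanInv-finds ws p (i ∷ L) (here h) | no nh = ⊥-elim (nh h)
    scanInv-finds ws p (i ∷ L) (there hit) | no nh rewrite ≡ᵇ-false nh = scanInv-finds ws p L hit
    ... | yes h rewrite ≡ᵇ-true h =
      sym (trans (cong (g ws) p≡) (trans (g-periodic ws (f ws i) (- q))
      (trans (cong (_+ - q * N) (g-f ws i)) (l i q N))))
      where
      q : ℤ
      q = (f ws i - p) /ℕ n
      l : ∀ i q m → i + - q * m ≡ i - q * m
      l = solve-∀
      l′ : ∀ x p y → x - p ≡ y → p ≡ x - y
      l′ x p y refl = l″ x p
        where
        l″ : ∀ x p → p ≡ x - (x - p)
        l″ = solve-∀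
      p≡ : p ≡ f ws i + - q * N
      p≡ = trans (l′ (f ws i) p (q * N)
        (trans (a≡a%ℕn+[a/ℕn]*n (f ws i - p) n) (trans (cong (λ z → + z + q * N) h) (ℤₚ.+-identityˡ (q * N)))))
        (sym (l (f ws i) q N))

    window-hit : ∀ ws p → Any (λ i → (f ws i - p) %ℕ n ≡ 0) (positions K)
    window-hit ws p with window-reduce (g ws p)
    ... | u , e , 1≤u , u≤N , eq with ≤⇒+ 1≤u
    ...   | t , refl = Any.map (λ { refl → zero% })
      (∈-map⁺ (λ i → + suc i) (∈-upTo⁺ (ℕₚ.≤-trans (ℤₚ.drop‿+≤+ u≤N) ℕₚ.≤-refl)))
      where
      l : ∀ x e m → x - (x + e * m) ≡ 0ℤ + - e * m
      l = solve-∀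
      zero% : (f ws (+ suc t) - p) %ℕ n ≡ 0
      zero% = proj₁ (divmod-unique (f ws (+ suc t) - p) (- e) 0 (s≤s z≤n)
        (trans (cong (λ z → f ws (+ suc t) - z)
          (trans (sym (f-g ws p)) (trans (cong (f ws) eq) (f-periodic ws (+ suc t) e))))
          (l (f ws (+ suc t)) e N)))

    inverse-prod : ∀ ws → inverse K (prod K ws) ≡ map (g ws) (positions K)
    inverse-prod ws = Listₚ.map-cong
      (λ p → trans (invAt-scan K (prod K ws) p) (scanInv-finds ws p (positions K) (window-hit ws p)))
      (positions K)

    ℓ-++≤ : ∀ us ws → ℓ (us ++ ws) ℕ.≤ length us ℕ.+ ℓ ws
    ℓ-++≤ [] ws = ℕₚ.≤-refl
    ℓ-++≤ (i ∷ us) ws = ℕₚ.≤-trans (ℓ-∷≤ i (us ++ ws)) (s≤s (ℓ-++≤ us ws))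

    -- The quotient of the two elements is `prod K as`, so `as` itself has to be reduced. A shorter
    -- word for the same element would make `as ++ ws` shorter than assumed.
    leftWeak : ∀ as ws → ℓ (as ++ ws) ≡ length as ℕ.+ ℓ ws → LeftWeak K (prod K ws) (prod K (as ++ ws))
    leftWeak as ws e = trans (cong₂ ℕ._+_ (trans (cong (len K) quot≡) (len-prod as)) (len-prod ws))
      (trans (cong (ℕ._+ ℓ ws) ℓas) (sym (trans (len-prod (as ++ ws)) e)))
      where
      quot≡ : _∘W_ K (prod K (as ++ ws)) (inverse K (prod K ws)) ≡ prod K as
      quot≡ = trans (cong₂ (_∘W_ K) (prod-f (as ++ ws)) (inverse-prod ws))
        (trans (∘W-map (f-periodic (as ++ ws)) (g-periodic ws))
                (trans (Listₚ.map-cong (λ p → trans (f-++ as ws (g ws p)) (cong (f as) (f-g ws p)))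
                  (positions K)) (sym (prod-f as))))
      red-as : ∃ λ us → (∀ p → g us p ≡ g as p) × length us ≡ ℓ as
      red-as = reduced-word as
      ℓas : ℓ as ≡ length as
      ℓas = ℕₚ.≤-antisym (ℓ≤length as) (ℕₚ.+-cancelʳ-≤ (ℓ ws) (length as) (ℓ as) (let us , eq , len≡ = red-as in
        ℕₚ.≤-trans (ℕₚ.≤-reflexive (trans (sym e)
          (ℓ-cong {as ++ ws} {us ++ ws} (λ p → trans (g-++ as ws p)
          (trans (cong (g ws) (sym (eq p))) (sym (g-++ us ws p)))))))
          (ℕₚ.≤-trans (ℓ-++≤ us ws) (ℕₚ.≤-reflexive (cong (ℕ._+ ℓ ws) len≡)))))

    <ᵇ-true : ∀ {a b} → a ℕ.< b → (a ℕ.<ᵇ b) ≡ true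
    <ᵇ-true {a} {b} lt with a ℕ.<ᵇ b | ℕₚ.<⇒<ᵇ lt
    ... | true | _ = refl

    <ᵇ-false : ∀ {a b} → ¬ a ℕ.< b → (a ℕ.<ᵇ b) ≡ false
    <ᵇ-false {a} {b} nlt with a ℕ.<ᵇ b | ℕₚ.<ᵇ⇒< a b
    ... | true | h = ⊥-elim (nlt (h tt))
    ... | false | _ = refl

    len-gen : ∀ ws i → len K (_∘W_ K (prod K ws) (gen K i)) ≡ inv (Win (f ws ∘ s i) 1ℤ n)
    len-gen ws i = trans (cong (len K)
      (trans (cong₂ (_∘W_ K) (prod-f ws) (Listₚ.map-cong (sfun≡s i) (positions K)))
      (∘W-map (f-periodic ws) (s-periodic i))))
      (len-map {f ws ∘ s i} (λ m e → trans (cong (f ws) (s-periodic i m e)) (f-periodic ws (s i m) e)))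

    ascent-right : ∀ ws i → f ws (+ toℕ i) < f ws (+ toℕ i + 1ℤ) → len K (prod K ws) ℕ.< len K
      (_∘W_ K (prod K ws) (gen K i))
    ascent-right ws i lt = ℕₚ.≤-reflexive
      (trans (cong suc (len-prod′ ws))
      (sym (trans (len-gen ws i) (inv-∘s (f-periodic ws) (injMod (f-periodic ws) (f-inj ws)) i lt))))

    descent-right : ∀ ws i → f ws (+ toℕ i + 1ℤ) < f ws (+ toℕ i) → ¬ len K (prod K ws) ℕ.< len K
      (_∘W_ K (prod K ws) (gen K i))
    descent-right ws i gt lt = ℕₚ.<-irrefl refl
      (ℕₚ.<-trans (subst₂ ℕ._<_ (len-prod′ ws) (len-gen ws i) lt) (ℕₚ.≤-reflexive (sym eq)))
      where
      G : ℤ → ℤ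
      G = f ws ∘ s i
      perG : Periodic G
      perG m e = trans (cong (f ws) (s-periodic i m e)) (f-periodic ws (s i m) e)
      injG : ∀ {p q} → G p ≡ G q → p ≡ q
      injG {p} {q} e = trans (sym (s-invol i p)) (trans (cong (s i) (f-inj ws e)) (s-invol i q))
      eq : inv (Win (f ws) 1ℤ n) ≡ suc (inv (Win G 1ℤ n))
      eq = trans (cong inv (Win-cong (λ p → cong (f ws) (sym (s-invol i p))) 1ℤ n))
             (inv-∘s perG (injMod perG injG) i
               (subst₂ _<_ (cong (f ws) (sym (s-up (toℕ∼ i)))) (cong (f ws) (sym (s-dn (toℕ∼ i)))) gt))

    sorted⇒grass : ∀ ws → Sorted ws → isGrass K (prod K ws) ≡ true
    sorted⇒grass ws so = allᵇ-intro (grassAt ws) (allFin n) (All.tabulate (λ {i} _ → each i))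
      where
      each : ∀ i → grassAt ws i ≡ true
      each i = go (toℕ i) refl
        where
        go : ∀ m → toℕ i ≡ m → grassAt ws i ≡ true
        go zero eq = cong (_∨ (len K (prod K ws) ℕ.<ᵇ len K (_∘W_ K (prod K ws) (gen K i)))) (cong (ℕ._≡ᵇ 0) eq)
        go (suc t) eq = trans (cong ((toℕ i ℕ.≡ᵇ 0) ∨_)
          (<ᵇ-true (ascent-right ws i (subst (λ z → f ws (+ z) < f ws (+ z + 1ℤ)) (sym eq)
             (so (+ suc t) (+ suc t + 1ℤ) (+≤+ (s≤s z≤n)) (p<p+1 (+ suc t))
               (+≤+ (ℕₚ.≤-trans (ℕₚ.≤-reflexive (trans (ℕₚ.+-comm (suc t) 1) (cong suc (sym eq))))
               (Finₚ.toℕ<n i)))))))) (∨-zeroʳ _)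

    grass⇒sorted : ∀ ws → isGrass K (prod K ws) ≡ true → Sorted ws
    grass⇒sorted ws gr (+ zero) v (+≤+ ()) _ _
    grass⇒sorted ws gr -[1+ m ] v () _ _
    grass⇒sorted ws gr +[1+ m ] v _ u<v v≤N with ≤⇒+ (<⇒≤1 u<v)
    ... | t , refl = chain t v≤N
      where
      adj : ∀ t → suc t ℕ.< n → f ws (+ suc t) < f ws (+ suc t + 1ℤ)
      adj t t<n with ℤₚ.<-cmp (f ws (+ suc t)) (f ws (+ suc t + 1ℤ))
      ... | tri< lt _ _ = lt
      ... | tri≈ _ e _ = ⊥-elim (p≢p+1 (+ suc t) (f-inj ws e))
      ... | tri> _ _ gt = ⊥-elim (false≢true (trans (sym (cong₂ _∨_ {toℕ i ℕ.≡ᵇ 0} {false} (cong (ℕ._≡ᵇ 0) i≡)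
          (<ᵇ-false (descent-right ws i (subst (λ z → f ws (+ z + 1ℤ) < f ws (+ z)) (sym i≡) gt)))))
            (All.lookup (allᵇ-true (grassAt ws) (allFin n) gr) (∈-tabulate⁺ {f = id} i))))
        where
        i : Fin n
        i = fromℕ< t<n
        false≢true : ¬ false ≡ true
        false≢true ()
        i≡ : toℕ i ≡ suc t
        i≡ = Finₚ.toℕ-fromℕ< t<n
      chain : ∀ t → + suc m + 1ℤ + + t ≤ N → f ws (+ suc m) < f ws (+ suc m + 1ℤ + + t)
      chain zero le = subst (λ z → f ws (+ suc m) < f ws z) (sym (ℤₚ.+-identityʳ _))
        (adj m (ℕₚ.≤-trans (ℕₚ.≤-reflexive (l m)) (ℤₚ.drop‿+≤+ le)))
        where
        l : ∀ m → suc (suc m) ≡ suc m ℕ.+ 1 ℕ.+ 0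
        l = ℕsolve-∀
      chain (suc t) le = ℤₚ.<-trans (chain t (ℤₚ.≤-trans (+≤+ (ℕₚ.+-monoʳ-≤ (suc m ℕ.+ 1) (ℕₚ.n≤1+n t))) le))
        (subst₂ (λ a b → f ws a < f ws b) (cong +_ (l₁ m t)) (cong +_ (l₂ m t))
          (adj (m ℕ.+ suc t) (ℕₚ.≤-trans (ℕₚ.≤-reflexive (l₃ m t)) (ℤₚ.drop‿+≤+ le))))
        where
        l₁ : ∀ m t → suc (m ℕ.+ suc t) ≡ suc m ℕ.+ 1 ℕ.+ t
        l₁ = ℕsolve-∀
        l₂ : ∀ m t → suc (m ℕ.+ suc t) ℕ.+ 1 ≡ suc m ℕ.+ 1 ℕ.+ suc t
        l₂ = ℕsolve-∀
        l₃ : ∀ m t → suc (suc (m ℕ.+ suc t)) ≡ suc m ℕ.+ 1 ℕ.+ suc t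
        l₃ = ℕsolve-∀

  -- Coefficients of products with h_r

  _≟W_ : (u v : Window) → Dec (u ≡ v)
  _≟W_ = Listₚ.≡-dec ℤₚ._≟_

  δ : Window → Window → ℤ
  δ w x = if does (w ≟W x) then 1ℤ else 0ℤ

  sumOver : ∀ {X : Set} → (X → ℤ) → List X → ℤ
  sumOver φ [] = 0ℤ
  sumOver φ (x ∷ L) = φ x + sumOver φ L

  lin : (Window → ℤ) → FSum K → ℤ
  lin φ [] = 0ℤ
  lin φ ((e , w) ∷ F) = e * φ w + lin φ F

  remove : Window → FSum K → FSum K
  remove v [] = []
  remove v ((e , w) ∷ F) = if does (w ≟W v) then remove v F else (e , w) ∷ remove v F

  abstract
    δ-indicates : ∀ w x → Indicates (δ w x) (w ≡ x)
    δ-indicates w x with w ≟W x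
    ... | yes e = (λ _ → refl) , (λ ne → ⊥-elim (ne e))
    ... | no ne = (λ e → ⊥-elim (ne e)) , (λ _ → refl)

    coeff-∷ : ∀ x e w F → coeff K x ((e , w) ∷ F) ≡ e * δ w x + coeff K x F
    coeff-∷ x e w F = cong (_+ coeff K x F) (go (w ≟W x))
      where
      go : (d : Dec (w ≡ x)) → (if does d then e else 0ℤ) ≡ e * (if does d then 1ℤ else 0ℤ)
      go (yes _) = sym (ℤₚ.*-identityʳ e)
      go (no _) = sym (ℤₚ.*-zeroʳ e)

    coeff-++ : ∀ x F G → coeff K x (F ++ G) ≡ coeff K x F + coeff K x G
    coeff-++ x [] G = sym (ℤₚ.+-identityˡ _)
    coeff-++ x ((e , w) ∷ F) G = trans (cong (_+_ (if does (w ≟W x) then e else 0ℤ)) (coeff-++ x F G))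
      (sym (ℤₚ.+-assoc (if does (w ≟W x) then e else 0ℤ) (coeff K x F) (coeff K x G)))

    coeff-concatMap : ∀ {X : Set} (t : X → FSum K) x L → coeff K x (concatMap t L) ≡ sumOver
      (λ a → coeff K x (t a)) L
    coeff-concatMap t x [] = refl
    coeff-concatMap t x (a ∷ L) = trans (coeff-++ x (t a) (concatMap t L))
      (cong (_+_ (coeff K x (t a))) (coeff-concatMap t x L))

    coeff-scale : ∀ e (m : ℤ × Window → ℤ × Window) → (∀ e′ y → m (e′ , y) ≡ (e * e′ , y)) → ∀ x P → coeff K x
      (map m P) ≡ e * coeff K x P
    coeff-scale e m eq x [] = sym (ℤₚ.*-zeroʳ e)
    coeff-scale e m eq x ((e′ , y) ∷ P) = trans (cong (λ z → coeff K x (z ∷ map m P)) (eq e′ y))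
      (trans (coeff-∷ x (e * e′) y (map m P))
      (trans (cong (_+_ (e * e′ * δ y x)) (coeff-scale e m eq x P))
        (trans (l e e′ (δ y x) (coeff K x P)) (cong (e *_) (sym (coeff-∷ x e′ y P))))))
      where
      l : ∀ e e′ d q → e * e′ * d + e * q ≡ e * (e′ * d + q)
      l = solve-∀

    sumOver-lin : ∀ (φ : Window → ℤ) (t : ℤ × Window → ℤ) → (∀ e w → t (e , w) ≡ e * φ w) → ∀ F →
      sumOver t F ≡ lin φ F
    sumOver-lin φ t eq [] = refl
    sumOver-lin φ t eq ((e , w) ∷ F) = cong₂ _+_ (eq e w) (sumOver-lin φ t eq F)

    coeff-hmul : ∀ r x F → coeff K x (hmul K (suc r) F) ≡ lin (λ w → coeff K x (pieri K (suc r) w)) F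
    coeff-hmul r x F = trans (coeff-concatMap _ x F)
      (sumOver-lin (λ w → coeff K x (pieri K (suc r) w)) _
      (λ e w → coeff-scale e _ (λ e′ y → refl) x (pieri K (suc r) w)) F)

    lin-remove : ∀ φ v F → lin φ F ≡ coeff K v F * φ v + lin φ (remove v F)
    lin-remove φ v [] = refl
    lin-remove φ v ((e , w) ∷ F) with w ≟W v
    ... | yes refl = trans (cong (_+_ (e * φ w)) (lin-remove φ v F))
      (l e (φ w) (coeff K v F) (lin φ (remove v F)))
      where
      l : ∀ e a q z → e * a + (q * a + z) ≡ (e + q) * a + z
      l = solve-∀
    ... | no _ = trans (cong (_+_ (e * φ w)) (lin-remove φ v F))
      (l (e * φ w) (coeff K v F) (φ v) (lin φ (remove v F)))
      where
      l : ∀ a q b z → a + (q * b + z) ≡ (0ℤ + q) * b + (a + z)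
      l = solve-∀

    coeff-remove-self : ∀ v F → coeff K v (remove v F) ≡ 0ℤ
    coeff-remove-self v [] = refl
    coeff-remove-self v ((e , w) ∷ F) with w ≟W v in eq
    ... | yes _ = coeff-remove-self v F
    ... | no _ rewrite eq = trans (ℤₚ.+-identityˡ _) (coeff-remove-self v F)

    coeff-remove-other : ∀ v x F → v ≢ x → coeff K x (remove v F) ≡ coeff K x F
    coeff-remove-other v x [] ne = refl
    coeff-remove-other v x ((e , w) ∷ F) ne with w ≟W v
    ... | no _ = cong (_+_ (if does (w ≟W x) then e else 0ℤ)) (coeff-remove-other v x F ne)
    ... | yes refl with w ≟W x
    ...   | yes e′ = ⊥-elim (ne e′)
    ...   | no _ = trans (coeff-remove-other v x F ne) (sym (ℤₚ.+-identityˡ _))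

    remove-length : ∀ v F → length (remove v F) ℕ.≤ length F
    remove-length v [] = z≤n
    remove-length v ((e , w) ∷ F) with w ≟W v
    ... | yes _ = ℕₚ.m≤n⇒m≤1+n (remove-length v F)
    ... | no _ = s≤s (remove-length v F)

    remove-head : ∀ e w F → length (remove w ((e , w) ∷ F)) ℕ.≤ length F
    remove-head e w F with w ≟W w
    ... | yes _ = remove-length w F
    ... | no ne = ⊥-elim (ne refl)

    -- Only the coefficient function of F matters, so cancelling terms may carry arbitrary windows.
    lin-cong : ∀ φ ψ F → (∀ w → coeff K w F * φ w ≡ coeff K w F * ψ w) → lin φ F ≡ lin ψ F
    lin-cong φ ψ F h = go (length F) F ℕₚ.≤-refl h
      where
      go : ∀ m F → length F ℕ.≤ m → (∀ w → coeff K w F * φ w ≡ coeff K w F * ψ w) → lin φ F ≡ lin ψ F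
      go m [] _ h = refl
      go (suc m) F@((e , v) ∷ F′) (s≤s le) h = trans (lin-remove φ v F)
        (trans (cong₂ _+_ (h v) (go m (remove v F) (ℕₚ.≤-trans (remove-head e v F′) le) h′))
        (sym (lin-remove ψ v F)))
        where
        h′ : ∀ w → coeff K w (remove v F) * φ w ≡ coeff K w (remove v F) * ψ w
        h′ w = by (v ≟W w)
          where
          by : Dec (v ≡ w) → coeff K w (remove v F) * φ w ≡ coeff K w (remove v F) * ψ w
          by (yes refl) = trans (cong (_* φ v) (coeff-remove-self v F))
            (cong (_* ψ v) (sym (coeff-remove-self v F)))
          by (no ne) = trans (cong (_* φ w) (coeff-remove-other v w F ne))
            (trans (h w) (cong (_* ψ w) (sym (coeff-remove-other v w F ne))))

    lin-zero : ∀ F → lin (λ _ → 0ℤ) F ≡ 0ℤ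
    lin-zero [] = refl
    lin-zero ((e , w) ∷ F) = trans (cong₂ _+_ (ℤₚ.*-zeroʳ e) (lin-zero F)) refl

    lin-+ : ∀ φ ψ F → lin (λ w → φ w + ψ w) F ≡ lin φ F + lin ψ F
    lin-+ φ ψ [] = refl
    lin-+ φ ψ ((e , w) ∷ F) = trans (cong (_+_ (e * (φ w + ψ w))) (lin-+ φ ψ F))
      (l e (φ w) (ψ w) (lin φ F) (lin ψ F))
      where
      l : ∀ e a b x y → e * (a + b) + (x + y) ≡ e * a + x + (e * b + y)
      l = solve-∀

    lin-sumOver : ∀ {X : Set} (φ : X → Window → ℤ) L F → lin (λ w → sumOver (λ a → φ a w) L) F ≡ sumOver
      (λ a → lin (φ a) F) L
    lin-sumOver φ [] F = lin-zero F
    lin-sumOver φ (a ∷ L) F = trans (lin-+ (φ a) (λ w → sumOver (λ a → φ a w) L) F)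
      (cong (_+_ (lin (φ a) F)) (lin-sumOver φ L F))

    sumOver-cong : ∀ {X : Set} {φ ψ : X → ℤ} → (∀ a → φ a ≡ ψ a) → ∀ L → sumOver φ L ≡ sumOver ψ L
    sumOver-cong e [] = refl
    sumOver-cong e (a ∷ L) = cong₂ _+_ (e a) (sumOver-cong e L)

    sumOver-zero : ∀ {X : Set} {φ : X → ℤ} → (∀ a → φ a ≡ 0ℤ) → ∀ L → sumOver φ L ≡ 0ℤ
    sumOver-zero e [] = refl
    sumOver-zero e (a ∷ L) = cong₂ _+_ (e a) (sumOver-zero e L)

    U-cong : ∀ as {h h′ : Word → ℤ} → (∀ y → h y ≡ h′ y) → ∀ x → U as h x ≡ U as h′ x
    U-cong [] e x = e x
    U-cong (i ∷ as) e x = cong₂ _-_ (U-cong as e (psi i x)) (U-cong as e x)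

    U-linear : ∀ as e (h h′ : Word → ℤ) x → U as (λ y → e * h y + h′ y) x ≡ e * U as h x + U as h′ x
    U-linear [] e h h′ x = refl
    U-linear (i ∷ as) e h h′ x = trans (cong₂ _-_ (U-linear as e h h′ (psi i x)) (U-linear as e h h′ x))
      (l e (U as h (psi i x)) (U as h′ (psi i x)) (U as h x) (U as h′ x))
      where
      l : ∀ e a b x y → e * a + b - (e * x + y) ≡ e * (a - x) + (b - y)
      l = solve-∀

    U-zero : ∀ as x → U as (λ _ → 0ℤ) x ≡ 0ℤ
    U-zero [] x = refl
    U-zero (i ∷ as) x = cong₂ _-_ (U-zero as (psi i x)) (U-zero as x)

    lin-U : ∀ as x F → lin (λ w → U as (λ y → δ w (prod K y)) x) F ≡ U as (λ y → coeff K (prod K y) F) x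
    lin-U as x [] = sym (U-zero as x)
    lin-U as x ((e , w) ∷ F) = trans (cong (_+_ (e * U as (λ y → δ w (prod K y)) x)) (lin-U as x F))
      (trans (sym (U-linear as e (λ y → δ w (prod K y)) (λ y → coeff K (prod K y) F) x))
        (U-cong as (λ y → sym (coeff-∷ (prod K y) e w F)) x))

  -- The Demazure action and the signs of the Pieri rule

  phiW : Fin n → Word → Word
  phiW i y with asc? i y
  ... | inj₁ _ = i ∷ y
  ... | inj₂ _ = y

  demW : Word → Word → Word
  demW [] w = w
  demW (i ∷ as) w = phiW i (demW as w)

  parity : ℕ → ℤ
  parity m = if (m ℕ.% 2) ℕ.≡ᵇ 0 then 1ℤ else -1ℤ

  abstract
    parity-suc : ∀ m → parity (suc m) ≡ - parity m
    parity-suc zero = refl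
    parity-suc (suc zero) = refl
    parity-suc (suc (suc m)) = trans (two (suc m)) (trans (parity-suc m) (cong -_ (sym (two m))))
      where
      two : ∀ m → parity (suc (suc m)) ≡ parity m
      two m = cong (λ z → if z ℕ.≡ᵇ 0 then 1ℤ else -1ℤ)
        (trans (cong (ℕ._% 2) (ℕₚ.+-comm 2 m)) (ℕd.[m+n]%n≡m%n m 2))

    parity-suc² : ∀ m → parity (suc (suc m)) ≡ parity m
    parity-suc² m = trans (parity-suc (suc m)) (trans (cong -_ (parity-suc m)) (ℤₚ.neg-involutive (parity m)))

    phi-prod : ∀ i y → phi K i (prod K y) ≡ prod K (phiW i y)
    phi-prod i y with asc? i y
    ... | inj₁ a = cong (λ b → if b then prod K (i ∷ y) else prod K y)
      (<ᵇ-true (ℕₚ.≤-reflexive (trans (cong suc (len-prod y))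
      (trans (sym (ℓ-asc i y a)) (sym (len-prod (i ∷ y)))))))
    ... | inj₂ d = cong (λ b → if b then prod K (i ∷ y) else prod K y)
      (<ᵇ-false (λ lt → ℕₚ.<-irrefl refl
      (ℕₚ.<-trans (subst₂ ℕ._<_ (len-prod y) (len-prod (i ∷ y)) lt) (ℕₚ.≤-reflexive (sym (ℓ-desc i y d))))))

    demazure-prod : ∀ as w → demazure K as (prod K w) ≡ prod K (demW as w)
    demazure-prod [] w = refl
    demazure-prod (i ∷ as) w = trans (cong (phi K i) (demazure-prod as w)) (phi-prod i (demW as w))

    asc-prod : ∀ i {x y} → prod K x ≡ prod K y → Asc i y → Asc i x
    asc-prod i {x} {y} e = asc-f i x y (prod⇒f x y e)

    -- If i is an ascent of x, the right side cancels and x cannot be `i ∷ y`, which has a descent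
    -- there. If it is a descent, x differs from y and only the first term survives.
    δ-psi : ∀ i y x → Asc i y → δ (prod K (i ∷ y)) (prod K x) ≡ δ (prod K y) (prod K (psi i x)) - δ (prod K y)
      (prod K x)
    δ-psi i y x a with asc? i x
    ... | inj₁ ax = trans (proj₂ (δ-indicates (prod K (i ∷ y)) (prod K x))
      (λ e → ¬asc∧desc {i} {i ∷ y} (asc-prod i {i ∷ y} {x} e ax) (asc⇒desc y a)))
      (sym (ℤₚ.+-inverseʳ (δ (prod K y) (prod K x))))
    ... | inj₂ dx = trans swap (trans (sym (ℤₚ.+-identityʳ _))
      (cong (_-_ (δ (prod K y) (prod K (i ∷ x))))
      (sym (proj₂ (δ-indicates (prod K y) (prod K x))
      (λ e → ¬asc∧desc {i} {x} (asc-prod i {x} {y} (sym e) a) dx)))))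
      where
      to : prod K (i ∷ y) ≡ prod K x → prod K y ≡ prod K (i ∷ x)
      to e = f⇒prod y (i ∷ x) (λ p → trans (sym (s-invol i (f y p))) (cong (s i) (prod⇒f (i ∷ y) x e p)))
      from : prod K y ≡ prod K (i ∷ x) → prod K (i ∷ y) ≡ prod K x
      from e = f⇒prod (i ∷ y) x (λ p → trans (cong (s i) (prod⇒f y (i ∷ x) e p)) (s-invol i (f x p)))
      swap : δ (prod K (i ∷ y)) (prod K x) ≡ δ (prod K y) (prod K (i ∷ x))
      swap = classical (prod K y ≡ prod K (i ∷ x))
        (λ e → trans (proj₁ (δ-indicates (prod K (i ∷ y)) (prod K x)) (from e))
        (sym (proj₁ (δ-indicates (prod K y) (prod K (i ∷ x))) e)))
               (λ ne → trans (proj₂ (δ-indicates (prod K (i ∷ y)) (prod K x)) (ne ∘ to))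
                 (sym (proj₂ (δ-indicates (prod K y) (prod K (i ∷ x))) ne)))

    -- The value of `psi` always has the ascent i, so it is never y. Thus a trivial Demazure step
    -- turns the indicator of y into its negative.
    δ-psi-desc : ∀ i y x → Desc i y → δ (prod K y) (prod K (psi i x)) ≡ 0ℤ
    δ-psi-desc i y x d with asc? i x
    ... | inj₁ ax = proj₂ (δ-indicates (prod K y) (prod K x))
      (λ e → ¬asc∧desc {i} {y} (asc-prod i {y} {x} e ax) d)
    ... | inj₂ dx = proj₂ (δ-indicates (prod K y) (prod K (i ∷ x)))
      (λ e → ¬asc∧desc {i} {y} (asc-prod i {y} {i ∷ x} e (desc⇒asc x dx)) d)

    -- The sign of the Pieri rule emerges letter by letter: a letter that lengthens the element adds
    -- two to the exponent, one that acts trivially adds one.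
    U-δ : ∀ as w x → U as (λ y → δ (prod K w) (prod K y)) x ≡ parity (length as ℕ.+ ℓ w ℕ.+ ℓ (demW as w)) * δ
      (prod K (demW as w)) (prod K x)
    U-δ [] w x = sym (trans (cong (_* δ (prod K w) (prod K x)) (double (ℓ w)))
      (ℤₚ.*-identityˡ (δ (prod K w) (prod K x))))
      where
      double : ∀ m → parity (m ℕ.+ m) ≡ 1ℤ
      double zero = refl
      double (suc m) = trans (cong parity (cong suc (ℕₚ.+-suc m m))) (trans (parity-suc² (m ℕ.+ m)) (double m))
    U-δ (i ∷ as) w x = trans (cong₂ _-_ (U-δ as w (psi i x)) (U-δ as w x)) step
      where
      y : Word
      y = demW as w
      a : ℕ
      a = length as ℕ.+ ℓ w
      step : parity (a ℕ.+ ℓ y) * δ (prod K y) (prod K (psi i x)) - parity (a ℕ.+ ℓ y) * δ (prod K y)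
        (prod K x) ≡
             parity (suc a ℕ.+ ℓ (phiW i y)) * δ (prod K (phiW i y)) (prod K x)
      step with asc? i y
      ... | inj₁ asc = trans (l (parity (a ℕ.+ ℓ y)) (δ (prod K y) (prod K (psi i x)))
        (δ (prod K y) (prod K x)))
             (cong₂ _*_ (sym (trans (cong parity
               (trans (cong (suc a ℕ.+_) (ℓ-asc i y asc)) (ℕₚ.+-suc (suc a) (ℓ y)))) (parity-suc² (a ℕ.+ ℓ y))))
               (sym (δ-psi i y x asc)))
        where
        l : ∀ s u v → s * u - s * v ≡ s * (u - v)
        l = solve-∀
      ... | inj₂ desc = trans (cong (λ z → parity (a ℕ.+ ℓ y) * z - parity (a ℕ.+ ℓ y) * δ (prod K y)
        (prod K x)) (δ-psi-desc i y x desc))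
             (trans (l (parity (a ℕ.+ ℓ y)) (δ (prod K y) (prod K x)))
               (cong (_* δ (prod K y) (prod K x)) (sym (parity-suc (a ℕ.+ ℓ y)))))
        where
        l : ∀ s v → s * 0ℤ - s * v ≡ - s * v
        l = solve-∀

    if-scale : ∀ x (b : Bool) e y → coeff K x (if b then (e , y) ∷ [] else []) ≡ (if b then e * δ y x else 0ℤ)
    if-scale x true e y = trans (coeff-∷ x e y []) (ℤₚ.+-identityʳ _)
    if-scale x false e y = refl

  admissible : ℕ → Subset n → Bool
  admissible r A = (∣ A ∣ˢ ℕ.≡ᵇ r) ∧ not (isFull K A)

  term : ℕ → Window → Window → Subset n → ℤ
  term r w x A = if (∣ A ∣ˢ ℕ.≡ᵇ r) ∧ not (isFull K A) ∧ isGrass K (demazure K (cdWord K A) w)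
    then sign K r (len K w) (len K (demazure K (cdWord K A) w)) * δ (demazure K (cdWord K A) w) x else 0ℤ

  abstract
    admissible-true : ∀ r A → admissible r A ≡ true → ∣ A ∣ˢ ≡ r × isFull K A ≡ false
    admissible-true r A e with ∣ A ∣ˢ ℕ.≡ᵇ r in eq | isFull K A
    ... | true | false = ℕₚ.≡ᵇ⇒≡ ∣ A ∣ˢ r (subst T (sym eq) tt) , refl

    admissible-intro : ∀ r A → ∣ A ∣ˢ ≡ r → isFull K A ≡ false → admissible r A ≡ true
    admissible-intro r A e f = cong₂ (λ a b → a ∧ not b) (≡ᵇ-true e) f

    pieri-coeff : ∀ r w x → coeff K x (pieri K r w) ≡ sumOver (term r w x) (allSubsets K n)
    pieri-coeff r w x = trans (coeff-concatMap _ x (allSubsets K n)) (sumOver-cong (λ A → if-scale x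
       ((∣ A ∣ˢ ℕ.≡ᵇ r) ∧ not (isFull K A) ∧ isGrass K (demazure K (cdWord K A) w))
       (sign K r (len K w) (len K (demazure K (cdWord K A) w))) (demazure K (cdWord K A) w)) (allSubsets K n))

    if-split : ∀ b₁ b₂ b₃ {u v : ℤ} → (b₁ ∧ b₂ ≡ true → (if b₃ then u else 0ℤ) ≡ v) →
      (if b₁ ∧ b₂ ∧ b₃ then u else 0ℤ) ≡ (if b₁ ∧ b₂ then v else 0ℤ)
    if-split true true b₃ h = h refl
    if-split true false b₃ h = refl
    if-split false b₂ b₃ h = refl

    term-prod : ∀ r ws x A → term r (prod K ws) x A ≡
      (if (∣ A ∣ˢ ℕ.≡ᵇ r) ∧ not (isFull K A) ∧ isGrass K (prod K (demW (cdWord K A) ws))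
       then sign K r (len K (prod K ws)) (len K (prod K (demW (cdWord K A) ws))) * δ
         (prod K (demW (cdWord K A) ws)) x else 0ℤ)
    term-prod r ws x A = cong (λ y → if (∣ A ∣ˢ ℕ.≡ᵇ r) ∧ not (isFull K A) ∧ isGrass K y then sign K r
      (len K (prod K ws)) (len K y) * δ y x else 0ℤ)
      (demazure-prod (cdWord K A) ws)

    -- At a Grassmannian window the test `isGrass` does not affect the value: a product that fails
    -- it is a different window, where δ vanishes.
    term-good : ∀ r ws xs A → isGrass K (prod K xs) ≡ true →
      term r (prod K ws) (prod K xs) A ≡
        (if admissible r A then U (cdWord K A) (λ y → δ (prod K ws) (prod K y)) xs else 0ℤ)
    term-good r ws xs A gr = trans (term-prod r ws (prod K xs) A)
      (if-split (∣ A ∣ˢ ℕ.≡ᵇ r) (not (isFull K A)) (isGrass K (prod K y)) main)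
      where
      y : Word
      y = demW (cdWord K A) ws
      main : admissible r A ≡ true →
        (if isGrass K (prod K y) then sign K r (len K (prod K ws)) (len K (prod K y)) * δ (prod K y)
          (prod K xs) else 0ℤ) ≡
        U (cdWord K A) (λ z → δ (prod K ws) (prod K z)) xs
      main adm = trans (by (isGrass K (prod K y)) refl) (sym (U-δ (cdWord K A) ws xs))
        where
        len≡ : length (cdWord K A) ≡ r
        len≡ = trans (Letters.length-cd A (not-full A (proj₂ (admissible-true r A adm))))
          (proj₁ (admissible-true r A adm))
        by : ∀ b → isGrass K (prod K y) ≡ b →
          (if b then sign K r (len K (prod K ws)) (len K (prod K y)) * δ (prod K y) (prod K xs) else 0ℤ) ≡
          parity (length (cdWord K A) ℕ.+ ℓ ws ℕ.+ ℓ y) * δ (prod K y) (prod K xs)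
        by true _ = cong (_* δ (prod K y) (prod K xs))
          (cong parity (cong₂ ℕ._+_ (cong₂ ℕ._+_ (sym len≡) (len-prod ws)) (len-prod y)))
        by false e = sym (trans (cong (parity (length (cdWord K A) ℕ.+ ℓ ws ℕ.+ ℓ y) *_)
            (proj₂ (δ-indicates (prod K y) (prod K xs))
              (λ eq → false≢true (trans (sym e) (trans (cong (isGrass K) eq) gr)))))
            (ℤₚ.*-zeroʳ (parity (length (cdWord K A) ℕ.+ ℓ ws ℕ.+ ℓ y))))
          where
          false≢true : ¬ false ≡ true
          false≢true ()

    term-bad : ∀ r ws x A → (∀ zs → prod K zs ≡ x → ¬ isGrass K x ≡ true) → term r (prod K ws) x A ≡ 0ℤ
    term-bad r ws x A bad = trans (term-prod r ws x A)
      (trans (if-split (∣ A ∣ˢ ℕ.≡ᵇ r) (not (isFull K A)) (isGrass K (prod K y)) {v = 0ℤ}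
      (λ _ → by (isGrass K (prod K y)) refl)) (const (admissible r A)))
      where
      y : Word
      y = demW (cdWord K A) ws
      e : ℤ
      e = sign K r (len K (prod K ws)) (len K (prod K y))
      by : ∀ b → isGrass K (prod K y) ≡ b → (if b then e * δ (prod K y) x else 0ℤ) ≡ 0ℤ
      by false _ = refl
      by true gr = trans (cong (e *_)
        (proj₂ (δ-indicates (prod K y) x) (λ eq → bad y eq (trans (cong (isGrass K) (sym eq)) gr))))
        (ℤₚ.*-zeroʳ e)
      const : ∀ b → (if b then 0ℤ else 0ℤ) ≡ 0ℤ
      const true = refl
      const false = refl

  -- The list `F` may contain windows outside W whose coefficients cancel. `supp` together with
  -- `lin-cong` reduces each evaluation to windows of words, on which the Demazure action is known.
  module Supported (F : FSum K) (supp : ∀ w → ¬ (∃ λ ws → prod K ws ≡ w) → coeff K w F ≡ 0ℤ) where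

    F̂ : Word → ℤ
    F̂ y = coeff K (prod K y) F

    contribution : ℕ → Word → Subset n → ℤ
    contribution r xs A = if admissible r A then U (cdWord K A) F̂ xs else 0ℤ

    abstract
      on-products : ∀ φ ψ → (∀ ws → φ (prod K ws) ≡ ψ (prod K ws)) → lin φ F ≡ lin ψ F
      on-products φ ψ e = lin-cong φ ψ F (λ w → classical (∃ λ ws → prod K ws ≡ w)
        (λ { (ws , refl) → cong (coeff K w F *_) (e ws) })
        (λ nw → trans (cong (_* φ w) (supp w nw)) (sym (cong (_* ψ w) (supp w nw)))))

      hmul-good : ∀ r xs → isGrass K (prod K xs) ≡ true →
        coeff K (prod K xs) (hmul K (suc r) F) ≡ sumOver (contribution (suc r) xs) (allSubsets K n)
      hmul-good r xs gr = trans (coeff-hmul r (prod K xs) F)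
        (trans (on-products (λ w → coeff K (prod K xs) (pieri K (suc r) w))
          (λ w → sumOver (λ A → t A w) (allSubsets K n))
                 (λ ws → trans (pieri-coeff (suc r) (prod K ws) (prod K xs))
                   (sumOver-cong (λ A → term-good (suc r) ws xs A gr) (allSubsets K n))))
          (trans (lin-sumOver t (allSubsets K n) F) (sumOver-cong each (allSubsets K n))))
        where
        t : Subset n → Window → ℤ
        t A w = if admissible (suc r) A then U (cdWord K A) (λ y → δ w (prod K y)) xs else 0ℤ
        each : ∀ A → lin (t A) F ≡ contribution (suc r) xs A
        each A with admissible (suc r) A
        ... | true = lin-U (cdWord K A) xs F
        ... | false = lin-zero F

      hmul-bad : ∀ r x → (∀ zs → prod K zs ≡ x → ¬ isGrass K x ≡ true) → coeff K x (hmul K (suc r) F) ≡ 0ℤ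
      hmul-bad r x bad = trans (coeff-hmul r x F)
        (trans (on-products (λ w → coeff K x (pieri K (suc r) w)) (λ _ → 0ℤ)
                 (λ ws → trans (pieri-coeff (suc r) (prod K ws) x)
                   (sumOver-zero (λ A → term-bad (suc r) ws x A bad) (allSubsets K n))))
          (lin-zero F))

  -- The coefficient at a Grassmannian element

  abstract
    c-f : ∀ us ws → (∀ p → f us p ≡ f ws p) → ∀ p → c us p ≡ c ws p
    c-f us ws e = c-cong us ws (f⇒g us ws e)

    bruhat⇒≼ : ∀ xs ys → Bruhat K (prod K xs) (prod K ys) → c xs ≼ c ys
    bruhat⇒≼ xs ys (ws , ws≡ , lw , us , sub , us≡ , _) p = subst₂ ℕ._≤_ (c-f us xs (prod⇒f us xs us≡) p)
      (c-f ws ys (prod⇒f ws ys ws≡) p) (subword⇒≼ red sub p)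
      where
      red : Red ws
      red = trans lw (trans (cong (len K) (sym ws≡)) (len-prod ws))

    ≼⇒bruhat : ∀ xs ys → Red ys → Sorted xs → c xs ≼ c ys → Bruhat K (prod K xs) (prod K ys)
    ≼⇒bruhat xs ys red so le =
      let us , sub , e , r = ≼⇒subword ys xs red so le
          eq = f⇒prod us xs e
      in ys , refl , trans red (sym (len-prod ys)) , us , sub , eq , trans r (trans (sym (len-prod us)) (cong (len K) eq))

    ∣∣-mono : ∀ {m} (A B : Subset m) → (∀ i → Vec.lookup A i ≡ true → Vec.lookup B i ≡ true) → ∣ A ∣ˢ ℕ.≤ ∣ B ∣ˢ
    ∣∣-mono Vec.[] Vec.[] h = z≤n
    ∣∣-mono (a Vec.∷ A) (b Vec.∷ B) h with ∣∣-mono A B (h ∘ Fin.suc)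
    ∣∣-mono (false Vec.∷ A) (false Vec.∷ B) h | ih = ih
    ∣∣-mono (false Vec.∷ A) (true Vec.∷ B) h | ih = ℕₚ.m≤n⇒m≤1+n ih
    ∣∣-mono (true Vec.∷ A) (true Vec.∷ B) h | ih = s≤s ih
    ∣∣-mono (true Vec.∷ A) (false Vec.∷ B) h | ih with () ← h Fin.zero refl

    ∣∣-nonempty : ∀ {m} (A : Subset m) → ∣ A ∣ˢ ≢ 0 → ∃ λ i → Vec.lookup A i ≡ true
    ∣∣-nonempty Vec.[] ne = ⊥-elim (ne refl)
    ∣∣-nonempty (true Vec.∷ A) ne = Fin.zero , refl
    ∣∣-nonempty (false Vec.∷ A) ne = let i , e = ∣∣-nonempty A ne in Fin.suc i , e

    ∣∣-proper : ∀ {m} (A : Subset m) → ∣ A ∣ˢ ℕ.< m → ∃ λ i → Vec.lookup A i ≡ false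
    ∣∣-proper (false Vec.∷ A) lt = Fin.zero , refl
    ∣∣-proper (true Vec.∷ A) (s≤s lt) = let i , e = ∣∣-proper A lt in Fin.suc i , e

    ∣∣-insert : ∀ {m} (A : Subset m) i → Vec.lookup A i ≡ false → ∣ A Vec.[ i ]≔ true ∣ˢ ≡ suc ∣ A ∣ˢ
    ∣∣-insert (false Vec.∷ A) Fin.zero e = refl
    ∣∣-insert (true Vec.∷ A) (Fin.suc i) e = cong suc (∣∣-insert A i e)
    ∣∣-insert (false Vec.∷ A) (Fin.suc i) e = ∣∣-insert A i e

    lookup-ext : ∀ {m} (A B : Subset m) → (∀ i → Vec.lookup A i ≡ Vec.lookup B i) → A ≡ B
    lookup-ext Vec.[] Vec.[] h = refl
    lookup-ext (a Vec.∷ A) (b Vec.∷ B) h = cong₂ Vec._∷_ (h Fin.zero) (lookup-ext A B (h ∘ Fin.suc))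

    proper : ∀ (A : Subset n) → ∣ A ∣ˢ ℕ.≤ K → ∃ λ i → Vec.lookup A i ≡ false
    proper A le = ∣∣-proper A (s≤s le)

    proper⇒≢⊤ : ∀ (A : Subset n) → ∣ A ∣ˢ ℕ.≤ K → A ≢ full
    proper⇒≢⊤ A le refl = ℕₚ.<-irrefl (∣⊤∣≡n n) (s≤s le)

    ∼cl⇒≡ : ∀ {p i} → p ∼ i → cl p ≡ i
    ∼cl⇒≡ {p} a = ∼-unique (∼cl p) a

    Any∼⇒∈ : ∀ {p as} → p ∼∈ as → cl p ∈ as
    Any∼⇒∈ = Any.map ∼cl⇒≡

    ∈⇒Any∼ : ∀ {p as} → cl p ∈ as → p ∼∈ as
    ∈⇒Any∼ {p} = Any.map (λ e → subst (p ∼_) e (∼cl p))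

    -- Finite comprehension for an arbitrary predicate, available because the goal is an equality of
    -- integers: one use of `classical` for each element.
    subset-choice : ∀ {m} (P : Fin m → Set) {a b : ℤ} →
      ((E : Subset m) → (∀ i → Vec.lookup E i ≡ true → P i) → (∀ i → Vec.lookup E i ≡ false → ¬ P i) → a ≡ b) →
        a ≡ b
    subset-choice {zero} P h = h Vec.[] (λ ()) (λ ())
    subset-choice {suc m} P {a} {b} h = classical (P Fin.zero)
      (λ p → subset-choice (P ∘ Fin.suc)
        (λ E yes′ no′ → h (true Vec.∷ E) (λ { Fin.zero _ → p ; (Fin.suc i) → yes′ i })
        (λ { Fin.zero () ; (Fin.suc i) → no′ i })))
      (λ np → subset-choice (P ∘ Fin.suc)
        (λ E yes′ no′ → h (false Vec.∷ E) (λ { Fin.zero () ; (Fin.suc i) → yes′ i })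
        (λ { Fin.zero _ → np ; (Fin.suc i) → no′ i })))

    -- `allSubsets` places the two extensions of each smaller subset side by side, so they are added
    -- up first and the induction runs on the sums `ψ`.
    sum-subsets : ∀ m (φ : Subset m → ℤ) E → (∀ A → A ≢ E → φ A ≡ 0ℤ) → sumOver φ (allSubsets K m) ≡ φ E
    sum-subsets zero φ Vec.[] h = ℤₚ.+-identityʳ (φ Vec.[])
    sum-subsets (suc m) φ (b Vec.∷ E) h = trans (pair-up (allSubsets K m))
      (trans (sum-subsets m ψ E zero′) (at-E b refl))
      where
      ψ : Subset m → ℤ
      ψ A = φ (false Vec.∷ A) + φ (true Vec.∷ A)
      pair-up : ∀ L → sumOver φ (concatMap (λ A → (false Vec.∷ A) ∷ (true Vec.∷ A) ∷ []) L) ≡ sumOver ψ L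
      pair-up [] = refl
      pair-up (A ∷ L) = trans (cong (λ z → φ (false Vec.∷ A) + (φ (true Vec.∷ A) + z)) (pair-up L))
        (sym (ℤₚ.+-assoc (φ (false Vec.∷ A)) (φ (true Vec.∷ A)) (sumOver ψ L)))
      tail≢ : ∀ {a A} → A ≢ E → a Vec.∷ A ≢ b Vec.∷ E
      tail≢ ne refl = ne refl
      zero′ : ∀ A → A ≢ E → ψ A ≡ 0ℤ
      zero′ A ne = cong₂ _+_ (h (false Vec.∷ A) (tail≢ ne)) (h (true Vec.∷ A) (tail≢ ne))
      at-E : ∀ b′ → b ≡ b′ → ψ E ≡ φ (b Vec.∷ E)
      at-E true refl = trans (cong (_+ φ (true Vec.∷ E)) (h (false Vec.∷ E) (λ ()))) (ℤₚ.+-identityˡ _)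
      at-E false refl = trans (cong (_+_ (φ (false Vec.∷ E))) (h (true Vec.∷ E) (λ ()))) (ℤₚ.+-identityʳ _)

    sum-zero-on : ∀ (φ : ℕ → ℤ) L → (∀ t → t ∈ L → φ t ≡ 0ℤ) → sumOver φ L ≡ 0ℤ
    sum-zero-on φ [] h = refl
    sum-zero-on φ (x ∷ L) h = cong₂ _+_ (h x (here refl)) (sum-zero-on φ L (λ t → h t ∘ there))

    sum-unique : ∀ (φ : ℕ → ℤ) a L → Unique L → a ∈ L → (∀ t → t ≢ a → φ t ≡ 0ℤ) → sumOver φ L ≡ φ a
    sum-unique φ a (x ∷ L) (nx ∷ u) (here refl) h =
      trans (cong (_+_ (φ a)) (sum-zero-on φ L (λ t t∈L → h t (λ e → All.lookup nx t∈L (sym e)))))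
      (ℤₚ.+-identityʳ (φ a))
    sum-unique φ a (x ∷ L) (nx ∷ u) (there a∈L) h =
      trans (cong₂ _+_ (h x (All.lookup nx a∈L)) (sum-unique φ a L u a∈L h)) (ℤₚ.+-identityˡ (φ a))

    dom-word : ∀ as ws → CyclicallyDecreasing as → Dom as (c (as ++ ws)) (c ws)
    dom-word [] ws cd p = (λ ()) , (λ _ → ℕₚ.≤-refl)
    dom-word (i ∷ as) ws cd = dom-untail {C′ = c (as ++ ws)} cd (c-Step (i ∷ as ++ ws))
      (λ na → sym (c-off i (as ++ ws) na)) (dom-word as ws (proj₂ cd))

    dom-≼ : ∀ {as C C′ d} → C′ ≼ C → Dom as C d → Dom as C′ d
    dom-≼ le dom p = (λ m → ℕₚ.≤-trans (le p) (proj₁ (dom p) m)) , (λ nm → ℕₚ.≤-trans (le p) (proj₂ (dom p) nm))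

    first-outside : ∀ (P : ℕ → Bool) T → P T ≡ false → ∃ λ t → P t ≡ false × (∀ r → r ℕ.< t → P r ≡ true)
    first-outside P T e = pick (search T)
      where
      search : ∀ T → (∀ r → r ℕ.< T → P r ≡ true) ⊎ (∃ λ t → P t ≡ false × (∀ r → r ℕ.< t → P r ≡ true))
      search zero = inj₁ λ _ ()
      search (suc T) with search T
      ... | inj₂ found = inj₂ found
      ... | inj₁ all with P T in eq
      ...   | false = inj₂ (T , eq , all)
      ...   | true = inj₁ (λ r lt → extend r (ℕₚ.m≤n⇒m<n∨m≡n (ℕₚ.≤-pred lt)))
        where
        extend : ∀ r → r ℕ.< T ⊎ r ≡ T → P r ≡ true
        extend r (inj₁ lt) = all r lt
        extend r (inj₂ refl) = eq
      pick : (∀ r → r ℕ.< T → P r ≡ true) ⊎ (∃ λ t → P t ≡ false × (∀ r → r ℕ.< t → P r ≡ true)) → ∃ λ t →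
        P t ≡ false × (∀ r → r ℕ.< t → P r ≡ true)
      pick (inj₁ all) = T , e , all
      pick (inj₂ found) = found

    reaches : ∀ m i → ∃ λ t → cl (m + + t) ≡ i
    reaches m i = t₀ , ∼cl⇒≡ (- q , l₁ (+ toℕ i) m (+ t₀) q N (a≡a%ℕn+[a/ℕn]*n (+ toℕ i - m) n))
      where
      t₀ : ℕ
      t₀ = (+ toℕ i - m) %ℕ n
      q : ℤ
      q = (+ toℕ i - m) /ℕ n
      l₁ : ∀ i m t q k → i - m ≡ t + q * k → m + t ≡ i + - q * k
      l₁ i m t q k e = trans (l₂ m t q k) (trans (cong (λ z → m + z + - q * k) (sym e)) (l₃ i m q k))
        where
        l₂ : ∀ m t q k → m + t ≡ m + (t + q * k) + - q * k
        l₂ = solve-∀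
        l₃ : ∀ i m q k → m + (i - m) + - q * k ≡ i + - q * k
        l₃ = solve-∀

    -- The search descends from the site `length ws`, where the count is zero, to - `length ws` - 1,
    -- where `c-far` makes it positive.
    last-bead : ∀ ws → ∃ λ m → (∀ q → m ≤ q → c ws q ≡ 0) × (∀ q → q < m → 1 ℕ.≤ c ws q)
    last-bead ws = let m , z , o = search (suc (length ws ℕ.+ length ws)) (c-vanishes ws _ (ℤₚ.≤-reflexive (l (+ length ws)))) in
        m , (λ q le → ℕₚ.n≤0⇒n≡0 (subst (c ws q ℕ.≤_) z (step-anti (c-Step ws) le))) ,
        (λ q lt → ℕₚ.≤-trans o (step-anti (c-Step ws) (≤⇒ (<⇒≤1 lt) (l₂ q m))))
      where
      b : ℤ
      b = -[1+ length ws ]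
      l₂ : ∀ q m → m - 1ℤ - q ≡ m - (q + 1ℤ)
      l₂ = solve-∀
      l : ∀ a → a ≡ - (1ℤ + a) + (1ℤ + (a + a))
      l = solve-∀
      l₃ : ∀ b t → b + t ≡ b + (1ℤ + t) - 1ℤ
      l₃ = solve-∀
      search : ∀ t → c ws (b + + t) ≡ 0 → ∃ λ m → c ws m ≡ 0 × 1 ℕ.≤ c ws (m - 1ℤ)
      search zero z = ⊥-elim (ℕₚ.1+n≢0
        (trans (sym (c-far ws (length ws) ℕₚ.≤-refl)) (trans (cong (c ws) (sym (ℤₚ.+-identityʳ b))) z)))
      search (suc t) z with c ws (b + + t) in eq
      ... | zero = search t eq
      ... | suc _ = b + + suc t , z , subst (λ v → 1 ℕ.≤ c ws v) (l₃ b (+ t))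
        (subst (1 ℕ.≤_) (sym eq) (s≤s z≤n))

  -- Enlarging A to a prescribed size

  DomS : Subset n → (ℤ → ℕ) → (ℤ → ℕ) → Set
  DomS A C d = ∀ p → (Vec.lookup A (cl p) ≡ true → C p ℕ.≤ suc (d (p + 1ℤ))) ×
    (Vec.lookup A (cl p) ≡ false → C p ℕ.≤ d p)

  -- The positive form of `Excess`: `realize` needs actual sites at which its letters jump.
  Witnessed : Subset n → (ℤ → ℕ) → (ℤ → ℕ) → Set
  Witnessed A C d = ∀ i → Vec.lookup A i ≡ true → ∃ λ p → p ∼ i × d p ℕ.< C p

  bump : ℤ → ℤ → ℕ
  bump m p = if does (p ℤₚ.≤? m) then 1 else 0

  abstract
    true≢false : ∀ {b} → b ≡ true → ¬ b ≡ false
    true≢false refl ()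

    bool : ∀ b → b ≡ true ⊎ b ≡ false
    bool true = inj₁ refl
    bool false = inj₂ refl

    bump-≤ : ∀ {m p} → p ≤ m → bump m p ≡ 1
    bump-≤ {m} {p} le with p ℤₚ.≤? m
    ... | yes _ = refl
    ... | no n = ⊥-elim (n le)

    bump≤1 : ∀ m p → bump m p ℕ.≤ 1
    bump≤1 m p with p ℤₚ.≤? m
    ... | yes _ = ℕₚ.≤-refl
    ... | no _ = z≤n

    bump≤ : ∀ m p {a} → (p ≤ m → 1 ℕ.≤ a) → bump m p ℕ.≤ a
    bump≤ m p h with p ℤₚ.≤? m
    ... | yes le = h le
    ... | no _ = z≤n

    -- The last bead is at m. Adding the first missing letter m + t lets it travel
    -- on to m + t + 1, which is what the bump records.
    enlarge-at : ∀ ws A {C} m t → (∀ q → m ≤ q → c ws q ≡ 0) → (∀ q → q < m → 1 ℕ.≤ c ws q) →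
      Vec.lookup A (cl (m + + t)) ≡ false → (∀ r → r ℕ.< t → Vec.lookup A (cl (m + + r)) ≡ true) →
      Step C → DomS A C (c ws) → Witnessed A C (c ws) →
      ∃ λ A′ → ∃ λ C′ → ∣ A′ ∣ˢ ≡ suc ∣ A ∣ˢ × Step C′ × C ≼ C′ × DomS A′ C′ (c ws) × Witnessed A′ C′ (c ws)
    enlarge-at ws A {C} m t vanish occupied i₁∉A before st dom wit = A′ , C′ , ∣∣-insert A i₁ i₁∉A , st′ ,
      (λ p → ℕₚ.m≤m⊔n (C p) _) , dom′ , wit′
      where
      i₁ : Fin n
      i₁ = cl (m + + t)
      l : ∀ m t → m + t - m ≡ t - 0ℤ
      l = solve-∀
      A′ : Subset n
      A′ = A Vec.[ i₁ ]≔ true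
      C′ : ℤ → ℕ
      C′ p = C p ℕ.⊔ bump (m + + t) p
      at-i₁ : Vec.lookup A′ i₁ ≡ true
      at-i₁ = Vecₚ.lookup∘updateAt i₁ A
      keep : ∀ i → Vec.lookup A i ≡ true → Vec.lookup A′ i ≡ true
      keep i e = trans (Vecₚ.lookup∘updateAt′ i i₁ (λ { refl → true≢false e i₁∉A }) A) e
      st′ : Step C′
      st′ p = ℕₚ.⊔-mono-≤ (proj₁ (st p))
        (bump≤ (m + + t) (p + 1ℤ) (λ le → ℕₚ.≤-reflexive
        (sym (bump-≤ {m + + t} {p} (ℤₚ.≤-trans (ℤₚ.<⇒≤ (p<p+1 p)) le))))) ,
        ℕₚ.⊔-lub (ℕₚ.≤-trans (proj₂ (st p)) (s≤s (ℕₚ.m≤m⊔n (C (p + 1ℤ)) _)))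
          (ℕₚ.≤-trans (bump≤1 (m + + t) p) (s≤s z≤n))
      dom′ : DomS A′ C′ (c ws)
      dom′ p = in′ , out′
        where
        in′ : Vec.lookup A′ (cl p) ≡ true → C′ p ℕ.≤ suc (c ws (p + 1ℤ))
        in′ _ = ℕₚ.⊔-lub by (ℕₚ.≤-trans (bump≤1 (m + + t) p) (s≤s z≤n))
          where
          by : C p ℕ.≤ suc (c ws (p + 1ℤ))
          by with bool (Vec.lookup A (cl p))
          ... | inj₁ e = proj₁ (dom p) e
          ... | inj₂ e = ℕₚ.≤-trans (proj₂ (dom p) e) (proj₂ (c-Step ws p))
        out′ : Vec.lookup A′ (cl p) ≡ false → C′ p ℕ.≤ c ws p
        out′ e = ℕₚ.⊔-lub by (bump≤ (m + + t) p low)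
          where
          by : C p ℕ.≤ c ws p
          by with bool (Vec.lookup A (cl p))
          ... | inj₁ e′ = ⊥-elim (true≢false (keep (cl p) e′) e)
          ... | inj₂ e′ = proj₂ (dom p) e′
          -- The classes of m, ..., m + t all belong to `A′`, so a site of another class that is at
          -- most m + t lies left of m and has a bead to its right.
          low : p ≤ m + + t → 1 ℕ.≤ c ws p
          low le with p ℤₚ.<? m
          ... | yes lt = occupied p lt
          ... | no ge = inside (≤⇒+ (ℤₚ.≮⇒≥ ge))
            where
            inside : (∃ λ r → p ≡ m + + r) → 1 ℕ.≤ c ws p
            inside (r , refl) with ℕₚ.<-cmp r t
            ... | tri< lt _ _ = ⊥-elim (true≢false (keep (cl p) (before r lt)) e)
            ... | tri≈ _ refl _ = ⊥-elim (true≢false at-i₁ e)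
            ... | tri> _ _ gt = ⊥-elim (ℤₚ.<-irrefl refl (ℤₚ.<-≤-trans (ℤₚ.+-monoʳ-< m (+<+ gt)) le))
      wit′ : Witnessed A′ C′ (c ws)
      wit′ i e with i Finₚ.≟ i₁
      ... | yes refl = m + + t , ∼cl (m + + t) , subst (ℕ._< C′ (m + + t))
        (sym (vanish (m + + t) (≤⇒ {0ℤ} {+ t} (+≤+ z≤n) (l m (+ t)))))
            (ℕₚ.≤-trans (ℕₚ.≤-reflexive (sym (bump-≤ {m + + t} {m + + t} ℤₚ.≤-refl)))
              (ℕₚ.m≤n⊔m (C (m + + t)) _))
      ... | no ne = let p , a , lt = wit i (trans (sym (Vecₚ.lookup∘updateAt′ i i₁ ne A)) e) in p , a , ℕₚ.<-≤-trans lt (ℕₚ.m≤m⊔n (C p) _)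

  Enlargement : Word → Subset n → (ℤ → ℕ) → ℕ → Set
  Enlargement ws A C e = ∃ λ A′ → ∃ λ C′ → ∣ A′ ∣ˢ ≡ e × Step C′ × C ≼ C′ × DomS A′ C′ (c ws) × Witnessed A′ C′
    (c ws)

  abstract
    enlarge : ∀ ws A {C} → (∃ λ i → Vec.lookup A i ≡ false) → Step C → DomS A C (c ws) → Witnessed A C (c ws) →
      Enlargement ws A C (suc ∣ A ∣ˢ)
    enlarge ws A {C} (i₀ , out) st dom wit = go (last-bead ws)
      where
      go : (∃ λ m → (∀ q → m ≤ q → c ws q ≡ 0) × (∀ q → q < m → 1 ℕ.≤ c ws q)) → Enlargement ws A C (suc ∣ A ∣ˢ)
      go (m , vanish , occupied) = pick (reaches m i₀)
        where
        place : (∃ λ t → Vec.lookup A (cl (m + + t)) ≡ false ×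
          (∀ r → r ℕ.< t → Vec.lookup A (cl (m + + r)) ≡ true)) → Enlargement ws A C (suc ∣ A ∣ˢ)
        place (t , free , before) = enlarge-at ws A m t vanish occupied free before st dom wit
        pick : (∃ λ t → cl (m + + t) ≡ i₀) → Enlargement ws A C (suc ∣ A ∣ˢ)
        pick (t , e) = place (first-outside (λ t → Vec.lookup A (cl (m + + t))) t
          (trans (cong (Vec.lookup A) e) out))

    enlarge-to : ∀ ws e A {C} → ∣ A ∣ˢ ℕ.+ e ℕ.≤ K → Step C → DomS A C (c ws) → Witnessed A C (c ws) →
      Enlargement ws A C (∣ A ∣ˢ ℕ.+ e)
    enlarge-to ws zero A {C} le st dom wit = A , C , sym (ℕₚ.+-identityʳ _) , st , (λ p → ℕₚ.≤-refl) , dom , wit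
    enlarge-to ws (suc e) A {C} le st dom wit = again
      (enlarge ws A (proper A (ℕₚ.≤-trans (ℕₚ.m≤m+n _ _) le)) st dom wit)
      where
      again : Enlargement ws A C (suc ∣ A ∣ˢ) → Enlargement ws A C (∣ A ∣ˢ ℕ.+ suc e)
      again (A₁ , C₁ , s₁ , st₁ , le₁ , dom₁ , wit₁) = finish
        (enlarge-to ws e A₁ (ℕₚ.≤-trans (ℕₚ.≤-reflexive eq) le) st₁ dom₁ wit₁)
        where
        eq : ∣ A₁ ∣ˢ ℕ.+ e ≡ ∣ A ∣ˢ ℕ.+ suc e
        eq = trans (cong (ℕ._+ e) s₁) (sym (ℕₚ.+-suc ∣ A ∣ˢ e))
        finish : Enlargement ws A₁ C₁ (∣ A₁ ∣ˢ ℕ.+ e) → Enlargement ws A C (∣ A ∣ˢ ℕ.+ suc e)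
        finish (A₂ , C₂ , s₂ , st₂ , le₂ , dom₂ , wit₂) = A₂ , C₂ , trans s₂ eq , st₂ ,
          (λ p → ℕₚ.≤-trans (le₁ p) (le₂ p)) , dom₂ , wit₂

  -- The product with a fixed partition, compared with its weak strips

  module Main (la : List ℕ) (pk : Pk K la) (r : ℕ) (r≤K : r ℕ.≤ K) (F : FSum K)
    (ind : IsIndicator K F (GSupp K la)) where

    L : Word
    L = readingWord K la

    D : Diagram la
    D = diagram la pk

    d : ℤ → ℕ
    d = c L

    abstract
      gsupp⇒ : ∀ {x} → GSupp K la x → ∃ λ xs → prod K xs ≡ x × Sorted xs × c xs ≼ d
      gsupp⇒ (mu , pkmu , bru , eq) = readingWord K mu , eq , Diagram.sorted (diagram mu pkmu) , bruhat⇒≼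
        (readingWord K mu) L bru

      ⇒gsupp : ∀ xs → Sorted xs → c xs ≼ d → GSupp K la (prod K xs)
      ⇒gsupp xs so le =
        let mu , pkmu , e = sorted⇒partition xs so
        in mu , pkmu , ≼⇒bruhat (readingWord K mu) L (Diagram.red D) (Diagram.sorted (diagram mu pkmu))
             (λ p → subst (ℕ._≤ d p) (sym (c-f (readingWord K mu) xs e p)) (le p)) , f⇒prod
               (readingWord K mu) xs e

      supp : ∀ w → ¬ (∃ λ ws → prod K ws ≡ w) → coeff K w F ≡ 0ℤ
      supp w nw = proj₂ (ind w) (λ gs → let xs , e , _ = gsupp⇒ gs in nw (xs , e))

    open Supported F supp

    abstract
      F̂-indicates : ∀ y → Sorted y → Indicates (F̂ y) (c y ≼ d)
      F̂-indicates y so = indicates-⇔ (λ gs p → let xs , e , _ , le = gsupp⇒ gs in subst (ℕ._≤ d p) (c-f xs y (prod⇒f xs y e) p) (le p)) (⇒gsupp y so) (ind (prod K y))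

      strip⇒ : ∀ {x} → StripSupp K la r x → ∃ λ xs → prod K xs ≡ x × Sorted xs ×
        (∃ λ A → ∣ A ∣ˢ ≡ r × Dom (cdWord K A) (c xs) d)
      strip⇒ (mu , pkmu , eq , ka , pkka , (A , _ , size , ka≡ , _) , bru) =
        readingWord K mu , eq , Diagram.sorted (diagram mu pkmu) , A , size ,
        dom-≼ le (dom-word (cdWord K A) L
          (Letters.cd-decreasing A (proper A (ℕₚ.≤-trans (ℕₚ.≤-reflexive size) r≤K))))
        where
        le : c (readingWord K mu) ≼ c (cdWord K A ++ L)
        le p = subst (c (readingWord K mu) p ℕ.≤_)
          (c-f (readingWord K ka) (cdWord K A ++ L)
            (prod⇒f (readingWord K ka) (cdWord K A ++ L) (trans ka≡ (sym (prod-++ (cdWord K A) L)))) p)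
          (bruhat⇒≼ (readingWord K mu) (readingWord K ka) bru p)

      -- If A has fewer than r elements, `enlarge-to` adds letters while raising the target
      -- function; `realize` then turns the target into d_A w_λ above x. That each letter adds one
      -- to the length is what the left weak order asks for.
      ⇒strip : ∀ xs → Sorted xs → ∀ A → ∣ A ∣ˢ ℕ.≤ r → DomS A (c xs) d → Witnessed A (c xs) d → StripSupp K la r
        (prod K xs)
      ⇒strip xs so A le dom wit = build
        (enlarge-to L (r ∸ ∣ A ∣ˢ) A (ℕₚ.≤-trans (ℕₚ.≤-reflexive (ℕₚ.m+[n∸m]≡n le)) r≤K) (c-Step xs) dom wit)
        (sorted⇒partition xs so)
        where
        build : Enlargement L A (c xs) (∣ A ∣ˢ ℕ.+ (r ∸ ∣ A ∣ˢ)) →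
          (∃ λ mu → Pk K mu × (∀ p → f (readingWord K mu) p ≡ f xs p)) → StripSupp K la r (prod K xs)
        build (A′ , C , size , st , le′ , dom′ , wit′) (mu , pkmu , eμ) = place
          (realize L as (Letters.cd-decreasing A′ nf) st word-dom
          (All.tabulate (λ {i} m → wit′ i (Letters.∈-cd⁻ A′ nf m))) (Diagram.sorted D))
          where
          as : Word
          as = cdWord K A′
          size′ : ∣ A′ ∣ˢ ≡ r
          size′ = trans size (ℕₚ.m+[n∸m]≡n le)
          small : ∣ A′ ∣ˢ ℕ.≤ K
          small = ℕₚ.≤-trans (ℕₚ.≤-reflexive size′) r≤K
          nf : ∃ λ i → Vec.lookup A′ i ≡ false
          nf = proper A′ small
          outside : ∀ {p} → ¬ p ∼∈ as → Vec.lookup A′ (cl p) ≡ false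
          outside {p} nm with bool (Vec.lookup A′ (cl p))
          ... | inj₁ e = ⊥-elim (nm (∈⇒Any∼ (Letters.∈-cd⁺ A′ nf e)))
          ... | inj₂ e = e
          word-dom : Dom as C d
          word-dom p = (λ m → proj₁ (dom′ p) (Letters.∈-cd⁻ A′ nf (Any∼⇒∈ m))) ,
            (λ nm → proj₂ (dom′ p) (outside nm))
          place : C ≼ c (as ++ L) × Sorted (as ++ L) × ℓ (as ++ L) ≡ length as ℕ.+ ℓ L → StripSupp K la r
            (prod K xs)
          place (up , so′ , len≡) = finish (sorted⇒partition (as ++ L) so′)
            where
            finish : (∃ λ ka → Pk K ka × (∀ p → f (readingWord K ka) p ≡ f (as ++ L) p)) → StripSupp K la r
              (prod K xs)
            finish (ka , pkka , eκ) = mu , pkmu , f⇒prod (readingWord K mu) xs eμ , ka , pkka ,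
              (A′ , proper⇒≢⊤ A′ small , size′ , trans κ≡ (prod-++ as L) , subst (LeftWeak K (prod K L))
                (sym κ≡) (leftWeak as L len≡)) ,
              ≼⇒bruhat (readingWord K mu) (readingWord K ka) (Diagram.red (diagram ka pkka))
                (Diagram.sorted (diagram mu pkmu))
                (λ p → subst₂ ℕ._≤_ (sym (c-f (readingWord K mu) xs eμ p))
                  (sym (c-f (readingWord K ka) (as ++ L) eκ p)) (ℕₚ.≤-trans (le′ p) (up p)))
              where
              κ≡ : prod K (readingWord K ka) ≡ prod K (as ++ L)
              κ≡ = f⇒prod (readingWord K ka) (as ++ L) eκ

    -- E collects the classes on which c xs exceeds d; no other subset contributes to the coefficient at xs.
    module AtPoint (xs : Word) (so : Sorted xs) (E : Subset n)
      (exceeds : ∀ i → Vec.lookup E i ≡ true → ¬ (∀ p → p ∼ i → c xs p ℕ.≤ d p))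
      (bounded : ∀ i → Vec.lookup E i ≡ false → ¬ ¬ (∀ p → p ∼ i → c xs p ℕ.≤ d p)) where

      val : ℤ
      val = U (cdWord K E) F̂ xs

      V : ℕ → ℤ
      V t = coeff K (prod K xs) (hmul K t F)

      abstract
        outside≤ : ∀ p → Vec.lookup E (cl p) ≡ false → c xs p ℕ.≤ d p
        outside≤ p e = decidable-stable (c xs p ℕₚ.≤? d p)
          (λ nle → bounded (cl p) e (λ all → nle (all p (∼cl p))))

        indicates : ∀ A → (∃ λ i → Vec.lookup A i ≡ false) → Indicates (U (cdWord K A) F̂ xs)
          (Dom (cdWord K A) (c xs) d × Excess (cdWord K A) (c xs) d)
        indicates A nf = U-indicates (c-Step L) F̂-indicates (cdWord K A) (Letters.cd-decreasing A nf) xs so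

        -- A class in A but not in E contradicts `Excess`, and one in E but not in A contradicts
        -- `Dom`.
        forced : ∀ A → (nf : ∃ λ i → Vec.lookup A i ≡ false) → Dom (cdWord K A) (c xs) d × Excess (cdWord K A)
          (c xs) d → A ≡ E
        forced A nf (dom , ex) = lookup-ext A E each
          where
          each : ∀ i → Vec.lookup A i ≡ Vec.lookup E i
          each i with bool (Vec.lookup A i) | bool (Vec.lookup E i)
          ... | inj₁ a | inj₁ b = trans a (sym b)
          ... | inj₂ a | inj₂ b = trans a (sym b)
          ... | inj₁ a | inj₂ b = ⊥-elim (bounded i b (All.lookup ex (Letters.∈-cd⁺ A nf a)))
          ... | inj₂ a | inj₁ b = ⊥-elim
            (exceeds i b (λ p p∼ → proj₂ (dom p)
            (λ m → true≢false (Letters.∈-cd⁻ A nf (subst (_∈ cdWord K A) (∼cl⇒≡ p∼) (Any∼⇒∈ m))) a)))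

        other : ∀ A → (∃ λ i → Vec.lookup A i ≡ false) → A ≢ E → U (cdWord K A) F̂ xs ≡ 0ℤ
        other A nf ne = proj₂ (indicates A nf) (ne ∘ forced A nf)

        contribution-other : ∀ t A → A ≢ E → contribution t xs A ≡ 0ℤ
        contribution-other t A ne = by (admissible t A) refl
          where
          by : ∀ b → admissible t A ≡ b → (if b then U (cdWord K A) F̂ xs else 0ℤ) ≡ 0ℤ
          by false _ = refl
          by true adm = other A (not-full A (proj₂ (admissible-true t A adm))) ne

        V-suc : ∀ t → V (suc t) ≡ contribution (suc t) xs E
        V-suc t = trans (hmul-good t xs (sorted⇒grass xs so))
          (sum-subsets n (contribution (suc t) xs) E (contribution-other (suc t)))

        V-off : ∀ t → t ≢ ∣ E ∣ˢ → V t ≡ 0ℤ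
        V-off zero ne = proj₂ (F̂-indicates xs so) (λ le → nonempty le (∣∣-nonempty E (ne ∘ sym)))
          where
          nonempty : c xs ≼ d → ¬ (∃ λ i → Vec.lookup E i ≡ true)
          nonempty le (i , e) = exceeds i e (λ p _ → le p)
        V-off (suc t) ne = trans (V-suc t) (by (admissible (suc t) E) refl)
          where
          by : ∀ b → admissible (suc t) E ≡ b → (if b then U (cdWord K E) F̂ xs else 0ℤ) ≡ 0ℤ
          by false _ = refl
          by true adm = ⊥-elim (ne (sym (proj₁ (admissible-true (suc t) E adm))))

        V-on : ∀ t → t ≡ ∣ E ∣ˢ → t ℕ.≤ K → V t ≡ val
        -- For t = 0 the factor is h_0 = 1, and a coefficient of `F` itself is `U` along the empty
        -- word, which is the word of an empty E.
        V-on zero e le = cong (λ as → U as F̂ xs)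
          (sym (empty-word (cdWord K E) (trans (Letters.length-cd E (proper E (subst (ℕ._≤ K) e le))) (sym e))))
          where
          empty-word : ∀ (as : Word) → length as ≡ 0 → as ≡ []
          empty-word [] _ = refl
        V-on (suc t) e le = trans (V-suc t) (cong (λ b → if b then val else 0ℤ) (admissible-intro (suc t) E (sym e) (let i , out = proper E (subst (ℕ._≤ K) e le) in full-false E i out)))

        total : coeff K (prod K xs) (htilde K r F) ≡ sumOver V (upTo (suc r))
        total = coeff-concatMap (λ t → hmul K t F) (prod K xs) (upTo (suc r))

        total-small : ∣ E ∣ˢ ℕ.≤ r → coeff K (prod K xs) (htilde K r F) ≡ val
        total-small le = trans total (trans
          (sum-unique V ∣ E ∣ˢ (upTo (suc r)) (upTo⁺ (suc r)) (∈-upTo⁺ (s≤s le)) V-off)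
          (V-on ∣ E ∣ˢ refl (ℕₚ.≤-trans le r≤K)))

        total-large : ¬ ∣ E ∣ˢ ℕ.≤ r → coeff K (prod K xs) (htilde K r F) ≡ 0ℤ
        total-large nle = trans total (sum-zero-on V (upTo (suc r))
          (λ t t∈ → V-off t (λ { refl → nle (ℕₚ.≤-pred (∈-upTo⁻ t∈)) })))

        E⊆ : ∀ A → ∣ A ∣ˢ ℕ.≤ K → Dom (cdWord K A) (c xs) d → ∀ i → Vec.lookup E i ≡ true →
          Vec.lookup A i ≡ true
        E⊆ A small dom i e with bool (Vec.lookup A i)
        ... | inj₁ a = a
        ... | inj₂ a = ⊥-elim (exceeds i e
          (λ p p∼ → proj₂ (dom p) (λ m → true≢false
          (Letters.∈-cd⁻ A (proper A small) (subst (_∈ cdWord K A) (∼cl⇒≡ p∼) (Any∼⇒∈ m))) a)))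

        -- Domination through A forces E to be contained in A, so E has at most r elements, of
        -- whatever number. The sum h_0 + ... + h_r contains exactly one term for that number.
        one : (∃ λ A → ∣ A ∣ˢ ≡ r × Dom (cdWord K A) (c xs) d) → coeff K (prod K xs) (htilde K r F) ≡ 1ℤ
        one (A , size , dom) = trans (total-small E≤r)
          (proj₁ (indicates E nfE) (domE , All.tabulate (λ {i} m → exceeds i (Letters.∈-cd⁻ E nfE m))))
          where
          smallA : ∣ A ∣ˢ ℕ.≤ K
          smallA = ℕₚ.≤-trans (ℕₚ.≤-reflexive size) r≤K
          E≤r : ∣ E ∣ˢ ℕ.≤ r
          E≤r = subst (∣ E ∣ˢ ℕ.≤_) size (∣∣-mono E A (E⊆ A smallA dom))
          nfE : ∃ λ i → Vec.lookup E i ≡ false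
          nfE = proper E (ℕₚ.≤-trans E≤r r≤K)
          domE : Dom (cdWord K E) (c xs) d
          domE p = (λ m → proj₁ (dom p) (∈⇒Any∼
            (Letters.∈-cd⁺ A (proper A smallA) (E⊆ A smallA dom (cl p) (Letters.∈-cd⁻ E nfE (Any∼⇒∈ m)))))) ,
            out
            where
            out : ¬ p ∼∈ cdWord K E → c xs p ℕ.≤ d p
            out nm with bool (Vec.lookup E (cl p))
            ... | inj₁ e = ⊥-elim (nm (∈⇒Any∼ (Letters.∈-cd⁺ E nfE e)))
            ... | inj₂ e = outside≤ p e

        -- Double negation passes through a quantifier over finitely many classes; since a
        -- contradiction is being sought, this turns `exceeds` into `Witnessed`.
        witnesses : ∀ {m} (A : Subset m) (P : Fin m → Set) → (∀ i → Vec.lookup A i ≡ true → ¬ ¬ P i) → ¬ ¬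
          (∀ i → Vec.lookup A i ≡ true → P i)
        witnesses Vec.[] P h k = k (λ ())
        witnesses (false Vec.∷ A) P h k = witnesses A (P ∘ Fin.suc) (h ∘ Fin.suc)
          (λ all → k (λ { Fin.zero () ; (Fin.suc i) → all i }))
        witnesses (true Vec.∷ A) P h k = h Fin.zero refl
          (λ p → witnesses A (P ∘ Fin.suc) (h ∘ Fin.suc)
          (λ all → k (λ { Fin.zero _ → p ; (Fin.suc i) → all i })))

        none : ¬ StripSupp K la r (prod K xs) → coeff K (prod K xs) (htilde K r F) ≡ 0ℤ
        none ns with ∣ E ∣ˢ ℕₚ.≤? r
        ... | no nle = total-large nle
        ... | yes le = trans (total-small le) (proj₂ (indicates E nfE) contra)
          where
          nfE : ∃ λ i → Vec.lookup E i ≡ false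
          nfE = proper E (ℕₚ.≤-trans le r≤K)
          contra : ¬ (Dom (cdWord K E) (c xs) d × Excess (cdWord K E) (c xs) d)
          contra (dom , _) = witnesses E (λ i → ∃ λ p → p ∼ i × d p ℕ.< c xs p)
              (λ i e nw → exceeds i e (λ p p∼ → ℕₚ.≮⇒≥ (λ lt → nw (p , p∼ , lt))))
              (λ wit → ns (⇒strip xs so E le
                (λ p → (λ e → proj₁ (dom p) (∈⇒Any∼ (Letters.∈-cd⁺ E nfE e))) , outside≤ p) wit))

    abstract
      absent : ∀ x → ¬ (∃ λ xs → prod K xs ≡ x × Sorted xs) → coeff K x (htilde K r F) ≡ 0ℤ
      absent x nx = trans (coeff-concatMap (λ t → hmul K t F) x (upTo (suc r)))
        (sum-zero-on (λ t → coeff K x (hmul K t F)) (upTo (suc r)) (λ t _ → each t))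
        where
        each : ∀ t → coeff K x (hmul K t F) ≡ 0ℤ
        each zero = proj₂ (ind x) (λ gs → let xs , e , so , _ = gsupp⇒ gs in nx (xs , e , so))
        each (suc t) = hmul-bad t x (λ { zs refl gr → nx (zs , refl , grass⇒sorted zs gr) })

      at-point : ∀ xs → Sorted xs → (StripSupp K la r (prod K xs) → coeff K (prod K xs) (htilde K r F) ≡ 1ℤ) ×
        (¬ StripSupp K la r (prod K xs) → coeff K (prod K xs) (htilde K r F) ≡ 0ℤ)
      at-point xs so =
        (λ ss → subset-choice P (λ E ex bd → AtPoint.one xs so E ex bd (transport (strip⇒ ss)))) ,
        (λ ns → subset-choice P (λ E ex bd → AtPoint.none xs so E ex bd ns))
        where
        P : Fin n → Set
        P i = ¬ (∀ p → p ∼ i → c xs p ℕ.≤ d p)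
        transport : (∃ λ ys → prod K ys ≡ prod K xs × Sorted ys ×
          (∃ λ A → ∣ A ∣ˢ ≡ r × Dom (cdWord K A) (c ys) d)) → ∃ λ A → ∣ A ∣ˢ ≡ r × Dom (cdWord K A) (c xs) d
        transport (ys , e , _ , A , size , dom) = A , size , dom-≼
          (λ p → ℕₚ.≤-reflexive (sym (c-f ys xs (prod⇒f ys xs e) p))) dom

      result : IsIndicator K (htilde K r F) (StripSupp K la r)
      result x =
        (λ ss → let xs , e , so , _ = strip⇒ ss in subst (λ w → StripSupp K la r w → coeff K w (htilde K r F) ≡ 1ℤ) e (proj₁ (at-point xs so)) ss) ,
        (λ ns → classical (∃ λ xs → prod K xs ≡ x × Sorted xs)
          (λ { (xs , e , so) → subst (λ w → ¬ StripSupp K la r w → coeff K w (htilde K r F) ≡ 0ℤ) e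
            (proj₂ (at-point xs so)) ns })
          (absent x))

theorem1p2 : (k : ℕ) → 1 ℕ.≤ k → (la : List ℕ) → Pk k la →
    (r : ℕ) → 1 ℕ.≤ r → r ℕ.≤ k →
    (F : FSum k) → IsIndicator k F (GSupp k la) →
    IsIndicator k (htilde k r F) (StripSupp k la r)
theorem1p2 (suc j) _ la pk r _ r≤k F ind = Affine.Main.result j la pk r r≤k F ind
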